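{- (Provably in ZFC) The following are equivalent: (i) $\mathbf{Det}(\Sigma^1_1)$: every Gale–Stewart game $G(L)$ with $L\subseteq X^\omega$ an effective analytic ($\Sigma^1_1$) set, $X$ a finite alphabet, is determined; (ii) $\mathbf{Det}(\mathbf{RAT}_\omega)$: for all finite alphabets $\Sigma,\Gamma$ and every infinitary rational relation $R\subseteq \Sigma^\omega\times\Gamma^\omega$, viewed as a subset of $(\Sigma\times\Gamma)^\omega$, the Gale–Stewart game $G(R)$ is determined.
   Context: Gale–Stewart game $G(A)$ for $A\subseteq X^\omega$: Player 1 writes $a_1\in X$, Player 2 writes $b_1\in X$, Player 1 writes $a_2$, etc.; after $\omega$ steps Player 1 wins iff $a_1b_1a_2b_2\cdots\in A$. A strategy for Player 1 is a map $(X^2)^\star\to X$, for Player 2 a map $(X^2)^\star X\to X$; the game is determined if one player has a winning strategy. A 2-tape Büchi automaton is $(K,\Sigma,\Gamma,\Delta,q_0,F)$ with $K$ finite set of states, $\Delta\subseteq K\times\Sigma^\star\times\Gamma^\star\times K$ finite, $q_0$ initial, $F\subseteq K$ accepting; a computation is an infinite sequence of transitions $(q_0,u_1,v_1,q_1),(q_1,u_2,v_2,q_2),\dots$, successful if some state of $F$ occurs infinitely often; it accepts $(u,v)\in\Sigma^\omega\times\Gamma^\omega$ if $u=u_1u_2\cdots$ and $v=v_1v_2\cdots$ for some successful computation. An infinitary rational relation is a set $L(\mathcal A)\subseteq\Sigma^\omega\times\Gamma^\omega$ of pairs accepted by such an automaton; a pair $(u,v)$ is identified with the $\omega$-word over $\Sigma\times\Gamma$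 whose $i$-th letter is $(u(i),v(i))$. A set $L\subseteq X^\omega$ is $\Sigma^1_1$ if it is the projection of a $\Pi^0_2$ (arithmetical) subset of $(X\times\{0,1\})^\omega$. -}

module Defs where

open import Data.Nat using (ℕ; zero; suc; _+_; _*_; _^_; _≤_)
open import Data.Fin using (Fin; toℕ)
open import Data.Fin.Subset using (Subset; _∈_)
open import Data.Vec using (Vec; []; _∷_; lookup)
open import Data.List using (List; []; _∷_; _++_; [_]; length)
open import Data.List.Membership.Propositional using () renaming (_∈_ to _∈ₗ_)
open import Data.Product using (Σ; ∃; _×_; _,_; proj₁; proj₂)
open import Data.Sum using (_⊎_)
open import Relation.Nullary using (¬_)
open import Relation.Binary.PropositionalEquality using (_≡_)
open import Function using (_∘_)
open import Function.Bundles using (_⇔_)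

take : {A : Set} → ℕ → (ℕ → A) → List A
take zero    y = []
take (suc m) y = y 0 ∷ take m (y ∘ suc)

interleave : {A : Set} → (ℕ → A) → (ℕ → A) → (ℕ → A)
interleave f g zero    = f 0
interleave f g (suc i) = interleave g (f ∘ suc) i

Strategy₁ : Set → Set
Strategy₁ X = List (X × X) → X

Strategy₂ : Set → Set
Strategy₂ X = List (X × X) → X → X

history₁ : {X : Set} → Strategy₁ X → (ℕ → X) → ℕ → List (X × X)
history₁ σ ys zero    = []
history₁ σ ys (suc n) = history₁ σ ys n ++ [ (σ (history₁ σ ys n) , ys n) ]

play₁ : {X : Set} → Strategy₁ X → (ℕ → X) → (ℕ → X)
play₁ σ ys = interleave (λ n → σ (history₁ σ ys n)) ys

history₂ : {X : Set} → Strategy₂ X → (ℕ → X) → ℕ → List (X × X)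
history₂ τ xs zero    = []
history₂ τ xs (suc n) =
  history₂ τ xs n ++ [ (xs n , τ (history₂ τ xs n) (xs n)) ]

play₂ : {X : Set} → Strategy₂ X → (ℕ → X) → (ℕ → X)
play₂ τ xs = interleave xs (λ n → τ (history₂ τ xs n) (xs n))

Player1Wins : {X : Set} → ((ℕ → X) → Set) → Set
Player1Wins {X} A = Σ (Strategy₁ X) λ σ → ∀ (ys : ℕ → X) → A (play₁ σ ys)

Player2Wins : {X : Set} → ((ℕ → X) → Set) → Set
Player2Wins {X} A = Σ (Strategy₂ X) λ τ → ∀ (xs : ℕ → X) → ¬ A (play₂ τ xs)

Determined : {X : Set} → ((ℕ → X) → Set) → Set
Determined A = Player1Wins A ⊎ Player2Wins A

data PR : ℕ → Set where
  zer  : ∀ {n} → PR n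
  succ : PR 1
  proj : ∀ {n} → Fin n → PR n
  comp : ∀ {m n} → PR m → Vec (PR n) m → PR n
  prec : ∀ {n} → PR n → PR (suc (suc n)) → PR (suc n)

mutual
  eval : ∀ {n} → PR n → Vec ℕ n → ℕ
  eval zer        xs       = 0
  eval succ       (x ∷ []) = suc x
  eval (proj i)   xs       = lookup xs i
  eval (comp f gs) xs      = eval f (evalVec gs xs)
  eval (prec f g) (y ∷ xs) = evalRec f g y xs

  evalVec : ∀ {m n} → Vec (PR n) m → Vec ℕ n → Vec ℕ m
  evalVec []       xs = []
  evalVec (g ∷ gs) xs = eval g xs ∷ evalVec gs xs

  evalRec : ∀ {n} → PR n → PR (suc (suc n)) → ℕ → Vec ℕ n → ℕ
  evalRec f g zero    xs = eval f xs
  evalRec f g (suc y) xs = eval g (evalRec f g y xs ∷ y ∷ xs)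

-- Coding finite words (of letter codes) by natural numbers
-- code [] = 0,  code (a ∷ w) = 2^a · (2 · code w + 1)   (injective)

codeList : List ℕ → ℕ
codeList []      = 0
codeList (a ∷ w) = 2 ^ a * suc (2 * codeList w)

mapL : {A B : Set} → (A → B) → List A → List B
mapL f []       = []
mapL f (x ∷ xs) = f x ∷ mapL f xs

-- P ⊆ A^ω (letters coded by c) is Π⁰₂ if for some recursive (here:
-- primitive recursive) R, P = { y | ∀ n ∃ m  R(n, y↾m) }.
IsΠ⁰₂ : {A : Set} → (A → ℕ) → ((ℕ → A) → Set) → Set
IsΠ⁰₂ c P = Σ (PR 2) λ f →
  ∀ y → P y ⇔ (∀ (n : ℕ) → ∃ λ (m : ℕ) →
                 eval f (n ∷ codeList (mapL c (take m y)) ∷ []) ≡ 0)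

pairCode : {k : ℕ} → Fin k × Fin 2 → ℕ
pairCode (a , b) = 2 * toℕ a + toℕ b

IsΣ¹₁ : {k : ℕ} → ((ℕ → Fin k) → Set) → Set₁
IsΣ¹₁ {k} L = Σ ((ℕ → Fin k × Fin 2) → Set) λ P →
  IsΠ⁰₂ pairCode P ×
  (∀ x → L x ⇔ (∃ λ (b : ℕ → Fin 2) → P (λ i → x i , b i)))

record TwoTapeBüchi (Σₐ Γₐ : Set) : Set where
  field
    nStates : ℕ
    Δ       : List (Fin nStates × List Σₐ × List Γₐ × Fin nStates)
    q₀      : Fin nStates
    F       : Subset nStates

concatUpTo : {A : Set} → (ℕ → List A) → ℕ → List A
concatUpTo ws zero    = []
concatUpTo ws (suc n) = concatUpTo ws n ++ ws n

ConcatIs : {A : Set} → (ℕ → List A) → (ℕ → A) → Set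
ConcatIs ws u =
  (∀ n → concatUpTo ws n ≡ take (length (concatUpTo ws n)) u) ×
  (∀ i → ∃ λ n → i Data.Nat.< length (concatUpTo ws n))

module _ {Σₐ Γₐ : Set} (𝒜 : TwoTapeBüchi Σₐ Γₐ) where
  open TwoTapeBüchi 𝒜

  Transition : Set
  Transition = Fin nStates × List Σₐ × List Γₐ × Fin nStates

  src : Transition → Fin nStates
  src (p , _ , _ , _) = p

  inU : Transition → List Σₐ
  inU (_ , u , _ , _) = u

  inV : Transition → List Γₐ
  inV (_ , _ , v , _) = v

  tgt : Transition → Fin nStates
  tgt (_ , _ , _ , q) = q

  IsComputation : (ℕ → Transition) → Set
  IsComputation t =
    (∀ i → t i ∈ₗ Δ) × (src (t 0) ≡ q₀) × (∀ i → tgt (t i) ≡ src (t (suc i)))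

  Successful : (ℕ → Transition) → Set
  Successful t = ∃ λ (q : Fin nStates) →
    (q ∈ F) × (∀ n → ∃ λ m → n ≤ m × tgt (t m) ≡ q)

  Accepts : (ℕ → Σₐ) → (ℕ → Γₐ) → Set
  Accepts u v = ∃ λ (t : ℕ → Transition) →
    IsComputation t × Successful t ×
    ConcatIs (inU ∘ t) u × ConcatIs (inV ∘ t) v

DetΣ¹₁ : Set₁
DetΣ¹₁ = ∀ (k : ℕ) (L : (ℕ → Fin k) → Set) → IsΣ¹₁ L → Determined L

DetRATω : Set
DetRATω = ∀ (s g : ℕ) (𝒜 : TwoTapeBüchi (Fin s) (Fin g)) →
  Determined (λ (z : ℕ → Fin s × Fin g) → Accepts 𝒜 (proj₁ ∘ z) (proj₂ ∘ z))

{-# OPTIONS --safe #-}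
module Submission where

-- (i) ⇒ (ii): acceptance of (u , v) is a Σ¹₁ property of the word over pairs of letters; the witness
-- bits spell out a successful run, block by block, and a prefix suffices to check an initial segment.
--
-- (ii) ⇒ (i): let L = { x ∣ ∃ β ∀ n ∃ m f (n , (x , β)↾m) = 0 }. A deterministic register machine fed
-- with x and β passes through a marked state infinitely often iff the inner condition holds. In the
-- new game both players go on playing x, and Player 2 has to annotate, on both tapes, the complete
-- binary tree of all runs of the machine on x: level i lists the 2^i configurations after i steps, one
-- for each choice of β↾i. The automaton accepts if the annotation is wrong, which is visible to two
-- heads placed on an entry and on one of its children, or on a letter of x and on the level that uses
-- it. It also accepts if it can guess a branch β along which marked states recur. A head leaving the
-- chosen entry counts the entries to its right while the other head counts two entries of the next
-- level for each of them; this leads to the children of the mirror image of the chosen entry, and so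
-- each entry carries the configurations for both β↾i and its complement. Since the only correct
-- annotation is a causal function of x, winning strategies carry over to the game on L.

open import Defs
open import Data.Nat using (ℕ; zero; suc; _+_; _*_; _≤_; _<_; z≤n; s≤s)
open import Data.Nat.Properties
open import Data.Bool using (Bool; true; false; _∧_; not; if_then_else_)
open import Data.Maybe using (Maybe; just; nothing; maybe′)
open import Data.Unit using (⊤; tt)
open import Data.Empty using (⊥; ⊥-elim)
open import Data.Product using (Σ; ∃; _×_; _,_; proj₁; proj₂)
open import Data.Sum using (_⊎_; inj₁; inj₂)
open import Function using (_∘_)
open import Function.Bundles using (_⇔_; mk⇔; Equivalence)
open import Relation.Nullary using (¬_; Dec; yes; no)
open import Relation.Binary.PropositionalEquality hiding ([_])

-- The bits of β cannot be left to a player, who would have to choose them knowing only a prefix of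
-- the play, whereas β may depend on all of x. So the whole tree of runs is written, which leaves no
-- choice to anyone, and β is guessed by the automaton, which sees the infinite play. Since errors
-- lead to acceptance, they only hurt Player 2: a winning Player 2 never errs, and a winning Player
-- 1 may be assumed to face a correct annotator. The annotation stands on both tapes because
-- comparing two distant places takes two independent heads. Finite control can relate an entry to
-- its child only if machine steps are local; hence arithmetic is done on stacks, whose operations
-- move items by at most one cell, and configurations grow by at most one cell per step, so that i +
-- 1 letters suffice on level i. At time t the machine has seen t letters only, so its search
-- descends through the prefixes of what has been read and then starts again from a longer history.
-- The argument is constructive: if no position is a first error, induction on the position shows
-- that the annotation is correct, because letters can be compared.

module FiniteTypes where
  open import Data.Fin using (Fin; zero; suc; combine; remQuot; splitAt; join)
  open import Data.Fin.Properties using (remQuot-combine; splitAt-join) renaming (_≟_ to _≟ᶠ_)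
  open import Data.Vec using (Vec; []; _∷_)
  open import Data.List using (List; map; allFin)
  open import Data.List.Membership.Propositional using (_∈_)
  open import Data.List.Membership.Propositional.Properties using (∈-map⁺; ∈-allFin)
  import Data.Sum as Sum

  -- A retract of a standard finite set: enough to enumerate A and to decide equality on it.
  record Finite (A : Set) : Set where
    field
      size    : ℕ
      enc     : A → Fin size
      dec     : Fin size → A
      dec-enc : ∀ a → dec (enc a) ≡ a

    enumerate : List A
    enumerate = map dec (allFin size)

    ∈-enumerate : ∀ a → a ∈ enumerate
    ∈-enumerate a = subst (_∈ enumerate) (dec-enc a) (∈-map⁺ dec (∈-allFin (enc a)))

    _≟ᴬ_ : (a b : A) → Dec (a ≡ b)
    a ≟ᴬ b with enc a ≟ᶠ enc b
    ... | yes e = yes (trans (sym (dec-enc a)) (trans (cong dec e) (dec-enc b)))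
    ... | no ne = no (λ e → ne (cong enc e))

  open Finite using (size; enc; dec; dec-enc) public

  finFin : ∀ n → Finite (Fin n)
  finFin n = record { size = n ; enc = λ i → i ; dec = λ i → i ; dec-enc = λ _ → refl }

  finRetract : ∀ {A B : Set} (f : B → A) (g : A → B) → (∀ b → g (f b) ≡ b) → Finite A → Finite B
  finRetract f g gf F = record
    { size = size F ; enc = λ b → enc F (f b) ; dec = λ i → g (dec F i)
    ; dec-enc = λ b → trans (cong g (dec-enc F (f b))) (gf b) }

  fin⊤ : Finite ⊤
  fin⊤ = finRetract (λ _ → zero) (λ _ → tt) (λ _ → refl) (finFin 1)

  fin⊎ : ∀ {A B : Set} → Finite A → Finite B → Finite (A ⊎ B)
  fin⊎ {A} {B} FA FB = finRetract f g gf (finFin (size FA + size FB))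
    where
    f : A ⊎ B → Fin (size FA + size FB)
    f s = join (size FA) (size FB) (Sum.map (enc FA) (enc FB) s)
    g : Fin (size FA + size FB) → A ⊎ B
    g i = Sum.map (dec FA) (dec FB) (splitAt (size FA) i)
    gf : ∀ s → g (f s) ≡ s
    gf s rewrite splitAt-join (size FA) (size FB) (Sum.map (enc FA) (enc FB) s) with s
    ... | inj₁ a = cong inj₁ (dec-enc FA a)
    ... | inj₂ b = cong inj₂ (dec-enc FB b)

  fin× : ∀ {A B : Set} → Finite A → Finite B → Finite (A × B)
  fin× {A} {B} FA FB = finRetract f g gf (finFin (size FA * size FB))
    where
    f : A × B → Fin (size FA * size FB)
    f (a , b) = combine (enc FA a) (enc FB b)
    g : Fin (size FA * size FB) → A × B
    g i = dec FA (proj₁ (remQuot (size FB) i)) , dec FB (proj₂ (remQuot {size FA} (size FB) i))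
    gf : ∀ p → g (f p) ≡ p
    gf (a , b) = trans
      (cong (λ (i , j) → dec FA i , dec FB j) (remQuot-combine (enc FA a) (enc FB b)))
      (cong₂ _,_ (dec-enc FA a) (dec-enc FB b))

  finBool : Finite Bool
  finBool = finRetract f g gf (fin⊎ fin⊤ fin⊤)
    where
    f : Bool → ⊤ ⊎ ⊤
    f false = inj₁ tt
    f true  = inj₂ tt
    g : ⊤ ⊎ ⊤ → Bool
    g (inj₁ _) = false
    g (inj₂ _) = true
    gf : ∀ b → g (f b) ≡ b
    gf false = refl
    gf true  = refl

  finMaybe : ∀ {A : Set} → Finite A → Finite (Maybe A)
  finMaybe {A} FA = finRetract f g gf (fin⊎ fin⊤ FA)
    where
    f : Maybe A → ⊤ ⊎ A
    f nothing  = inj₁ tt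
    f (just a) = inj₂ a
    g : ⊤ ⊎ A → Maybe A
    g (inj₁ _) = nothing
    g (inj₂ a) = just a
    gf : ∀ m → g (f m) ≡ m
    gf nothing  = refl
    gf (just _) = refl

  finVec : ∀ {A : Set} → Finite A → ∀ n → Finite (Vec A n)
  finVec FA zero    = finRetract (λ _ → tt) (λ _ → []) (λ { [] → refl }) fin⊤
  finVec FA (suc n) =
    finRetract (λ { (a ∷ v) → a , v }) (λ { (a , v) → a ∷ v }) (λ { (_ ∷ _) → refl }) (fin× FA (finVec FA n))

-- Two-head automata driven by an oracle, and their translation into two-tape Büchi automata.

module Automata where
  open FiniteTypes
  open import Data.Fin using (Fin)
  open import Data.Fin.Subset using () renaming (_∈_ to _∈ₛ_)
  open import Data.Vec using (tabulate)
  open import Data.Vec.Properties using (lookup∘tabulate; lookup⇒[]=; []=⇒lookup)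
  open import Data.List using (List; []; _∷_; _++_; length; concatMap; allFin; cartesianProduct)
  open import Data.List.Properties using (length-++; ++-cancelˡ)
  open import Data.List.Membership.Propositional using (_∈_; find; lose)
  open import Data.List.Membership.Propositional.Properties using (∈-concatMap⁺; ∈-concatMap⁻; ∈-allFin; ∈-cartesianProduct⁺)
  open import Data.List.Relation.Unary.Any using (here; there)

  Opt : Bool → Set → Set
  Opt true  A = A
  Opt false A = ⊤

  readAt : ∀ {A : Set} m → (ℕ → A) → ℕ → Opt m A
  readAt true  u p = u p
  readAt false u p = tt

  advance : Bool → ℕ → ℕ
  advance true  p = suc p
  advance false p = p

  -- In each state the set of moving heads is fixed and the successor is a function of the letters
  -- read and of one oracle bit; all nondeterminism is in the oracle.
  record Automaton (U V : Set) : Set₁ where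
    field
      State   : Set
      finite  : Finite State
      start   : State
      acc     : State → Bool
      move₁   : State → Bool
      move₂   : State → Bool
      δ       : (q : State) → Opt (move₁ q) U → Opt (move₂ q) V → Bool → State

  module Runs {U V : Set} (𝒜 : Automaton U V) (u : ℕ → U) (v : ℕ → V) where
    open Automaton 𝒜

    succ-state : State → ℕ → ℕ → Bool → State
    succ-state q p₁ p₂ b = δ q (readAt (move₁ q) u p₁) (readAt (move₂ q) v p₂) b

    mutual
      stateAt : (ℕ → Bool) → ℕ → State
      stateAt o zero    = start
      stateAt o (suc n) = succ-state (stateAt o n) (pos₁ o n) (pos₂ o n) (o n)

      pos₁ : (ℕ → Bool) → ℕ → ℕ
      pos₁ o zero    = 0
      pos₁ o (suc n) = advance (move₁ (stateAt o n)) (pos₁ o n)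

      pos₂ : (ℕ → Bool) → ℕ → ℕ
      pos₂ o zero    = 0
      pos₂ o (suc n) = advance (move₂ (stateAt o n)) (pos₂ o n)

    record Accepting (o : ℕ → Bool) : Set where
      field
        unbounded₁ : ∀ N → ∃ λ n → N < pos₁ o n
        unbounded₂ : ∀ N → ∃ λ n → N < pos₂ o n
        accState   : State
        isAcc      : acc accState ≡ true
        recurs     : ∀ N → ∃ λ n → N ≤ n × stateAt o n ≡ accState

    Accepted : Set
    Accepted = ∃ Accepting

  open Runs using (Accepted; Accepting) public

  finΣBool : {A : Bool → Set} → (∀ b → Finite (A b)) → Finite (Σ Bool A)
  finΣBool {A} F = finRetract f g gf (fin⊎ (F false) (F true))
    where
    f : Σ Bool A → A false ⊎ A true
    f (false , a) = inj₁ a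
    f (true  , a) = inj₂ a
    g : A false ⊎ A true → Σ Bool A
    g (inj₁ a) = false , a
    g (inj₂ a) = true , a
    gf : ∀ p → g (f p) ≡ p
    gf (false , _) = refl
    gf (true  , _) = refl

  module _ {U V : Set} (𝒜 : Bool → Automaton U V) where
    private
      module A c = Automaton (𝒜 c)

    -- The choice of a component costs one silent step and the first oracle bit, so a run of the
    -- union is a run of the component delayed by one step.
    union : Automaton U V
    union = record
      { State = ⊤ ⊎ Σ Bool A.State
      ; finite = fin⊎ fin⊤ (finΣBool A.finite)
      ; start = inj₁ tt
      ; acc = λ { (inj₁ _) → false ; (inj₂ (c , q)) → A.acc c q }
      ; move₁ = λ { (inj₁ _) → false ; (inj₂ (c , q)) → A.move₁ c q }
      ; move₂ = λ { (inj₁ _) → false ; (inj₂ (c , q)) → A.move₂ c q }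
      ; δ = λ { (inj₁ _) _ _ c → inj₂ (c , A.start c)
              ; (inj₂ (c , q)) a b o → inj₂ (c , A.δ c q a b o) }
      }

    module _ (u : ℕ → U) (v : ℕ → V) where
      private
        module RA c = Runs (𝒜 c) u v
        module RU = Runs union u v

        run : ∀ o n → RU.stateAt o (suc n) ≡ inj₂ (o 0 , RA.stateAt (o 0) (o ∘ suc) n) ×
          RU.pos₁ o (suc n) ≡ RA.pos₁ (o 0) (o ∘ suc) n × RU.pos₂ o (suc n) ≡ RA.pos₂ (o 0) (o ∘ suc) n
        run o zero = refl , refl , refl
        run o (suc n) with RU.stateAt o (suc n) | RU.pos₁ o (suc n) | RU.pos₂ o (suc n) | run o n
        ... | _ | _ | _ | refl , refl , refl = refl , refl , refl

      union-complete : ∀ c → Accepted (𝒜 c) u v → Accepted union u v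
      union-complete c (o , a) = o′ , record
        { unbounded₁ = λ N → let n , lt = unbounded₁ N in suc n , subst (N <_) (sym (proj₁ (proj₂ (run o′ n)))) lt
        ; unbounded₂ = λ N → let n , lt = unbounded₂ N in suc n , subst (N <_) (sym (proj₂ (proj₂ (run o′ n)))) lt
        ; accState = inj₂ (c , accState)
        ; isAcc = isAcc
        ; recurs = λ N → let n , le , e = recurs N in
                   suc n , m≤n⇒m≤1+n le , trans (proj₁ (run o′ n)) (cong (λ q → inj₂ (c , q)) e) }
        where
        open Runs.Accepting a
        o′ : ℕ → Bool
        o′ zero    = c
        o′ (suc n) = o n

      union-sound : Accepted union u v → ∃ λ c → Accepted (𝒜 c) u v
      union-sound (o , a) = o 0 , o ∘ suc , record
        { unbounded₁ = λ N → pred₁ (unbounded₁ N) ; unbounded₂ = λ N → pred₂ (unbounded₂ N)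
        ; accState = proj₁ q ; isAcc = proj₁ (proj₂ q)
        ; recurs = λ N → rec (recurs (suc N)) }
        where
        open RU.Accepting a
        r = run o
        pred₁ : ∀ {N} → (∃ λ n → N < RU.pos₁ o n) → ∃ λ n → N < RA.pos₁ (o 0) (o ∘ suc) n
        pred₁ (suc n , lt) = n , subst (_ <_) (proj₁ (proj₂ (r n))) lt
        pred₂ : ∀ {N} → (∃ λ n → N < RU.pos₂ o n) → ∃ λ n → N < RA.pos₂ (o 0) (o ∘ suc) n
        pred₂ (suc n , lt) = n , subst (_ <_) (proj₂ (proj₂ (r n))) lt
        component : (∃ λ n → 1 ≤ n × RU.stateAt o n ≡ accState) →
          ∃ λ q → A.acc (o 0) q ≡ true × accState ≡ inj₂ (o 0 , q)
        component (suc n , _ , e₁) = _ , subst (λ s → Automaton.acc union s ≡ true) e₂ isAcc , e₂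
          where e₂ = trans (sym e₁) (proj₁ (r n))
        -- From time 1 on the run is inside a component, so a visit at such a time shows where the
        -- accepting state lies.
        q = component (recurs 1)
        rec : ∀ {N} → (∃ λ n → suc N ≤ n × RU.stateAt o n ≡ accState) →
              ∃ λ n → N ≤ n × RA.stateAt (o 0) (o ∘ suc) n ≡ proj₁ q
        rec (suc n , s≤s le , e₁) = n , le , inj (trans (sym (proj₁ (r n))) (trans e₁ (proj₂ (proj₂ q))))
          where inj : ∀ {c} {a b : A.State c} → _≡_ {A = ⊤ ⊎ Σ Bool A.State} (inj₂ (c , a)) (inj₂ (c , b)) → a ≡ b
                inj refl = refl

  take-+ : {A : Set} → ∀ m n (u : ℕ → A) → take (m + n) u ≡ take m u ++ take n (λ i → u (m + i))
  take-+ zero    n u = refl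
  take-+ (suc m) n u = cong (u 0 ∷_) (take-+ m n (u ∘ suc))

  take-cong : {A : Set} → ∀ n {u v : ℕ → A} → (∀ i → u i ≡ v i) → take n u ≡ take n v
  take-cong zero    e = refl
  take-cong (suc n) e = cong₂ _∷_ (e 0) (take-cong n (e ∘ suc))

  module _ {A : Set} (ws : ℕ → List A) (u : ℕ → A) where

    -- `ConcatIs` speaks of ever longer prefixes; this equivalent form concerns each block alone, as
    -- is needed when a run is followed step by step.
    Slices : Set
    Slices = ∀ n → ws n ≡ take (length (ws n)) (λ i → u (length (concatUpTo ws n) + i))

    private
      take-next : ∀ n → take (length (concatUpTo ws (suc n))) u ≡
        take (length (concatUpTo ws n)) u ++ take (length (ws n)) (λ i → u (length (concatUpTo ws n) + i))
      take-next n = trans (cong (λ l → take l u) (length-++ (concatUpTo ws n))) (take-+ _ (length (ws n)) u)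

    concat⇒slices : ConcatIs ws u → Slices
    concat⇒slices (c , _) n = ++-cancelˡ (concatUpTo ws n) _ _ (begin
      concatUpTo ws n ++ ws n ≡⟨ c (suc n) ⟩
      take (length (concatUpTo ws (suc n))) u ≡⟨ take-next n ⟩
      take (length (concatUpTo ws n)) u ++ rest ≡⟨ cong (_++ rest) (sym (c n)) ⟩
      concatUpTo ws n ++ rest ∎)
      where
      open ≡-Reasoning
      rest = take (length (ws n)) (λ i → u (length (concatUpTo ws n) + i))

    slices⇒concat : Slices → ∀ n → concatUpTo ws n ≡ take (length (concatUpTo ws n)) u
    slices⇒concat s zero    = refl
    slices⇒concat s (suc n) = trans (cong₂ _++_ (slices⇒concat s n) (s n)) (sym (take-next n))

  -- A head reads a whole round of the game as one symbol, first Player 1's letter and then Player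
  -- 2's, so a moving edge of the transition table consumes two letters of its tape.
  rounds : {A : Set} → (ℕ → A) → ℕ → A × A
  rounds u j = u (j + j) , u (suc (j + j))

  module _ {A : Set} where

    word : ∀ m → Opt m (A × A) → List A
    word true  (a , b) = a ∷ b ∷ []
    word false _       = []

    words : ∀ m → List A → List (Opt m (A × A))
    words true  as = cartesianProduct as as
    words false as = tt ∷ []

    ∈-words : ∀ m {as} → (∀ a → a ∈ as) → ∀ w → w ∈ words m as
    ∈-words true  all (a , b) = ∈-cartesianProduct⁺ (all a) (all b)
    ∈-words false all tt      = here refl

    word-slice : ∀ m (u : ℕ → A) p l → l ≡ p + p →
      word m (readAt m (rounds u) p) ≡ take (length (word m (readAt m (rounds u) p))) (λ i → u (l + i))
    word-slice true u p .(p + p) refl =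
      cong₂ (λ i j → u i ∷ u j ∷ []) (sym (+-identityʳ (p + p))) (trans (cong suc (sym (+-identityʳ (p + p)))) (sym (+-suc (p + p) 0)))
    word-slice false u p l e = refl

    slice-word : ∀ m (u : ℕ → A) p l → l ≡ p + p → ∀ w →
      word m w ≡ take (length (word m w)) (λ i → u (l + i)) → w ≡ readAt m (rounds u) p
    slice-word true u p .(p + p) refl (a , b) e with e
    ... | e′ with trans e′ (sym (word-slice true u p (p + p) refl))
    ... | refl = refl
    slice-word false u p l e tt _ = refl

    length-word : ∀ m w p l → l ≡ p + p → l + length (word m w) ≡ advance m p + advance m p
    length-word true  w p .(p + p) refl = begin
      p + p + 2 ≡⟨ +-suc (p + p) 1 ⟩
      suc (p + p + 1) ≡⟨ cong suc (trans (+-suc (p + p) 0) (cong suc (+-identityʳ (p + p)))) ⟩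
      suc (suc (p + p)) ≡⟨ cong suc (sym (+-suc p p)) ⟩
      suc (p + suc p) ∎
      where open ≡-Reasoning
    length-word false w p .(p + p) refl = +-identityʳ _

  module TwoTape {s g : ℕ} (𝒜 : Automaton (Fin s × Fin s) (Fin g × Fin g)) where
    open Automaton 𝒜
    private
      module Fᶠ = Finite finite

    edge : (q : State) → Opt (move₁ q) (Fin s × Fin s) → Opt (move₂ q) (Fin g × Fin g) → Bool →
      Fin (size finite) × List (Fin s) × List (Fin g) × Fin (size finite)
    edge q a b o = enc finite q , word (move₁ q) a , word (move₂ q) b , enc finite (δ q a b o)

    edges : List (Fin (size finite) × List (Fin s) × List (Fin g) × Fin (size finite))
    edges = concatMap (λ q → concatMap (λ a → concatMap (λ b → edge q a b false ∷ edge q a b true ∷ [])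
              (words (move₂ q) (allFin g))) (words (move₁ q) (allFin s))) Fᶠ.enumerate

    edge∈ : ∀ q a b o → edge q a b o ∈ edges
    edge∈ q a b o = ∈-concatMap⁺ _ (lose (Fᶠ.∈-enumerate q)
      (∈-concatMap⁺ _ (lose (∈-words (move₁ q) ∈-allFin a)
      (∈-concatMap⁺ _ (lose (∈-words (move₂ q) ∈-allFin b) (pick o))))))
      where
      pick : ∀ o → edge q a b o ∈ edge q a b false ∷ edge q a b true ∷ []
      pick false = here refl
      pick true  = there (here refl)

    record IsEdge (t : Fin (size finite) × List (Fin s) × List (Fin g) × Fin (size finite)) : Set where
      constructor isEdge
      field
        from : State
        in₁  : Opt (move₁ from) (Fin s × Fin s)
        in₂  : Opt (move₂ from) (Fin g × Fin g)
        bit  : Bool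
        form : t ≡ edge from in₁ in₂ bit

    ∈edges : ∀ {t} → t ∈ edges → IsEdge t
    ∈edges t∈ with find (∈-concatMap⁻ _ {xs = Fᶠ.enumerate} t∈)
    ... | q , _ , t∈₁ with find (∈-concatMap⁻ _ {xs = words (move₁ q) (allFin s)} t∈₁)
    ... | a , _ , t∈₂ with find (∈-concatMap⁻ _ {xs = words (move₂ q) (allFin g)} t∈₂)
    ... | b , _ , here e = isEdge q a b false e
    ... | b , _ , there (here e) = isEdge q a b true e

    twoTape : TwoTapeBüchi (Fin s) (Fin g)
    twoTape = record
      { nStates = size finite ; Δ = edges ; q₀ = enc finite start ; F = tabulate (acc ∘ dec finite) }

    enc-injective : ∀ {q q′} → enc finite q ≡ enc finite q′ → q ≡ q′
    enc-injective {q} {q′} e = trans (sym (dec-enc finite q)) (trans (cong (dec finite) e) (dec-enc finite q′))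

    module _ (u : ℕ → Fin s) (v : ℕ → Fin g) where
      open Runs 𝒜 (rounds u) (rounds v) hiding (Accepted; Accepting)

      private
        double-< : ∀ {N p} → N < p → N < p + p
        double-< {N} {p} lt = ≤-trans lt (m≤m+n p p)

        half-< : ∀ {N p} → N + N < p + p → N < p
        half-< {zero}  {suc p} _ = s≤s z≤n
        half-< {suc N} {suc p} (s≤s lt) rewrite +-suc N N | +-suc p p with lt
        ... | s≤s lt′ = s≤s (half-< lt′)

      complete : Accepted 𝒜 (rounds u) (rounds v) → Accepts twoTape u v
      complete (o , a) = t , (t∈ , refl , λ _ → refl) ,
        (enc finite accState , q∈F , λ N → again N (recurs (suc N))) ,
        concat u (λ n → word (move₁ (stateAt o n)) (r₁ n)) (pos₁ o)
          (λ n → word-slice (move₁ (stateAt o n)) u (pos₁ o n) _ (len₁ n)) len₁ unbounded₁ ,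
        concat v (λ n → word (move₂ (stateAt o n)) (r₂ n)) (pos₂ o)
          (λ n → word-slice (move₂ (stateAt o n)) v (pos₂ o n) _ (len₂ n)) len₂ unbounded₂
        where
        open Runs.Accepting a
        r₁ : ∀ n → Opt (move₁ (stateAt o n)) (Fin s × Fin s)
        r₁ n = readAt (move₁ (stateAt o n)) (rounds u) (pos₁ o n)
        r₂ : ∀ n → Opt (move₂ (stateAt o n)) (Fin g × Fin g)
        r₂ n = readAt (move₂ (stateAt o n)) (rounds v) (pos₂ o n)
        t : ℕ → Transition twoTape
        t n = edge (stateAt o n) (r₁ n) (r₂ n) (o n)
        t∈ : ∀ n → t n ∈ edges
        t∈ n = edge∈ (stateAt o n) (r₁ n) (r₂ n) (o n)
        q∈F : enc finite accState ∈ₛ tabulate (acc ∘ dec finite)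
        q∈F = lookup⇒[]= _ _ (trans (lookup∘tabulate (acc ∘ dec finite) (enc finite accState))
                (trans (cong acc (dec-enc finite accState)) isAcc))
        again : ∀ N → (∃ λ n → suc N ≤ n × stateAt o n ≡ accState) → ∃ λ m → N ≤ m × tgt twoTape (t m) ≡ enc finite accState
        again N (suc n , s≤s le , e) = n , le , cong (enc finite) e
        len₁ : ∀ n → length (concatUpTo (inU twoTape ∘ t) n) ≡ pos₁ o n + pos₁ o n
        len₁ zero    = refl
        len₁ (suc n) = trans (length-++ (concatUpTo (inU twoTape ∘ t) n)) (length-word (move₁ (stateAt o n)) (r₁ n) _ _ (len₁ n))
        len₂ : ∀ n → length (concatUpTo (inV twoTape ∘ t) n) ≡ pos₂ o n + pos₂ o n
        len₂ zero    = refl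
        len₂ (suc n) = trans (length-++ (concatUpTo (inV twoTape ∘ t) n)) (length-word (move₂ (stateAt o n)) (r₂ n) _ _ (len₂ n))
        concat : ∀ {A : Set} (w : ℕ → A) (ws : ℕ → List A) (pos : ℕ → ℕ) → Slices ws w →
          (∀ n → length (concatUpTo ws n) ≡ pos n + pos n) → (∀ N → ∃ λ n → N < pos n) → ConcatIs ws w
        concat w ws pos sl len unb = slices⇒concat ws w sl ,
          λ N → let n , lt = unb N in n , subst (N <_) (sym (len n)) (double-< lt)

      -- Each transition, being an edge, comes with a state, the symbols read and an oracle bit. The
      -- bits together form an oracle, and by induction the deterministic run under it passes
      -- through the same states; the lengths consumed are twice its head positions.
      reconstruct : ∀ t → (∀ n → IsEdge (t n)) → src twoTape (t 0) ≡ enc finite start →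
        (∀ i → tgt twoTape (t i) ≡ src twoTape (t (suc i))) → Successful twoTape t →
        ConcatIs (inU twoTape ∘ t) u → ConcatIs (inV twoTape ∘ t) v → Accepted 𝒜 (rounds u) (rounds v)
      reconstruct t E t0 chain (qF , qF∈ , inf) concat₁ concat₂ = o , record
        { unbounded₁ = λ N → let n , lt = proj₂ concat₁ (N + N) in n , half-< (subst (N + N <_) (proj₁ (proj₂ (tracks n))) lt)
        ; unbounded₂ = λ N → let n , lt = proj₂ concat₂ (N + N) in n , half-< (subst (N + N <_) (proj₂ (proj₂ (tracks n))) lt)
        ; accState = dec finite qF
        ; isAcc = trans (sym (lookup∘tabulate (acc ∘ dec finite) qF)) ([]=⇒lookup qF∈)
        ; recurs = λ N → let m , le , e = inf N in suc m , m≤n⇒m≤1+n le ,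
            trans (sym (proj₁ (advances m _ _ _ (tracks m)))) (trans (sym (dec-enc finite _)) (trans (cong (dec finite) (sym (tgt-form m))) (cong (dec finite) e)))
        }
        where
        from : ℕ → State
        from n = IsEdge.from (E n)
        o : ℕ → Bool
        o n = IsEdge.bit (E n)
        in₁ : ∀ n → Opt (move₁ (from n)) (Fin s × Fin s)
        in₁ n = IsEdge.in₁ (E n)
        in₂ : ∀ n → Opt (move₂ (from n)) (Fin g × Fin g)
        in₂ n = IsEdge.in₂ (E n)
        form : ∀ n → t n ≡ edge (from n) (in₁ n) (in₂ n) (o n)
        form n = IsEdge.form (E n)

        tgt-form : ∀ n → tgt twoTape (t n) ≡ enc finite (δ (from n) (in₁ n) (in₂ n) (o n))
        tgt-form n = cong (tgt twoTape) (form n)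

        onTape₁ : ∀ n → word (move₁ (from n)) (in₁ n) ≡
          take (length (word (move₁ (from n)) (in₁ n))) (λ i → u (length (concatUpTo (inU twoTape ∘ t) n) + i))
        onTape₁ n = subst (λ w → w ≡ take (length w) (λ i → u (length (concatUpTo (inU twoTape ∘ t) n) + i)))
          (cong (inU twoTape) (form n)) (concat⇒slices _ u concat₁ n)

        onTape₂ : ∀ n → word (move₂ (from n)) (in₂ n) ≡
          take (length (word (move₂ (from n)) (in₂ n))) (λ i → v (length (concatUpTo (inV twoTape ∘ t) n) + i))
        onTape₂ n = subst (λ w → w ≡ take (length w) (λ i → v (length (concatUpTo (inV twoTape ∘ t) n) + i)))
          (cong (inV twoTape) (form n)) (concat⇒slices _ v concat₂ n)

        Tracks : ℕ → State → ℕ → ℕ → Set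
        Tracks n q p₁ p₂ = from n ≡ q ×
          length (concatUpTo (inU twoTape ∘ t) n) ≡ p₁ + p₁ × length (concatUpTo (inV twoTape ∘ t) n) ≡ p₂ + p₂

        advances : ∀ n q p₁ p₂ → Tracks n q p₁ p₂ →
          δ (from n) (in₁ n) (in₂ n) (o n) ≡ succ-state q p₁ p₂ (o n) ×
          length (concatUpTo (inU twoTape ∘ t) (suc n)) ≡ advance (move₁ q) p₁ + advance (move₁ q) p₁ ×
          length (concatUpTo (inV twoTape ∘ t) (suc n)) ≡ advance (move₂ q) p₂ + advance (move₂ q) p₂
        advances n .(from n) p₁ p₂ (refl , l₁ , l₂) =
          cong₂ (λ a b → δ (from n) a b (o n))
            (slice-word (move₁ (from n)) u p₁ _ l₁ (in₁ n) (onTape₁ n))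
            (slice-word (move₂ (from n)) v p₂ _ l₂ (in₂ n) (onTape₂ n)) ,
          trans (length-++ (concatUpTo (inU twoTape ∘ t) n))
            (trans (cong (λ e → length (concatUpTo (inU twoTape ∘ t) n) + length (inU twoTape e)) (form n))
                   (length-word (move₁ (from n)) (in₁ n) _ _ l₁)) ,
          trans (length-++ (concatUpTo (inV twoTape ∘ t) n))
            (trans (cong (λ e → length (concatUpTo (inV twoTape ∘ t) n) + length (inV twoTape e)) (form n))
                   (length-word (move₂ (from n)) (in₂ n) _ _ l₂))

        tracks : ∀ n → Tracks n (stateAt o n) (pos₁ o n) (pos₂ o n)
        tracks zero    = enc-injective (trans (sym (cong (src twoTape) (form 0))) t0) , refl , refl
        tracks (suc n) = let e , l₁ , l₂ = advances n _ _ _ (tracks n) in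
          trans (sym (enc-injective (trans (sym (tgt-form n)) (trans (chain n) (cong (src twoTape) (form (suc n))))))) e , l₁ , l₂

      sound : Accepts twoTape u v → Accepted 𝒜 (rounds u) (rounds v)
      sound (t , (t∈ , t0 , chain) , recurring , c₁ , c₂) = reconstruct t (λ n → ∈edges (t∈ n)) t0 chain recurring c₁ c₂

    -- Abstract, because unfolding the transition table is expensive.
    abstract
      recognizer : TwoTapeBüchi (Fin s) (Fin g)
      recognizer = twoTape

      recognizer-sound : ∀ u v → Accepts recognizer u v → Accepted 𝒜 (rounds u) (rounds v)
      recognizer-sound = sound

      recognizer-complete : ∀ u v → Accepted 𝒜 (rounds u) (rounds v) → Accepts recognizer u v
      recognizer-complete = complete

-- Transfer of winning strategies between a game and its annotated version.

module Games where
  open import Data.List using (List; []; _∷_; _++_; [_]; length; foldl)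
  open import Data.List.Properties using (foldl-++; ++-assoc)

  interleave-even : ∀ {A : Set} n (f g : ℕ → A) → interleave f g (n + n) ≡ f n
  interleave-odd  : ∀ {A : Set} n (f g : ℕ → A) → interleave f g (suc (n + n)) ≡ g n
  interleave-even zero    f g = refl
  interleave-even (suc n) f g rewrite +-suc n n = interleave-even n (f ∘ suc) (g ∘ suc)
  interleave-odd  zero    f g = refl
  interleave-odd  (suc n) f g rewrite +-suc n n = interleave-odd n (f ∘ suc) (g ∘ suc)

  interleave-map : ∀ {A B : Set} (h : A → B) {f g : ℕ → A} {f′ g′ : ℕ → B} →
    (∀ n → h (f n) ≡ f′ n) → (∀ n → h (g n) ≡ g′ n) → ∀ i → h (interleave f g i) ≡ interleave f′ g′ i
  interleave-map h ef eg zero    = ef 0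
  interleave-map h ef eg (suc i) = interleave-map h eg (λ n → ef (suc n)) i

  take-snoc : ∀ {A : Set} n (u : ℕ → A) → take (suc n) u ≡ take n u ++ [ u n ]
  take-snoc zero    u = refl
  take-snoc (suc n) u = cong (u 0 ∷_) (take-snoc n (u ∘ suc))

  extend : ∀ {A : Set} → A → List A → ℕ → A
  extend d []       i       = d
  extend d (x ∷ xs) zero    = x
  extend d (x ∷ xs) (suc i) = extend d xs i

  extend-take : ∀ {A : Set} (d : A) m (f : ℕ → A) i → i < m → extend d (take m f) i ≡ f i
  extend-take d (suc m) f zero    _        = refl
  extend-take d (suc m) f (suc i) (s≤s lt) = extend-take d m (f ∘ suc) i lt

  flatten : {A B : Set} → (A → B) → List (A × A) → List B
  flatten h []            = []
  flatten h ((a , b) ∷ w) = h a ∷ h b ∷ flatten h w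

  flatten-snoc : ∀ {A B : Set} (h : A → B) w a b → flatten h (w ++ [ (a , b) ]) ≡ flatten h w ++ h a ∷ h b ∷ []
  flatten-snoc h []            a b = refl
  flatten-snoc h ((c , d) ∷ w) a b = cong (λ l → h c ∷ h d ∷ l) (flatten-snoc h w a b)

  take-round : ∀ {B : Set} n (u : ℕ → B) → take (suc n + suc n) u ≡ take (n + n) u ++ u (n + n) ∷ u (suc (n + n)) ∷ []
  take-round n u rewrite +-suc n n = trans (take-snoc (suc (n + n)) u)
    (trans (cong (_++ [ u (suc (n + n)) ]) (take-snoc (n + n) u)) (++-assoc (take (n + n) u) _ _))

  flatten-history : ∀ {A B : Set} (h : A → B) (hist : ℕ → List (A × A)) (f g : ℕ → A) → hist 0 ≡ [] →
    (∀ n → hist (suc n) ≡ hist n ++ [ (f n , g n) ]) → ∀ n →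
    flatten h (hist n) ≡ take (n + n) (h ∘ interleave f g)
  flatten-history h hist f g e₀ eₛ zero rewrite e₀ = refl
  flatten-history h hist f g e₀ eₛ (suc n) = begin
    flatten h (hist (suc n)) ≡⟨ cong (flatten h) (eₛ n) ⟩
    flatten h (hist n ++ [ (f n , g n) ]) ≡⟨ flatten-snoc h (hist n) (f n) (g n) ⟩
    flatten h (hist n) ++ h (f n) ∷ h (g n) ∷ []
      ≡⟨ cong₂ _++_ (flatten-history h hist f g e₀ eₛ n)
           (cong₂ (λ a b → h a ∷ h b ∷ []) (sym (interleave-even n f g)) (sym (interleave-odd n f g))) ⟩
    take (n + n) (h ∘ interleave f g) ++ h (interleave f g (n + n)) ∷ h (interleave f g (suc (n + n))) ∷ []
      ≡⟨ sym (take-round n (h ∘ interleave f g)) ⟩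
    take (suc n + suc n) (h ∘ interleave f g) ∎
    where open ≡-Reasoning

  -- A game on annotated letters: Player 2 is expected to annotate the j-th round by `annotation x j`,
  -- which depends only on the letters played so far; the annotations of Player 1 are ignored.
  module Annotated
    {X N Z : Set} (letter : Z → X) (note : Z → N) (mk : X → N → Z)
    (letter-mk : ∀ x n → letter (mk x n) ≡ x) (note-mk : ∀ x n → note (mk x n) ≡ n) (n₀ : N)
    (annotation : (ℕ → X) → ℕ → N)
    (causal : ∀ x x′ j → (∀ i → i < suc j + suc j → x i ≡ x′ i) → annotation x j ≡ annotation x′ j)
    where

    Correct : (ℕ → Z) → Set
    Correct z = ∀ j → note (z (suc (j + j))) ≡ annotation (letter ∘ z) j

    module _ (R : (ℕ → Z) → Set) (L : (ℕ → X) → Set) (L-ext : ∀ {x x′} → (∀ i → x i ≡ x′ i) → L x → L x′)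
             (sound : ∀ z → Correct z → R z → L (letter ∘ z)) (complete : ∀ z → ¬ R z → ¬ L (letter ∘ z)) where

      -- σ is played against an imaginary Player 2 who copies the real letters and annotates them
      -- correctly. The imaginary history is a function of the real one, so this yields a strategy.
      player1 : Player1Wins R → Player1Wins L
      player1 (σ , win) = σ′ , λ ys → L-ext (same ys) (sound (play ys) (correct ys) (win (ws ys)))
        where
        note-after : List (Z × Z) → X → N
        -- `annotation` takes an infinite play; the finite history is padded with its last letter,
        -- which is harmless by causality.
        note-after acc b = annotation (extend b (flatten letter acc ++ letter (σ acc) ∷ b ∷ [])) (length acc)

        answer : List (Z × Z) → X → Z
        answer acc b = mk b (note-after acc b)

        replay : List (X × X) → List (Z × Z)
        replay = foldl (λ acc (_ , b) → acc ++ [ (σ acc , answer acc b) ]) []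

        replay-snoc : ∀ h a b → replay (h ++ [ (a , b) ]) ≡ replay h ++ [ (σ (replay h) , answer (replay h) b) ]
        replay-snoc h a b = foldl-++ _ [] h [ (a , b) ]

        σ′ : Strategy₁ X
        σ′ h = letter (σ (replay h))

        module _ (ys : ℕ → X) where
          ws : ℕ → Z
          ws n = answer (replay (history₁ σ′ ys n)) (ys n)

          play : ℕ → Z
          play = play₁ σ ws

          replays : ∀ n → history₁ σ ws n ≡ replay (history₁ σ′ ys n)
          replays zero    = refl
          replays (suc n) = trans (cong (λ h → h ++ [ (σ h , ws n) ]) (replays n))
                                  (sym (replay-snoc (history₁ σ′ ys n) _ (ys n)))

          same : ∀ i → letter (play i) ≡ play₁ σ′ ys i
          same = interleave-map letter (λ n → cong (letter ∘ σ) (replays n)) (λ n → letter-mk _ _)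

          length-history : ∀ n → length (history₁ σ ws n) ≡ n
          length-history n = snocs (history₁ σ ws) refl (λ _ → refl) n
            where
            length-snoc : ∀ (w : List (Z × Z)) p → length (w ++ [ p ]) ≡ suc (length w)
            length-snoc []      p = refl
            length-snoc (_ ∷ w) p = cong suc (length-snoc w p)
            snocs : ∀ (hist : ℕ → List (Z × Z)) → hist 0 ≡ [] →
              (∀ n → hist (suc n) ≡ hist n ++ [ (σ (hist n) , ws n) ]) → ∀ n → length (hist n) ≡ n
            snocs hist e₀ eₛ zero    = cong length e₀
            snocs hist e₀ eₛ (suc n) = trans (cong length (eₛ n)) (trans (length-snoc (hist n) _) (cong suc (snocs hist e₀ eₛ n)))

          correct : Correct play
          correct j = begin
            note (play (suc (j + j))) ≡⟨ cong note (interleave-odd j (λ n → σ (history₁ σ ws n)) ws) ⟩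
            note (ws j) ≡⟨ note-mk _ _ ⟩
            note-after (replay (history₁ σ′ ys j)) (ys j) ≡⟨ cong (λ h → note-after h (ys j)) (sym (replays j)) ⟩
            annotation (extend (ys j) so-far) (length (history₁ σ ws j)) ≡⟨ cong (annotation _) (length-history j) ⟩
            annotation (extend (ys j) so-far) j ≡⟨ causal _ _ j agree ⟩
            annotation (letter ∘ play) j ∎
            where
            open ≡-Reasoning
            so-far : List X
            so-far = flatten letter (history₁ σ ws j) ++ letter (σ (history₁ σ ws j)) ∷ ys j ∷ []
            so-far≡ : so-far ≡ take (suc j + suc j) (letter ∘ play)
            so-far≡ = trans (cong₂ _++_ (flatten-history letter (history₁ σ ws) _ ws refl (λ _ → refl) j)
                (cong₂ (λ a b → a ∷ b ∷ []) (cong letter (sym (interleave-even j _ ws)))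
                  (trans (sym (letter-mk _ _)) (cong letter (sym (interleave-odd j (λ n → σ (history₁ σ ws n)) ws))))))
              (sym (take-round j (letter ∘ play)))
            agree : ∀ i → i < suc j + suc j → extend (ys j) so-far i ≡ letter (play i)
            agree i lt = trans (cong (λ w → extend (ys j) w i) so-far≡) (extend-take (ys j) (suc j + suc j) (letter ∘ play) i lt)

      -- The moves of Player 1 are given the arbitrary annotation n₀. All plays of τ lie outside R,
      -- and `complete` turns this into being outside L; that τ must annotate correctly is hidden in
      -- `complete`.
      player2 : Player2Wins R → Player2Wins L
      player2 (τ , win) = τ′ , λ xs l → complete (play xs) (win (ws xs)) (L-ext (sym ∘ same xs) l)
        where
        replay : List (X × X) → List (Z × Z)
        replay = foldl (λ acc (a , _) → acc ++ [ (mk a n₀ , τ acc (mk a n₀)) ]) []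

        replay-snoc : ∀ h a b → replay (h ++ [ (a , b) ]) ≡ replay h ++ [ (mk a n₀ , τ (replay h) (mk a n₀)) ]
        replay-snoc h a b = foldl-++ _ [] h [ (a , b) ]

        τ′ : Strategy₂ X
        τ′ h a = letter (τ (replay h) (mk a n₀))

        module _ (xs : ℕ → X) where
          ws : ℕ → Z
          ws n = mk (xs n) n₀

          play : ℕ → Z
          play = play₂ τ ws

          replays : ∀ n → history₂ τ ws n ≡ replay (history₂ τ′ xs n)
          replays zero    = refl
          replays (suc n) = trans (cong (λ h → h ++ [ (ws n , τ h (ws n)) ]) (replays n))
                                  (sym (replay-snoc (history₂ τ′ xs n) (xs n) _))

          same : ∀ i → letter (play i) ≡ play₂ τ′ xs i
          same = interleave-map letter (λ n → letter-mk _ _) (λ n → cong (λ h → letter (τ h (ws n))) (replays n))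

      determined : Determined R → Determined L
      determined (inj₁ w) = inj₁ (player1 w)
      determined (inj₂ w) = inj₂ (player2 w)

-- The annotation: all runs of a local machine, written level by level.

module Tree where
  open FiniteTypes
  open import Data.Nat using (_≤′_; ≤′-refl; ≤′-step)

  -- A machine whose configurations are sequences of cells, each new cell depending only on the
  -- control state, the first cell and the three cells around its position.
  record LocalMachine (X : Set) : Set₁ where
    field
      Ctl Cell Conf : Set
      finCtl  : Finite Ctl
      finCell : Finite Cell
      ∅       : Cell
      init    : Conf
      step    : Bool → X → Conf → Conf
      ctl     : Conf → Ctl
      cell    : Conf → ℕ → Cell
      κ       : Ctl → Cell → Ctl
      top     : Bool → X → Ctl → Cell → Cell → Cell
      rest    : Ctl → Cell → Cell → Cell → Cell → Cell
      init-∅   : ∀ o → cell init o ≡ ∅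
      ctl-step : ∀ b x c → ctl (step b x c) ≡ κ (ctl c) (cell c 0)
      cell-top : ∀ b x c → cell (step b x c) 0 ≡ top b x (ctl c) (cell c 0) (cell c 1)
      cell-rest : ∀ b x c o → cell (step b x c) (suc o) ≡
                  rest (ctl c) (cell c 0) (cell c o) (cell c (suc o)) (cell c (suc (suc o)))
      rest-∅   : ∀ k d → rest k d ∅ ∅ ∅ ≡ ∅

  -- The second component runs on complemented choices. As the mirror image of an entry has all bits
  -- of its index flipped, the second component there equals the first component at the entry
  -- itself.
  double : ∀ {X} → LocalMachine X → LocalMachine X
  double M = record
    { Ctl = Ctl × Ctl ; Cell = Cell × Cell ; Conf = Conf × Conf
    ; finCtl = fin× finCtl finCtl ; finCell = fin× finCell finCell
    ; ∅ = ∅ , ∅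
    ; init = init , init
    ; step = λ b x (c , d) → step b x c , step (not b) x d
    ; ctl = λ (c , d) → ctl c , ctl d
    ; cell = λ (c , d) o → cell c o , cell d o
    ; κ = λ (k , l) (c , d) → κ k c , κ l d
    ; top = λ b x (k , l) (c , d) (c′ , d′) → top b x k c c′ , top (not b) x l d d′
    ; rest = λ (k , l) (a , b) (c , d) (c′ , d′) (c″ , d″) → rest k a c c′ c″ , rest l b d d′ d″
    ; init-∅ = λ o → cong₂ _,_ (init-∅ o) (init-∅ o)
    ; ctl-step = λ b x (c , d) → cong₂ _,_ (ctl-step b x c) (ctl-step (not b) x d)
    ; cell-top = λ b x (c , d) → cong₂ _,_ (cell-top b x c) (cell-top (not b) x d)
    ; cell-rest = λ b x (c , d) o → cong₂ _,_ (cell-rest b x c o) (cell-rest (not b) x d o)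
    ; rest-∅ = λ (k , l) (c , d) → cong₂ _,_ (rest-∅ k c) (rest-∅ l d)
    }
    where open LocalMachine M

  dbl : ℕ → ℕ
  dbl zero    = zero
  dbl (suc n) = suc (suc (dbl n))

  half : ℕ → ℕ
  half zero          = zero
  half (suc zero)    = zero
  half (suc (suc n)) = suc (half n)

  odd : ℕ → Bool
  odd zero          = false
  odd (suc zero)    = true
  odd (suc (suc n)) = odd n

  dbl+ : Bool → ℕ → ℕ
  dbl+ false n = dbl n
  dbl+ true  n = suc (dbl n)

  half-dbl+ : ∀ b n → half (dbl+ b n) ≡ n
  half-dbl+ false zero    = refl
  half-dbl+ false (suc n) = cong suc (half-dbl+ false n)
  half-dbl+ true  zero    = refl
  half-dbl+ true  (suc n) = cong suc (half-dbl+ true n)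

  odd-dbl+ : ∀ b n → odd (dbl+ b n) ≡ b
  odd-dbl+ false zero    = refl
  odd-dbl+ false (suc n) = odd-dbl+ false n
  odd-dbl+ true  zero    = refl
  odd-dbl+ true  (suc n) = odd-dbl+ true n

  dbl≡+ : ∀ n → dbl n ≡ n + n
  dbl≡+ zero    = refl
  dbl≡+ (suc n) = cong suc (trans (cong suc (dbl≡+ n)) (sym (+-suc n n)))

  isZero : ℕ → Bool
  isZero zero    = true
  isZero (suc _) = false

  -- The nodes of the binary tree in breadth-first order: `left` counts the nodes to the right of the
  -- node on its level, so that ⟨ i , r , j ⟩ is the mirror image of ⟨ i , j , r ⟩.
  record Entry : Set where
    constructor ⟨_,_,_⟩
    field
      level index left : ℕ
  open Entry public

  root : Entry
  root = ⟨ 0 , 0 , 0 ⟩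

  nextE : Entry → Entry
  nextE ⟨ i , j , suc r ⟩ = ⟨ i , suc j , r ⟩
  -- At the last entry the level has j + 1 entries, so the next one has 2j + 2, of which 2j + 1
  -- follow the first.
  nextE ⟨ i , j , zero ⟩  = ⟨ suc i , 0 , suc (dbl j) ⟩

  kid : Bool → Entry → Entry
  kid b ⟨ i , j , r ⟩ = ⟨ suc i , dbl+ b j , dbl+ (not b) r ⟩

  mirror : Entry → Entry
  mirror ⟨ i , j , r ⟩ = ⟨ i , r , j ⟩

  nextE-kid : ∀ e → nextE (kid true e) ≡ kid false (nextE e)
  nextE-kid ⟨ i , j , zero ⟩  = refl
  nextE-kid ⟨ i , j , suc r ⟩ = refl

  -- An entry of level i occupies i + 1 consecutive letters; `more` counts the letters to come.
  record Address : Set where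
    constructor _at_∣_
    field
      entry       : Entry
      offset more : ℕ
  open Address public

  first : Entry → Address
  first e = e at 0 ∣ level e

  nextA : Address → Address
  nextA (e at o ∣ suc s) = e at suc o ∣ s
  nextA (e at o ∣ zero)  = first (nextE e)

  addr : ℕ → Address
  addr zero    = first root
  addr (suc p) = nextA (addr p)

  lev : Address → ℕ
  lev a = level (entry a)

  lev-nextA : ∀ a → lev a ≤ lev (nextA a) × lev (nextA a) ≤ suc (lev a)
  lev-nextA (e at o ∣ suc s) = ≤-refl , n≤1+n _
  lev-nextA (⟨ i , j , zero ⟩ at o ∣ zero) = n≤1+n _ , ≤-refl
  lev-nextA (⟨ i , j , suc r ⟩ at o ∣ zero) = ≤-refl , n≤1+n _

  lev-mono : ∀ {p q} → p ≤ q → lev (addr p) ≤ lev (addr q)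
  lev-mono le = go (≤⇒≤′ le)
    where
    go : ∀ {p q} → p ≤′ q → lev (addr p) ≤ lev (addr q)
    go ≤′-refl = ≤-refl
    go {q = suc q} (≤′-step le) = ≤-trans (go le) (proj₁ (lev-nextA (addr q)))

  lev-reflects-< : ∀ {p q} → lev (addr p) < lev (addr q) → p < q
  lev-reflects-< lt = ≰⇒> (λ le → <⇒≱ lt (lev-mono le))

  -- One letter raises the level by at most one. This is the source of causality: the annotation of
  -- round p depends on at most p letters of x, all of them played by then.
  lev≤ : ∀ p → lev (addr p) ≤ p
  lev≤ zero    = z≤n
  lev≤ (suc p) = ≤-trans (proj₂ (lev-nextA (addr p))) (s≤s (lev≤ p))

  lev-unbounded : ∀ N → ∃ λ p → lev (addr p) ≡ N
  lev-unbounded zero    = 0 , refl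
  lev-unbounded (suc N) with lev-unbounded N
  -- The recursion is lexicographic in the entries remaining on the level and the letters remaining
  -- in the entry.
  ... | p , e = climb p (left (entry (addr p))) (more (addr p)) (addr p) refl refl refl e
    where
    climb : ∀ p r s a → addr p ≡ a → left (entry a) ≡ r → more a ≡ s → lev a ≡ N → ∃ λ p → lev (addr p) ≡ suc N
    climb p zero zero (⟨ i , j , .0 ⟩ at o ∣ .0) e refl refl refl = suc p , cong (λ a → lev (nextA a)) e
    climb p r (suc s) (⟨ i , j , .r ⟩ at o ∣ .(suc s)) e refl refl refl =
      climb (suc p) r s _ (cong nextA e) refl refl refl
    climb p (suc r) zero (⟨ i , j , .(suc r) ⟩ at o ∣ .0) e refl refl refl =
      climb (suc p) r i _ (cong nextA e) refl refl refl

  module Letters {X : Set} (finX : Finite X) (M : LocalMachine X) where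
    open LocalMachine M

    -- Input, control and the mark of the last entry are repeated in every letter of an entry, so a
    -- head has them at hand wherever it stands; only `content` and `ends` vary inside an entry.
    record Letter : Set where
      constructor letter
      field
        declared : Maybe X
        control  : Ctl
        content  : Cell
        ends     : Bool
        isLast   : Bool
    open Letter public

    finLetter : Finite Letter
    finLetter = finRetract (λ (letter a b c d e) → a , b , c , d , e) (λ (a , b , c , d , e) → letter a b c d e)
      (λ _ → refl) (fin× (finMaybe finX) (fin× finCtl (fin× finCell (fin× finBool finBool))))

    endsLevel : Letter → Bool
    endsLevel l = ends l ∧ isLast l

    module _ (x : ℕ → X) where

      conf : ℕ → ℕ → Conf
      conf zero    j = init
      conf (suc i) j = step (odd j) (x i) (conf i (half j))

      confAt : Entry → Conf
      confAt e = conf (level e) (index e)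

      input : ℕ → Maybe X
      input zero    = nothing
      input (suc i) = just (x i)

      letterAt : Address → Letter
      letterAt (e at o ∣ s) =
        letter (input (level e)) (ctl (confAt e)) (cell (confAt e) o) (isZero s) (isZero (left e))

      conf-kid : ∀ b e → confAt (kid b e) ≡ step b (x (level e)) (confAt e)
      conf-kid b ⟨ i , j , r ⟩ = cong₂ (λ b j → step b (x i) (conf i j)) (odd-dbl+ b j) (half-dbl+ b j)

      -- A blank cell with blank neighbours stays blank, so contents spread by one cell per step. On
      -- level i the cell at offset i is still blank, hence i + 1 letters show the whole
      -- configuration.
      conf-∅ : ∀ i j o → i ≤ o → cell (conf i j) o ≡ ∅
      conf-∅ zero    j o le = init-∅ o
      conf-∅ (suc i) j (suc o) (s≤s le) = begin
        cell (conf (suc i) j) (suc o) ≡⟨ cell-rest _ _ c o ⟩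
        rest (ctl c) (cell c 0) (cell c o) (cell c (suc o)) (cell c (suc (suc o)))
          ≡⟨ cong₂ (λ a b → rest (ctl c) (cell c 0) a b (cell c (suc (suc o)))) (conf-∅ i _ o le) (conf-∅ i _ (suc o) (m≤n⇒m≤1+n le)) ⟩
        rest (ctl c) (cell c 0) ∅ ∅ (cell c (suc (suc o)))
          ≡⟨ cong (rest (ctl c) (cell c 0) ∅ ∅) (conf-∅ i _ (suc (suc o)) (m≤n⇒m≤1+n (m≤n⇒m≤1+n le))) ⟩
        rest (ctl c) (cell c 0) ∅ ∅ ∅ ≡⟨ rest-∅ _ _ ⟩
        ∅ ∎
        where
        open ≡-Reasoning
        c = conf i (half j)

    conf-causal : ∀ x x′ i j → (∀ k → k < i → x k ≡ x′ k) → conf x i j ≡ conf x′ i j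
    conf-causal x x′ zero    j e = refl
    conf-causal x x′ (suc i) j e =
      cong₂ (step (odd j)) (e i ≤-refl) (conf-causal x x′ i (half j) (λ k lt → e k (m≤n⇒m≤1+n lt)))

    letterAt-causal : ∀ x x′ a → (∀ k → k < lev a → x k ≡ x′ k) → letterAt x a ≡ letterAt x′ a
    letterAt-causal x x′ (⟨ i , j , r ⟩ at o ∣ s) e =
      cong₂ (λ m c → letter m (ctl c) (cell c o) (isZero s) (isZero r)) (input-causal i e) (conf-causal x x′ i j e)
      where
      input-causal : ∀ i → (∀ k → k < i → x k ≡ x′ k) → input x i ≡ input x′ i
      input-causal zero    e = refl
      input-causal (suc i) e = cong just (e i ≤-refl)

    -- The letter of the b-th child, computed from a window on the parent: its first letter, the
    -- previous cell (absent at offset 0), the current and the next one.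
    expected : X → Bool → Letter → Maybe Cell → Cell → Cell → Bool → Letter
    expected x b f nothing  c n e = letter (just x) (κ (control f) (content f)) (top b x (control f) c n) e (b ∧ isLast f)
    expected x b f (just p) c n e = letter (just x) (κ (control f) (content f)) (rest (control f) (content f) p c n) e (b ∧ isLast f)

    before : (ℕ → Cell) → ℕ → Maybe Cell
    before c zero    = nothing
    before c (suc o) = just (c o)

    expected-correct : ∀ x b e o s → letterAt x (kid b e at o ∣ s) ≡
      expected (x (level e)) b (letterAt x (first e)) (before (cell (confAt x e)) o)
        (cell (confAt x e) o) (cell (confAt x e) (suc o)) (isZero s)
    expected-correct x b e o s rewrite conf-kid x b e | ctl-step b (x (level e)) (confAt x e) = lemma o
      where
      last-kid : ∀ b r → isZero (dbl+ (not b) r) ≡ (b ∧ isZero r)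
      last-kid false r       = refl
      last-kid true  zero    = refl
      last-kid true  (suc r) = refl
      lemma : ∀ o → letter (just (x (level e))) (κ (ctl (confAt x e)) (cell (confAt x e) 0))
          (cell (step b (x (level e)) (confAt x e)) o) (isZero s) (isZero (left (kid b e))) ≡
        expected (x (level e)) b (letterAt x (first e)) (before (cell (confAt x e)) o)
        (cell (confAt x e) o) (cell (confAt x e) (suc o)) (isZero s)
      lemma zero    = cong₂ (λ c l → letter (just (x (level e))) (κ (ctl (confAt x e)) (cell (confAt x e) 0)) c (isZero s) l) (cell-top b _ (confAt x e)) (last-kid b (left e))
      lemma (suc o) = cong₂ (λ c l → letter (just (x (level e))) (κ (ctl (confAt x e)) (cell (confAt x e) 0)) c (isZero s) l) (cell-rest b _ (confAt x e) o) (last-kid b (left e))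

-- Automata that accept exactly when the annotation contains an error.

module ErrorDetection where
  open FiniteTypes
  open Automata
  open Tree
  open import Data.Fin using (Fin; zero; suc)
  open import Relation.Nullary using (does)

  absurd : {A : Set} → false ≡ true → A
  absurd ()

  module _ {U V : Set} (𝒜 : Automaton U V) (u : ℕ → U) (v : ℕ → V) where
    open Automaton 𝒜
    open Runs 𝒜 u v hiding (Accepted; Accepting)

    invariant : (Inv : State → ℕ → ℕ → Set) → Inv start 0 0 →
      (∀ q p₁ p₂ b → Inv q p₁ p₂ → Inv (succ-state q p₁ p₂ b) (advance (move₁ q) p₁) (advance (move₂ q) p₂)) →
      ∀ o n → Inv (stateAt o n) (pos₁ o n) (pos₂ o n)
    invariant Inv i₀ pres o zero    = i₀
    invariant Inv i₀ pres o (suc n) = pres _ _ _ (o n) (invariant Inv i₀ pres o n)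

    never-accepts : (Inv : State → ℕ → ℕ → Set) → Inv start 0 0 →
      (∀ q p₁ p₂ b → Inv q p₁ p₂ → Inv (succ-state q p₁ p₂ b) (advance (move₁ q) p₁) (advance (move₂ q) p₂)) →
      (∀ q p₁ p₂ → acc q ≡ true → ¬ Inv q p₁ p₂) → ¬ Accepted 𝒜 u v
    never-accepts Inv i₀ pres none (o , a) = let n , _ , e = recurs 0 in
      none accState _ _ isAcc (subst (λ q → Inv q (pos₁ o n) (pos₂ o n)) e (invariant Inv i₀ pres o n))
      where open Runs.Accepting a

    module _ (sink : State) (stay₁ : move₁ sink ≡ true) (stay₂ : move₂ sink ≡ true)
             (stays : ∀ a b o → δ sink a b o ≡ sink) where

      reaches-sink : acc sink ≡ true → ∀ o m → stateAt o m ≡ sink → Accepted 𝒜 u v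
      reaches-sink isA o m e = o , record
        { unbounded₁ = λ N → suc N + m , below (pos₁ o) (suc N) (λ i → trans (cong (λ q → advance (move₁ q) (pos₁ o (i + m))) (later i)) (cong (λ b → advance b (pos₁ o (i + m))) stay₁))
        ; unbounded₂ = λ N → suc N + m , below (pos₂ o) (suc N) (λ i → trans (cong (λ q → advance (move₂ q) (pos₂ o (i + m))) (later i)) (cong (λ b → advance b (pos₂ o (i + m))) stay₂))
        ; accState = sink ; isAcc = isA
        ; recurs = λ N → N + m , m≤m+n N m , later N }
        where
        later : ∀ i → stateAt o (i + m) ≡ sink
        later zero    = e
        later (suc i) = trans (cong (λ q → succ-state q (pos₁ o (i + m)) (pos₂ o (i + m)) (o (i + m))) (later i)) (stays _ _ _)
        below : ∀ (pos : ℕ → ℕ) i → (∀ i → pos (suc i + m) ≡ suc (pos (i + m))) → i ≤ pos (i + m)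
        below pos zero    inc = z≤n
        below pos (suc i) inc = subst (suc i ≤_) (sym (inc i)) (s≤s (below pos i inc))

      -- The invariant has to survive only while head 2 reads before the error at p, where the
      -- annotation is correct. Head 2 never rests twice in a row, so it arrives at p, and the move
      -- made there leads to the sink.
      detects : acc sink ≡ true → (p : ℕ) (Inv : State → ℕ → ℕ → Set) → Inv start 0 0 →
        (∀ q p₁ p₂ b → Inv q p₁ p₂ → p₂ ≤ p → (move₂ q ≡ true → p₂ < p) →
          Inv (succ-state q p₁ p₂ b) (advance (move₁ q) p₁) (advance (move₂ q) p₂)) →
        (∀ q a b o → move₂ q ≡ true ⊎ move₂ (δ q a b o) ≡ true) →
        (∀ q p₁ b → Inv q p₁ p → move₂ q ≡ true → succ-state q p₁ p b ≡ sink) → Accepted 𝒜 u v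
      detects isA p Inv i₀ pres alt hit = let m , e = go p 0 i₀ z≤n (m≤m+n p 0) in reaches-sink isA o m e
        where
        o : ℕ → Bool
        o _ = false

        Found : Set
        Found = ∃ λ m → stateAt o m ≡ sink

        moving : ∀ n → Inv (stateAt o n) (pos₁ o n) (pos₂ o n) → pos₂ o n ≤ p → move₂ (stateAt o n) ≡ true →
          (Inv (stateAt o (suc n)) (pos₁ o (suc n)) (pos₂ o (suc n)) → pos₂ o (suc n) ≡ suc (pos₂ o n) → pos₂ o n < p → Found) → Found
        moving n inv le mv k with m≤n⇒m<n∨m≡n le
        ... | inj₁ lt = k (pres _ _ _ false inv le (λ _ → lt)) (cong (λ b → advance b (pos₂ o n)) mv) lt
        ... | inj₂ e  = suc n , trans (cong (λ p₂ → succ-state (stateAt o n) (pos₁ o n) p₂ false) e)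
                                (hit _ _ false (subst (Inv (stateAt o n) (pos₁ o n)) e inv) mv)

        go : ∀ fuel n → Inv (stateAt o n) (pos₁ o n) (pos₂ o n) → pos₂ o n ≤ p → p ≤ fuel + pos₂ o n → Found
        move : ∀ fuel n → Inv (stateAt o n) (pos₁ o n) (pos₂ o n) → pos₂ o n ≤ p → p ≤ fuel + pos₂ o n →
          move₂ (stateAt o n) ≡ true → Found
        move zero n inv le bound mv = moving n inv le mv (λ _ _ lt → ⊥-elim (<⇒≱ lt bound))
        move (suc fuel) n inv le bound mv = moving n inv le mv λ inv′ e lt →
          go fuel (suc n) inv′ (subst (_≤ p) (sym e) lt)
            (≤-trans bound (≤-reflexive (trans (sym (+-suc fuel _)) (cong (fuel +_) (sym e)))))
        go fuel n inv le bound with move₂ (stateAt o n) in mv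
        ... | true  = move fuel n inv le bound mv
        ... | false with alt (stateAt o n) (readAt _ u (pos₁ o n)) (readAt _ v (pos₂ o n)) false
        ...   | inj₁ t = absurd (trans (sym mv) t)
        ...   | inj₂ t = move fuel (suc n) (pres _ _ _ false inv le (λ t → absurd (trans (sym mv) t)))
                           (subst (_≤ p) (sym e) le) (subst (λ p₂ → p ≤ fuel + p₂) (sym e) bound) t
          where
          e : pos₂ o (suc n) ≡ pos₂ o n
          e = cong (λ b → advance b (pos₂ o n)) mv

  module Errors {X : Set} (finX : Finite X) (M : LocalMachine X) where
    open LocalMachine M
    open Letters finX M

    rootLetter : Letter
    rootLetter = letter nothing (ctl init) (cell init 0) true true

    _≟ˡ_ : (l l′ : Letter) → Dec (l ≡ l′)
    _≟ˡ_ = Finite._≟ᴬ_ finLetter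

    _≟ᵐ_ : (m m′ : Maybe X) → Dec (m ≡ m′)
    _≟ᵐ_ = Finite._≟ᴬ_ (finMaybe finX)

    advA : Bool → Address → Address
    advA true  a = nextA a
    advA false a = a

    addr-advance : ∀ m p → addr (advance m p) ≡ advA m (addr p)
    addr-advance true  p = refl
    addr-advance false p = refl

    module Machines {U V : Set} (note₁ : U → Letter) (note₂ : V → Letter) (in₁ : U → X × X) where

      pattern initialE = zero
      pattern equalE   = suc zero
      pattern sinkE    = suc (suc zero)

      -- Comparing the two copies lets the other detectors judge the copy on tape 2 and take their
      -- reference data from tape 1.
      equality : Automaton U V
      equality = record
        { State = Fin 3 ; finite = finFin 3 ; start = initialE
        ; acc = λ { sinkE → true ; _ → false }
        ; move₁ = λ _ → true ; move₂ = λ _ → true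
        ; δ = λ { initialE u v _ → if does (note₁ u ≟ˡ rootLetter) ∧ does (note₂ v ≟ˡ rootLetter) then equalE else sinkE
                ; equalE u v _ → if does (note₁ u ≟ˡ note₂ v) then equalE else sinkE
                ; sinkE u v _ → sinkE } }

      -- Head 1 reads one letter ahead, so that the window on the parent includes a next cell:
      -- `firstC` fetches the first letter. A child letter is compared in `moreC` while the parent
      -- has a further letter, in `lastC` when it has none, and in `overC` at the extra letter by
      -- which a child is longer. `skipC` passes the other child.
      pattern rootC  = inj₁ zero
      pattern skipC  = inj₁ (suc zero)
      pattern firstC = inj₁ (suc (suc zero))
      pattern sinkC  = inj₁ (suc (suc (suc zero)))
      pattern moreC f p c = inj₂ (f , p , c , zero)
      pattern lastC f p c = inj₂ (f , p , c , suc zero)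
      pattern overC f p c = inj₂ (f , p , c , suc (suc zero))

      -- The input is taken from the child's own declaration, so this test involves no letters of
      -- the game; wrong declarations are left to `inputs`. A missing declaration is legitimate at
      -- the root only, which is no child.
      verdict : Letter → (X → Letter) → Bool
      verdict l ex with declared l
      ... | nothing = false
      ... | just x  = does (l ≟ˡ ex x)

      CState : Set
      CState = Fin 4 ⊎ (Letter × Maybe Cell × Cell × Fin 3)

      -- Compares every entry with its b-th child.
      module Child (b : Bool) where

        move₁ᶜ move₂ᶜ : CState → Bool
        move₁ᶜ rootC = false
        move₁ᶜ skipC = false
        move₁ᶜ firstC = true
        move₁ᶜ sinkC = true
        move₁ᶜ (moreC _ _ _) = true
        move₁ᶜ (lastC _ _ _) = false
        move₁ᶜ (overC _ _ _) = false
        move₂ᶜ rootC = true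
        move₂ᶜ skipC = true
        move₂ᶜ firstC = false
        move₂ᶜ sinkC = true
        move₂ᶜ (moreC _ _ _) = true
        move₂ᶜ (lastC _ _ _) = true
        move₂ᶜ (overC _ _ _) = true

        δᶜ : (q : CState) → Opt (move₁ᶜ q) U → Opt (move₂ᶜ q) V → Bool → CState
        δᶜ rootC _ _ _ = if b then skipC else firstC
        δᶜ skipC _ v _ = if ends (note₂ v) then firstC else skipC
        δᶜ firstC u _ _ =
          if ends (note₁ u) then lastC (note₁ u) nothing (content (note₁ u)) else moreC (note₁ u) nothing (content (note₁ u))
        δᶜ sinkC _ _ _ = sinkC
        δᶜ (moreC f p c) u v _ = if verdict (note₂ v) (λ x → expected x b f p c (content (note₁ u)) false)
          then (if ends (note₁ u) then lastC f (just c) (content (note₁ u)) else moreC f (just c) (content (note₁ u)))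
          else sinkC
        δᶜ (lastC f p c) _ v _ = if verdict (note₂ v) (λ x → expected x b f p c ∅ false) then overC f (just c) ∅ else sinkC
        δᶜ (overC f p c) _ v _ = if verdict (note₂ v) (λ x → expected x b f p c ∅ true) then skipC else sinkC

        children : Automaton U V
        children = record
          { State = CState
          ; finite = fin⊎ (finFin 4) (fin× finLetter (fin× (finMaybe finCell) (fin× finCell (finFin 3))))
          ; start = rootC ; acc = λ { sinkC → true ; _ → false }
          ; move₁ = move₁ᶜ ; move₂ = move₂ᶜ ; δ = δᶜ }

        module _ (x : ℕ → X) where

          data Inv : CState → Address → Address → Set where
            at-root  : Inv rootC (first root) (first root)
            -- Head 2 is on the other child of e. If b = true, the wanted child of e comes next; if
            -- b = false, it has already been compared and head 1 is waiting at the next parent.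
            at-skip  : ∀ e o s → Inv skipC (first (if b then e else nextE e)) (kid (not b) e at o ∣ s)
            at-first : ∀ e → Inv firstC (first e) (first (kid b e))
            at-more  : ∀ e o s {f p c} → suc o + s ≡ level e → f ≡ letterAt x (first e) →
              p ≡ before (cell (confAt x e)) o → c ≡ cell (confAt x e) o →
              Inv (moreC f p c) (e at suc o ∣ s) (kid b e at o ∣ suc (suc s))
            at-last  : ∀ e o {f p c} → o ≡ level e → f ≡ letterAt x (first e) →
              p ≡ before (cell (confAt x e)) o → c ≡ cell (confAt x e) o →
              Inv (lastC f p c) (first (nextE e)) (kid b e at o ∣ 1)
            at-over  : ∀ e o {f p c} → o ≡ level e → f ≡ letterAt x (first e) →
              p ≡ just (cell (confAt x e) o) → c ≡ ∅ →
              Inv (overC f p c) (first (nextE e)) (kid b e at suc o ∣ 0)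

          Reads₁ : ∀ m → Opt m U → Address → Set
          Reads₁ true  u a = note₁ u ≡ letterAt x a
          Reads₁ false u a = ⊤

          Reads₂ : ∀ m → Opt m V → Address → Set
          Reads₂ true  v a = note₂ v ≡ letterAt x a
          Reads₂ false v a = ⊤

          verdict-good : ∀ {l} e ex → l ≡ ex (x (level e)) → declared (ex (x (level e))) ≡ just (x (level e)) → verdict l ex ≡ true
          verdict-good {l} e ex refl d rewrite d with ex (x (level e)) ≟ˡ ex (x (level e))
          ... | yes _ = refl
          ... | no ne = ⊥-elim (ne refl)

          verdict-bad : ∀ {l} e ex → declared l ≡ just (x (level e)) → ¬ l ≡ ex (x (level e)) → verdict l ex ≡ false
          verdict-bad {l} e ex d ne rewrite d with l ≟ˡ ex (x (level e))
          ... | yes l≡ = ⊥-elim (ne l≡)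
          ... | no _ = refl

          declared-expected : ∀ {y f} p {c n e} → declared (expected y b f p c n e) ≡ just y
          declared-expected nothing  = refl
          declared-expected (just _) = refl

          first-cell : ∀ {q} e s {a₂} → s ≡ level e → {l : Letter} → l ≡ letterAt x (e at 0 ∣ s) →
            (∀ {l} → l ≡ letterAt x (first e) → level e ≡ 0 → Inv (lastC l nothing (content l)) (first (nextE e)) a₂) →
            (∀ {l} s → l ≡ letterAt x (first e) → level e ≡ suc s → Inv (moreC l nothing (content l)) (e at 1 ∣ s) a₂) →
            q ≡ (if ends l then lastC l nothing (content l) else moreC l nothing (content l)) → Inv q (nextA (e at 0 ∣ s)) a₂
          first-cell e zero    el refl kl km refl = kl (cong (λ s → letterAt x (e at 0 ∣ s)) el) (sym el)
          first-cell e (suc s) el refl kl km refl = km s (cong (λ s → letterAt x (e at 0 ∣ s)) el) (sym el)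

          preserved : ∀ {q a₁ a₂} o → Inv q a₁ a₂ → ∀ u v → Reads₁ (move₁ᶜ q) u a₁ → Reads₂ (move₂ᶜ q) v a₂ →
            Inv (δᶜ q u v o) (advA (move₁ᶜ q) a₁) (advA (move₂ᶜ q) a₂)
          preserved _ at-root u v r₁ r₂ = helper b refl
            where
            helper : ∀ c → b ≡ c → Inv (if c then skipC else firstC) (first root) (first ⟨ 1 , 0 , 1 ⟩)
            helper false refl = at-first root
            helper true  refl = at-skip root 0 1
          preserved _ (at-skip e o (suc s)) u v r₁ r₂ rewrite r₂ = at-skip e (suc o) s
          preserved _ (at-skip e o zero) u v r₁ r₂ rewrite r₂ = helper b refl
            where
            helper : ∀ c → b ≡ c → Inv firstC (first (if c then e else nextE e)) (first (nextE (kid (not c) e)))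
            helper false refl = subst (λ e′ → Inv firstC (first (nextE e)) (first e′)) (sym (nextE-kid e)) (at-first (nextE e))
            helper true  refl = at-first e
          preserved _ (at-first e) u v r₁ r₂ = first-cell e (level e) refl r₁
            (λ {l} l≡ z → subst (λ s → Inv (lastC l nothing (content l)) (first (nextE e)) (kid b e at 0 ∣ suc s)) (sym z)
               (at-last e 0 (sym z) l≡ refl (cong content l≡)))
            (λ {l} s l≡ z → subst (λ s′ → Inv (moreC l nothing (content l)) (e at 1 ∣ s) (kid b e at 0 ∣ suc s′)) (sym z)
               (at-more e 0 s (sym z) l≡ refl (cong content l≡))) refl
          preserved _ (at-more e o s {p = p} el refl refl refl) u v r₁ r₂
            rewrite verdict-good {l = note₂ v} e (λ y → expected y b (letterAt x (first e)) p (cell (confAt x e) o) (content (note₁ u)) false)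
                      (trans r₂ (trans (expected-correct x b e o (suc (suc s)))
                        (cong (λ n → expected (x (level e)) b (letterAt x (first e)) p (cell (confAt x e) o) n false) (sym (cong content r₁)))))
                      (declared-expected p) = helper s el r₁
            where
            helper : ∀ s → suc o + s ≡ level e → note₁ u ≡ letterAt x (e at suc o ∣ s) →
              Inv (if ends (note₁ u) then lastC (letterAt x (first e)) (just (cell (confAt x e) o)) (content (note₁ u))
                   else moreC (letterAt x (first e)) (just (cell (confAt x e) o)) (content (note₁ u)))
                  (nextA (e at suc o ∣ s)) (kid b e at suc o ∣ suc s)
            helper zero    el r rewrite r = at-last e (suc o) (trans (sym (+-identityʳ (suc o))) el) refl refl refl
            helper (suc s) el r rewrite r = at-more e (suc o) s (trans (sym (+-suc (suc o) s)) el) refl refl refl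
          preserved _ (at-last e o {p = p} el refl refl refl) u v r₁ r₂
            rewrite verdict-good {l = note₂ v} e (λ y → expected y b (letterAt x (first e)) p (cell (confAt x e) o) ∅ false)
                      (trans r₂ (trans (expected-correct x b e o 1)
                        (cong (λ n → expected (x (level e)) b (letterAt x (first e)) p (cell (confAt x e) o) n false)
                          (conf-∅ x (level e) (index e) (suc o) (m≤n⇒m≤1+n (≤-reflexive (sym el)))))))
                      (declared-expected p) = at-over e o el refl refl refl
          preserved _ (at-over e o el refl refl refl) u v r₁ r₂
            rewrite verdict-good {l = note₂ v} e (λ y → expected y b (letterAt x (first e)) (just (cell (confAt x e) o)) ∅ ∅ true)
                      (trans r₂ (trans (expected-correct x b e (suc o) 0)
                        (cong₂ (λ c n → expected (x (level e)) b (letterAt x (first e)) (just (cell (confAt x e) o)) c n true)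
                          (conf-∅ x (level e) (index e) (suc o) (m≤n⇒m≤1+n (≤-reflexive (sym el))))
                          (conf-∅ x (level e) (index e) (suc (suc o)) (m≤n⇒m≤1+n (m≤n⇒m≤1+n (≤-reflexive (sym el))))))))
                      refl = helper b refl
            where
            helper : ∀ c → b ≡ c → Inv skipC (first (nextE e)) (first (nextE (kid c e)))
            helper false refl = at-skip e 0 (suc (level e))
            helper true  refl = subst (λ e′ → Inv skipC (first (nextE e)) (first e′)) (sym (nextE-kid e)) (at-skip (nextE e) 0 (suc (level (nextE e))))

          -- A parent is on an earlier level than its child, so head 1 reads strictly before head 2,
          -- and correctness before the error serves both heads.
          lower-head : ∀ {q a₁ a₂} → Inv q a₁ a₂ → move₁ᶜ q ≡ true → lev a₁ < lev a₂
          lower-head (at-first e) _ = ≤-refl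
          lower-head (at-more e _ _ _ _ _ _) _ = ≤-refl

          alternates : ∀ q u v o → move₂ᶜ q ≡ true ⊎ move₂ᶜ (δᶜ q u v o) ≡ true
          alternates rootC u v o = inj₁ refl
          alternates skipC u v o = inj₁ refl
          alternates firstC u v o with ends (note₁ u)
          ... | true  = inj₂ refl
          ... | false = inj₂ refl
          alternates sinkC u v o = inj₁ refl
          alternates (moreC _ _ _) u v o = inj₁ refl
          alternates (lastC _ _ _) u v o = inj₁ refl
          alternates (overC _ _ _) u v o = inj₁ refl

          -- The parity of the index excludes `at-skip`: head 2 is then on a b-th child, and every
          -- b-th child is compared letter by letter.
          hits : ∀ {q a₁ a₂} i o → Inv q a₁ a₂ → lev a₂ ≡ suc i → odd (index (entry a₂)) ≡ b → ∀ u v → Reads₁ (move₁ᶜ q) u a₁ →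
            (mv : move₂ᶜ q ≡ true) → let l = note₂ (subst (λ m → Opt m V) mv v) in
            declared l ≡ just (x i) → ¬ l ≡ letterAt x a₂ → δᶜ q u v o ≡ sinkC
          hits i _ (at-skip e o s) el ob u v r₁ refl d ne = ⊥-elim (not-self b (trans (sym (odd-dbl+ (not b) (index e))) ob))
            where
            not-self : ∀ b → ¬ not b ≡ b
            not-self false ()
            not-self true ()
          hits i _ (at-more e o s {p = p} el₀ refl refl refl) refl ob u v r₁ refl d ne
            rewrite verdict-bad {l = note₂ v} e (λ y → expected y b (letterAt x (first e)) p (cell (confAt x e) o) (content (note₁ u)) false) d
              (λ l≡ → ne (trans l≡ (sym (trans (expected-correct x b e o (suc (suc s)))
                        (cong (λ n → expected (x (level e)) b (letterAt x (first e)) p (cell (confAt x e) o) n false) (sym (cong content r₁)))))))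
            = refl
          hits i _ (at-last e o {p = p} el₀ refl refl refl) refl ob u v r₁ refl d ne
            rewrite verdict-bad {l = note₂ v} e (λ y → expected y b (letterAt x (first e)) p (cell (confAt x e) o) ∅ false) d
              (λ l≡ → ne (trans l≡ (sym (trans (expected-correct x b e o 1)
                        (cong (λ n → expected (x (level e)) b (letterAt x (first e)) p (cell (confAt x e) o) n false)
                          (conf-∅ x (level e) (index e) (suc o) (m≤n⇒m≤1+n (≤-reflexive (sym el₀)))))))))
            = refl
          hits i _ (at-over e o el₀ refl refl refl) refl ob u v r₁ refl d ne
            rewrite verdict-bad {l = note₂ v} e (λ y → expected y b (letterAt x (first e)) (just (cell (confAt x e) o)) ∅ ∅ true) d
              (λ l≡ → ne (trans l≡ (sym (trans (expected-correct x b e (suc o) 0)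
                        (cong₂ (λ c n → expected (x (level e)) b (letterAt x (first e)) (just (cell (confAt x e) o)) c n true)
                          (conf-∅ x (level e) (index e) (suc o) (m≤n⇒m≤1+n (≤-reflexive (sym el₀))))
                          (conf-∅ x (level e) (index e) (suc (suc o)) (m≤n⇒m≤1+n (m≤n⇒m≤1+n (≤-reflexive (sym el₀))))))))))
            = refl

      pattern rootI = inj₁ zero
      pattern readI = inj₁ (suc zero)
      pattern sinkI = inj₁ (suc (suc zero))
      pattern bothI x y = inj₂ (inj₁ (x , y))
      pattern oneI y    = inj₂ (inj₂ y)

      IState : Set
      IState = Fin 3 ⊎ (X × X ⊎ X)

      move₁ⁱ move₂ⁱ : IState → Bool
      move₁ⁱ rootI = false
      move₁ⁱ readI = true
      move₁ⁱ sinkI = true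
      move₁ⁱ (bothI _ _) = false
      move₁ⁱ (oneI _) = false
      move₂ⁱ rootI = true
      move₂ⁱ readI = false
      move₂ⁱ sinkI = true
      move₂ⁱ (bothI _ _) = true
      move₂ⁱ (oneI _) = true

      δⁱ : (q : IState) → Opt (move₁ⁱ q) U → Opt (move₂ⁱ q) V → Bool → IState
      δⁱ rootI _ _ _ = readI
      δⁱ readI u _ _ = bothI (proj₁ (in₁ u)) (proj₂ (in₁ u))
      δⁱ sinkI _ _ _ = sinkI
      δⁱ (bothI x y) _ v _ =
        if does (declared (note₂ v) ≟ᵐ just x) then (if endsLevel (note₂ v) then oneI y else bothI x y) else sinkI
      δⁱ (oneI y) _ v _ =
        if does (declared (note₂ v) ≟ᵐ just y) then (if endsLevel (note₂ v) then readI else oneI y) else sinkI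

      -- Compares the letters of the n-th round with the letters declared on levels 2n+1 and 2n+2.
      inputs : Automaton U V
      inputs = record
        { State = IState
        ; finite = fin⊎ (finFin 3) (fin⊎ (fin× finX finX) finX)
        ; start = rootI ; acc = λ { sinkI → true ; _ → false }
        ; move₁ = move₁ⁱ ; move₂ = move₂ⁱ ; δ = δⁱ }

      simple-errors all-errors : Bool → Automaton U V
      simple-errors false = equality
      simple-errors true  = inputs
      all-errors false = union simple-errors
      all-errors true  = union Child.children

      errors : Automaton U V
      errors = union all-errors

      lev-ends : ∀ x a → lev (nextA a) ≡ (if endsLevel (letterAt x a) then suc (lev a) else lev a)
      lev-ends x (⟨ i , j , r ⟩ at o ∣ suc s)     = refl
      lev-ends x (⟨ i , j , zero ⟩ at o ∣ zero)  = refl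
      lev-ends x (⟨ i , j , suc r ⟩ at o ∣ zero) = refl

      module _ (x : ℕ → X) where

        data InvI : IState → ℕ → Address → Set where
          at-root : InvI rootI 0 (first root)
          at-read : ∀ n {a} → lev a ≡ suc (dbl n) → InvI readI n a
          at-both : ∀ n {a y z} → lev a ≡ suc (dbl n) → y ≡ x (dbl n) → z ≡ x (suc (dbl n)) → InvI (bothI y z) (suc n) a
          at-one  : ∀ n {a z} → lev a ≡ suc (suc (dbl n)) → z ≡ x (suc (dbl n)) → InvI (oneI z) (suc n) a

        ReadsI : ∀ m → Opt m U → ℕ → Set
        ReadsI true  u n = in₁ u ≡ (x (n + n) , x (suc (n + n)))
        ReadsI false u n = ⊤

        ReadsN : ∀ m → Opt m V → Address → Set
        ReadsN true  v a = note₂ v ≡ letterAt x a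
        ReadsN false v a = ⊤

        input-at : ∀ {i} a → lev a ≡ suc i → declared (letterAt x a) ≡ just (x i)
        input-at a e = cong (input x) e

        preservedⁱ : ∀ {q n a} o → InvI q n a → ∀ u v → ReadsI (move₁ⁱ q) u n → ReadsN (move₂ⁱ q) v a →
          InvI (δⁱ q u v o) (advance (move₁ⁱ q) n) (advA (move₂ⁱ q) a)
        preservedⁱ _ at-root u v r₁ r₂ = at-read 0 refl
        preservedⁱ _ (at-read n e) u v r₁ r₂ = at-both n e
          (trans (cong proj₁ r₁) (cong x (sym (dbl≡+ n)))) (trans (cong proj₂ r₁) (cong (x ∘ suc) (sym (dbl≡+ n))))
        preservedⁱ _ (at-both n {a} e refl refl) u v r₁ r₂ rewrite r₂ with declared (letterAt x a) ≟ᵐ just (x (dbl n))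
        ... | no ne = ⊥-elim (ne (input-at a e))
        ... | yes _ with endsLevel (letterAt x a) | lev-ends x a
        ... | true  | l = at-one n (trans l (cong suc e)) refl
        ... | false | l = at-both n (trans l e) refl refl
        preservedⁱ _ (at-one n {a} e refl) u v r₁ r₂ rewrite r₂ with declared (letterAt x a) ≟ᵐ just (x (suc (dbl n)))
        ... | no ne = ⊥-elim (ne (input-at a e))
        ... | yes _ with endsLevel (letterAt x a) | lev-ends x a
        ... | true  | l = at-read (suc n) (trans l (cong suc e))
        ... | false | l = at-one n (trans l e) refl

        alternatesⁱ : ∀ q u v o → move₂ⁱ q ≡ true ⊎ move₂ⁱ (δⁱ q u v o) ≡ true
        alternatesⁱ rootI u v o = inj₁ refl
        alternatesⁱ readI u v o = inj₂ refl
        alternatesⁱ sinkI u v o = inj₁ refl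
        alternatesⁱ (bothI _ _) u v o = inj₁ refl
        alternatesⁱ (oneI _) u v o = inj₁ refl

        hitsⁱ : ∀ {q n a} i o → InvI q n a → lev a ≡ suc i → ∀ u v → (mv : move₂ⁱ q ≡ true) →
          ¬ declared (note₂ (subst (λ m → Opt m V) mv v)) ≡ just (x i) → δⁱ q u v o ≡ sinkI
        hitsⁱ i _ (at-both n e refl refl) e′ u v refl ne with declared (note₂ v) ≟ᵐ just (x (dbl n))
        ... | no _ = refl
        ... | yes d = ⊥-elim (ne (trans d (cong (just ∘ x) (suc-injective (trans (sym e) e′)))))
        hitsⁱ i _ (at-one n e refl) e′ u v refl ne with declared (note₂ v) ≟ᵐ just (x (suc (dbl n)))
        ... | no _ = refl
        ... | yes d = ⊥-elim (ne (trans d (cong (just ∘ x) (suc-injective (trans (sym e) e′)))))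

      positive-level : ∀ p → ∃ λ i → lev (addr (suc p)) ≡ suc i
      positive-level p with lev (addr (suc p)) | lev-mono {1} {suc p} (s≤s z≤n)
      ... | suc i | _ = i , refl

      module _ (u : ℕ → U) (v : ℕ → V) (x : ℕ → X) (in-ok : ∀ n → in₁ (u n) ≡ (x (n + n) , x (suc (n + n)))) where

        Good : ℕ → Set
        Good p = note₁ (u p) ≡ letterAt x (addr p) × note₂ (v p) ≡ letterAt x (addr p)

        private
          InvE : Fin 3 → ℕ → ℕ → Set
          InvE initialE p₁ p₂ = p₁ ≡ 0 × p₂ ≡ 0
          InvE equalE   p₁ p₂ = p₁ ≡ p₂ × ¬ p₂ ≡ 0
          InvE sinkE    p₁ p₂ = ⊥

          preservedᵉ : ∀ q p₁ p₂ o → InvE q p₁ p₂ → Good p₂ →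
            InvE (Runs.succ-state equality u v q p₁ p₂ o) (suc p₁) (suc p₂)
          preservedᵉ initialE _ _ o (refl , refl) (g₁ , g₂)
            with note₁ (u 0) ≟ˡ rootLetter | note₂ (v 0) ≟ˡ rootLetter
          ... | yes _ | yes _ = refl , λ ()
          ... | no ne | _     = ⊥-elim (ne g₁)
          ... | yes _ | no ne = ⊥-elim (ne g₂)
          preservedᵉ equalE p₁ _ o (refl , _) (g₁ , g₂) with note₁ (u p₁) ≟ˡ note₂ (v p₁)
          ... | yes _ = refl , λ ()
          ... | no ne = ⊥-elim (ne (trans g₁ (sym g₂)))

          preservedᵉ sinkE _ _ o () _

          hitsᵉ : ∀ q p₁ p o → ¬ Good p → (p ≡ 0 ⊎ ¬ note₁ (u p) ≡ note₂ (v p)) → InvE q p₁ p →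
            Runs.succ-state equality u v q p₁ p o ≡ sinkE
          hitsᵉ initialE _ _ o b _ (refl , refl) with note₁ (u 0) ≟ˡ rootLetter | note₂ (v 0) ≟ˡ rootLetter
          ... | yes g₁ | yes g₂ = ⊥-elim (b (g₁ , g₂))
          ... | no _   | _      = refl
          ... | yes _  | no _   = refl
          hitsᵉ equalE p _ o _ (inj₂ ne) (refl , _) with note₁ (u p) ≟ˡ note₂ (v p)
          ... | yes e = ⊥-elim (ne e)
          ... | no _  = refl
          hitsᵉ equalE p _ o _ (inj₁ z) (_ , nz) = ⊥-elim (nz z)
          hitsᵉ sinkE _ _ _ _ _ ()

          InvC : ∀ b → CState → ℕ → ℕ → Set
          InvC b q p₁ p₂ = Child.Inv b x q (addr p₁) (addr p₂)

          reads₁ : ∀ b m p → (m ≡ true → note₁ (u p) ≡ letterAt x (addr p)) → Child.Reads₁ b x m (readAt m u p) (addr p)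
          reads₁ b true  p g = g refl
          reads₁ b false p g = tt

          reads₂ : ∀ b m p → (m ≡ true → note₂ (v p) ≡ letterAt x (addr p)) → Child.Reads₂ b x m (readAt m v p) (addr p)
          reads₂ b true  p g = g refl
          reads₂ b false p g = tt

          preservedᶜ : ∀ b q p₁ p₂ o → InvC b q p₁ p₂ →
            (Child.move₁ᶜ b q ≡ true → Good p₁) → (Child.move₂ᶜ b q ≡ true → Good p₂) →
            InvC b (Runs.succ-state (Child.children b) u v q p₁ p₂ o) (advance (Child.move₁ᶜ b q) p₁) (advance (Child.move₂ᶜ b q) p₂)
          preservedᶜ b q p₁ p₂ o inv g₁ g₂ =
            subst₂ (Child.Inv b x _) (sym (addr-advance (Child.move₁ᶜ b q) p₁)) (sym (addr-advance (Child.move₂ᶜ b q) p₂))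
              (Child.preserved b x o inv _ _ (reads₁ b _ p₁ (proj₁ ∘ g₁)) (reads₂ b _ p₂ (proj₂ ∘ g₂)))

          Invⁱ : IState → ℕ → ℕ → Set
          Invⁱ q p₁ p₂ = InvI x q p₁ (addr p₂)

          readsI : ∀ m p → ReadsI x m (readAt m u p) p
          readsI true  p = in-ok p
          readsI false p = tt

          readsN : ∀ m p → (m ≡ true → note₂ (v p) ≡ letterAt x (addr p)) → ReadsN x m (readAt m v p) (addr p)
          readsN true  p g = g refl
          readsN false p g = tt

          preservedᶦ : ∀ q p₁ p₂ o → Invⁱ q p₁ p₂ → (move₂ⁱ q ≡ true → Good p₂) →
            Invⁱ (Runs.succ-state inputs u v q p₁ p₂ o) (advance (move₁ⁱ q) p₁) (advance (move₂ⁱ q) p₂)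
          preservedᶦ q p₁ p₂ o inv g = subst (InvI x _ _) (sym (addr-advance (move₂ⁱ q) p₂))
            (preservedⁱ x o inv _ _ (readsI _ p₁) (readsN _ p₂ (proj₂ ∘ g)))

          read-true : ∀ m p (mv : m ≡ true) → subst (λ m → Opt m V) mv (readAt m v p) ≡ v p
          read-true true p refl = refl

        errors-sound : (∀ p → Good p) → ¬ Accepted errors u v
        errors-sound good ac = dispatch (union-sound _ u v ac)
          where
          no-sinkᶜ : ∀ b q p₁ p₂ → Automaton.acc (Child.children b) q ≡ true → ¬ InvC b q p₁ p₂
          no-sinkᶜ b sinkC p₁ p₂ _ ()
          no-sinkᵉ : ∀ q p₁ p₂ → Automaton.acc equality q ≡ true → ¬ InvE q p₁ p₂
          no-sinkᵉ sinkE p₁ p₂ _ ()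
          no-sinkⁱ : ∀ q p₁ p₂ → Automaton.acc inputs q ≡ true → ¬ Invⁱ q p₁ p₂
          no-sinkⁱ sinkI p₁ p₂ _ ()

          dispatch₁ : ∀ c → ¬ Accepted (simple-errors c) u v
          dispatch₁ false = never-accepts equality u v InvE (refl , refl) (λ q p₁ p₂ o i → preservedᵉ q p₁ p₂ o i (good p₂)) no-sinkᵉ
          dispatch₁ true = never-accepts inputs u v Invⁱ at-root (λ q p₁ p₂ o i → preservedᶦ q p₁ p₂ o i (λ _ → good p₂)) no-sinkⁱ

          dispatch₂ : ∀ c → ¬ Accepted (Child.children c) u v
          dispatch₂ c = never-accepts (Child.children c) u v (InvC c) Child.at-root
            (λ q p₁ p₂ o i → preservedᶜ c q p₁ p₂ o i (λ _ → good p₁) (λ _ → good p₂)) (no-sinkᶜ c)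

          dispatch : (∃ λ c → Accepted (all-errors c) u v) → ⊥
          dispatch (false , ac) = let c , ac′ = union-sound simple-errors u v ac in dispatch₁ c ac′
          dispatch (true  , ac) = let c , ac′ = union-sound Child.children u v ac in dispatch₂ c ac′

        module _ (p : ℕ) (good : ∀ q → q < p → Good q) where

          equality-complete : ¬ Good p → p ≡ 0 ⊎ ¬ note₁ (u p) ≡ note₂ (v p) → Accepted equality u v
          equality-complete bad why = detects equality u v sinkE refl refl (λ _ _ _ → refl) refl p InvE (refl , refl)
            (λ q p₁ p₂ o i le lt → preservedᵉ q p₁ p₂ o i (good p₂ (lt refl))) (λ _ _ _ _ → inj₁ refl)
            (λ q p₁ o i _ → hitsᵉ q p₁ p o bad why i)

          inputs-complete : ∀ i → lev (addr p) ≡ suc i → ¬ declared (note₂ (v p)) ≡ just (x i) → Accepted inputs u v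
          inputs-complete i el ne = detects inputs u v sinkI refl refl (λ _ _ _ → refl) refl p Invⁱ at-root
            (λ q p₁ p₂ o inv le lt → preservedᶦ q p₁ p₂ o inv (λ mv → good p₂ (lt mv))) (alternatesⁱ x)
            (λ q p₁ o inv mv → hitsⁱ x i o inv el _ _ mv (subst (λ w → ¬ declared (note₂ w) ≡ just (x i)) (sym (read-true _ p mv)) ne))

          children-complete : ∀ i → lev (addr p) ≡ suc i → declared (note₂ (v p)) ≡ just (x i) →
            ¬ note₂ (v p) ≡ letterAt x (addr p) → Accepted (Child.children (odd (index (entry (addr p))))) u v
          children-complete i el d ne = detects (Child.children b) u v sinkC refl refl (λ _ _ _ → refl) refl p (InvC b) Child.at-root
            (λ q p₁ p₂ o inv le lt → preservedᶜ b q p₁ p₂ o inv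
              (λ mv → good p₁ (≤-trans (lev-reflects-< (Child.lower-head b x inv mv)) le)) (λ mv → good p₂ (lt mv)))
            (Child.alternates b x)
            (λ q p₁ o inv mv → Child.hits b x i o inv el refl _ _ (reads₁ b _ p₁
                (λ mv₁ → proj₁ (good p₁ (lev-reflects-< (Child.lower-head b x inv mv₁))))) mv
              (subst (λ w → declared (note₂ w) ≡ just (x i)) (sym (read-true _ p mv)) d)
              (subst (λ w → ¬ note₂ w ≡ letterAt x (addr p)) (sym (read-true _ p mv)) ne))
            where b = odd (index (entry (addr p)))

        -- At the first error the copies differ, or the root is wrong, or the declared input is
        -- wrong, or the letter contradicts the parent although the input is right. Each case has
        -- its detector, which relies on everything before p being correct.
        errors-complete : ∀ p → (∀ q → q < p → Good q) → ¬ Good p → Accepted errors u v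
        errors-complete p good bad with note₁ (u p) ≟ˡ note₂ (v p)
        ... | no ne = union-complete all-errors u v false (union-complete simple-errors u v false (equality-complete p good bad (inj₂ ne)))
        errors-complete zero good bad | yes _ =
          union-complete all-errors u v false (union-complete simple-errors u v false (equality-complete 0 good bad (inj₁ refl)))
        errors-complete p@(suc p′) good bad | yes e with positive-level p′
        ... | i , el with declared (note₂ (v p)) ≟ᵐ just (x i)
        ... | no ne = union-complete all-errors u v false (union-complete simple-errors u v true (inputs-complete p good i el ne))
        ... | yes d = union-complete all-errors u v true (union-complete Child.children u v _
          (children-complete p good i el d (λ g → bad (trans e g , g))))

-- The automaton that follows a guessed branch through the tree.

module PathAutomaton where
  open FiniteTypes
  open Automata
  open Tree
  open ErrorDetection
  open import Data.Nat using (_≤′_; ≤′-refl; ≤′-step)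
  open import Data.Fin using (Fin; zero; suc)
  open import Data.Bool.Properties using (not-involutive)
  open import Data.List using (List; []; _∷_; length)

  -- This is 2^i - 1, the index of the last entry of level i.
  full : ℕ → ℕ
  full zero    = 0
  full (suc i) = suc (dbl (full i))

  Valid : Entry → Set
  Valid e = index e + left e ≡ full (level e)

  dbl-+ : ∀ m n → dbl m + dbl n ≡ dbl (m + n)
  dbl-+ zero    n = refl
  dbl-+ (suc m) n = cong (λ k → suc (suc k)) (dbl-+ m n)

  valid-nextE : ∀ e → Valid e → Valid (nextE e)
  valid-nextE ⟨ i , j , zero ⟩  v = cong (suc ∘ dbl) (trans (sym (+-identityʳ j)) v)
  valid-nextE ⟨ i , j , suc r ⟩ v = trans (sym (+-suc j r)) v

  valid-kid : ∀ b e → Valid e → Valid (kid b e)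
  valid-kid false ⟨ i , j , r ⟩ v = trans (+-suc (dbl j) (dbl r)) (cong suc (trans (dbl-+ j r) (cong dbl v)))
  valid-kid true  ⟨ i , j , r ⟩ v = cong suc (trans (dbl-+ j r) (cong dbl v))

  valid-mirror : ∀ e → Valid e → Valid (mirror e)
  valid-mirror ⟨ i , j , r ⟩ v = trans (+-comm r j) v

  mirror-kid : ∀ t e → mirror (kid t (mirror e)) ≡ kid (not t) e
  mirror-kid t ⟨ i , j , r ⟩ = cong (λ b → ⟨ suc i , dbl+ (not t) j , dbl+ b r ⟩) (sym (not-involutive t))

  -- True for an even number of choices: then head A is on tape 1 and the first component of the
  -- chosen entry carries the run.
  parity : List Bool → Bool
  parity []       = true
  parity (_ ∷ bs) = not (parity bs)

  module Path {X : Set} (finX : Finite X) (M : LocalMachine X) (flag : LocalMachine.Ctl M → Bool) where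
    open LocalMachine M
    open Letters finX (double M)
    open Errors finX (double M) using (advA; addr-advance; rootLetter)

    -- `skipP`: B runs to the end of its level. `entryP` and `pairP`: A passes one entry to the
    -- right of the chosen one, then B passes two. `rightP`: B passes a left child. `pickP` reads
    -- the first letter of the newly chosen entry, `restP` and `accP` go on to its end. The bit e
    -- says that no entry is left for A.
    pattern startP = inj₁ zero
    pattern accP   = inj₁ (suc zero)
    pattern skipP par e = inj₂ (par , inj₁ e)
    pattern pairP par e n = inj₂ (par , inj₂ (inj₁ (e , n)))
    pattern entryP par  = inj₂ (par , inj₂ (inj₂ zero))
    pattern chooseP par = inj₂ (par , inj₂ (inj₂ (suc zero)))
    pattern rightP par  = inj₂ (par , inj₂ (inj₂ (suc (suc zero))))
    pattern pickP par   = inj₂ (par , inj₂ (inj₂ (suc (suc (suc zero)))))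
    pattern restP par   = inj₂ (par , inj₂ (inj₂ (suc (suc (suc (suc zero))))))

    PState : Set
    PState = Fin 2 ⊎ (Bool × (Bool ⊎ ((Bool × Bool) ⊎ Fin 5)))

    -- In a state with par = true, tape 1 carries head A, which moves inside the level of the chosen
    -- entry, and tape 2 carries head B, which moves inside the next level; otherwise they are swapped.
    parOf : PState → Bool
    parOf startP = true
    parOf accP   = false
    parOf (inj₂ (par , _)) = par

    data Head : Set where
      A B : Head

    reads : PState → Maybe Head
    reads startP = just A
    reads accP   = just B
    reads (skipP _ _)   = just B
    reads (pairP _ _ _) = just B
    reads (entryP _)  = just A
    reads (chooseP _) = nothing
    reads (rightP _)  = just B
    reads (pickP _)   = just B
    reads (restP _)   = just B

    reads-nothing : ∀ q → reads q ≡ nothing → ∃ λ par → q ≡ chooseP par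
    reads-nothing startP ()
    reads-nothing accP ()
    reads-nothing (skipP _ _) ()
    reads-nothing (pairP _ _ _) ()
    reads-nothing (entryP _) ()
    reads-nothing (chooseP par) _ = par , refl
    reads-nothing (rightP _) ()
    reads-nothing (pickP _) ()
    reads-nothing (restP _) ()

    onTape₁ : Bool → Maybe Head → Bool
    onTape₁ par nothing  = false
    onTape₁ par (just A) = par
    onTape₁ par (just B) = not par

    onTape₂ : Bool → Maybe Head → Bool
    onTape₂ par nothing  = false
    onTape₂ par (just A) = not par
    onTape₂ par (just B) = par

    nx : PState → Letter → Bool → PState
    nx startP l o = skipP true true
    nx accP l o = if ends l then skipP true (isLast l) else restP false
    nx (skipP par e) l o = if endsLevel l then (if e then chooseP par else entryP par) else skipP par e
    nx (pairP par e n) l o =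
      if ends l then (if n then pairP par e false else if e then chooseP par else entryP par) else pairP par e n
    nx (entryP par) l o = if ends l then pairP par (isLast l) true else entryP par
    nx (chooseP par) l o = if o then rightP par else pickP par
    nx (rightP par) l o = if ends l then pickP par else rightP par
    -- `par` is the parity before the pick, so `not par` means that the new entry is at even depth,
    -- where the run is in the first component.
    nx (pickP par) l o = if not par ∧ flag (proj₁ (control l)) then accP else restP par
    nx (restP par) l o = if ends l then skipP (not par) (isLast l) else restP par

    isPick : PState → Bool
    isPick (pickP _) = true
    isPick _         = false

    IsChoose : PState → Set
    IsChoose (chooseP _) = ⊤
    IsChoose _           = ⊥

    module _ (x : ℕ → X) where

      runM : List Bool → Conf
      runM []       = init
      runM (b ∷ bs) = step b (x (length bs)) (runM bs)

      conf₁ conf₂ : Entry → Conf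
      conf₁ e = proj₁ (confAt x e)
      conf₂ e = proj₂ (confAt x e)

      -- The run is visible both at the chosen entry and, in the other component, at its mirror
      -- image; the latter is needed because the next choice is among the children of the mirror
      -- image.
      Sync : Bool → Conf → Entry → Set
      Sync true  K c = conf₁ c ≡ K × conf₂ (mirror c) ≡ K
      Sync false K c = conf₂ c ≡ K × conf₁ (mirror c) ≡ K

      -- The bit of β that a move to child t stands for. At even depth the run leaves through the
      -- second component, which complements choices.
      bitOf : Bool → Bool → Bool
      bitOf true  t = not t
      bitOf false t = t

      -- One equation follows the run from the mirror image of c to its child. The other holds since
      -- the mirror image of that child is the opposite child of c, where the other component makes
      -- the same step.
      sync-kid : ∀ par t K c → Sync par K c →
        Sync (not par) (step (bitOf par t) (x (level c)) K) (kid t (mirror c))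
      sync-kid true t K c (s₁ , s₂) =
        trans (cong proj₂ (conf-kid x t (mirror c))) (cong (step (not t) _) s₂) ,
        trans (cong conf₁ (mirror-kid t c)) (trans (cong proj₁ (conf-kid x (not t) c)) (cong (step (not t) _) s₁))
      sync-kid false t K c (s₁ , s₂) =
        trans (cong proj₁ (conf-kid x t (mirror c))) (cong (step t _) s₂) ,
        trans (cong conf₂ (mirror-kid t c)) (trans (cong proj₂ (conf-kid x (not t) c))
          (cong₂ (λ b K → step b (x (level c)) K) (not-involutive t) s₁))

      record Chosen (cs : List Bool) (c : Entry) : Set where
        field
          sync  : Sync (parity cs) (runM cs) c
          depth : level c ≡ length cs
          valid : Valid c

      chosen-root : Chosen [] root
      chosen-root = record { sync = refl , refl ; depth = refl ; valid = refl }

      chosen-kid : ∀ t {cs c} → Chosen cs c → Chosen (bitOf (parity cs) t ∷ cs) (kid t (mirror c))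
      chosen-kid t {cs} {c} ch = record
        { sync = subst (λ i → Sync (not (parity cs)) (step (bitOf (parity cs) t) (x i) (runM cs)) (kid t (mirror c)))
                   depth (sync-kid (parity cs) t (runM cs) c sync)
        ; depth = cong suc depth
        ; valid = valid-kid t (mirror c) (valid-mirror c valid) }
        where open Chosen ch

      Flagged : List Bool → Bool
      Flagged cs = parity cs ∧ flag (ctl (runM cs))

      -- W k t: the choice t is allowed at level k.
      module _ (W : ℕ → Bool → Set) where

        data Inv : PState → List Bool → Entry → Address → Address → Set where
          at-start  : Inv startP [] root (first root) (first root)
          at-skip   : ∀ {cs c e aB} → e ≡ isZero (left c) → lev aB ≡ level c → Valid (entry aB) →
            Inv (skipP (parity cs) e) cs c (first (nextE c)) aB
          -- Of the entries right of c, n have been counted and suc r₁ remain, the one under A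
          -- included. B stands at the children of entry n of the level of c, which becomes the
          -- mirror image of c when n reaches `left c`.
          at-entry  : ∀ {cs c} n jA r₁ {o s} → n + suc r₁ ≡ left c → jA + r₁ ≡ full (level c) →
            Inv (entryP (parity cs)) cs c (⟨ level c , jA , r₁ ⟩ at o ∣ s) (first (kid false ⟨ level c , n , suc (index c + r₁) ⟩))
          at-pair   : ∀ {cs c} n jA r₁ f {e o s} → n + suc r₁ ≡ left c → jA + r₁ ≡ full (level c) → e ≡ isZero r₁ →
            Inv (pairP (parity cs) e f) cs c (first (nextE ⟨ level c , jA , r₁ ⟩))
                (kid (not f) ⟨ level c , n , suc (index c + r₁) ⟩ at o ∣ s)
          at-choose : ∀ {cs c aA} → lev aA ≡ suc (level c) → Valid (entry aA) →
            Inv (chooseP (parity cs)) cs c aA (first (kid false (mirror c)))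
          at-right  : ∀ {cs c aA o s} → lev aA ≡ suc (level c) → Valid (entry aA) → W (length cs) true →
            Inv (rightP (parity cs)) cs c aA (kid false (mirror c) at o ∣ s)
          at-pick   : ∀ {cs c aA} t → lev aA ≡ suc (level c) → Valid (entry aA) → W (length cs) t →
            Inv (pickP (parity cs)) cs c aA (first (kid t (mirror c)))
          at-rest   : ∀ {cs c aA o s par} → lev aA ≡ level c → Valid (entry aA) → not par ≡ parity cs → 1 ≤ length cs →
            Inv (restP par) cs c aA (c at o ∣ s)
          at-acc    : ∀ {cs c aA o s} → lev aA ≡ level c → Valid (entry aA) → parity cs ≡ true → 1 ≤ length cs → Flagged cs ≡ true →
            Inv accP cs c aA (c at o ∣ s)

        -- A step may swap the roles of the tapes.
        After : PState → PState → List Bool → Entry → Address → Address → Set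
        After q q′ cs c aA aB =
          (parOf q′ ≡ parOf q × Inv q′ cs c aA aB) ⊎ (parOf q′ ≡ not (parOf q) × Inv q′ cs c aB aA)

        movesA movesB : Maybe Head → Bool
        movesA = onTape₁ true
        movesB = onTape₂ true

        record Next (q q′ : PState) (cs : List Bool) (c : Entry) (aA aB : Address) : Set where
          constructor next
          field
            {cs′}  : List Bool
            {c′}   : Entry
            chosen : Chosen cs′ c′
            after  : After q q′ cs′ c′ aA aB
            -- Choices are recorded at picks only, and a pick that makes the list flagged enters the
            -- accepting state at once; the latter is what completeness needs.
            grow   : (isPick q ≡ false × cs′ ≡ cs) ⊎
                     (isPick q ≡ true × (∃ λ t → W (length cs) t × cs′ ≡ bitOf (parity cs) t ∷ cs) ×
                       (Flagged cs′ ≡ true → q′ ≡ accP))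

        -- By validity the last entry of a level has index `full`, so B leaves the level onto the
        -- first child of its first entry, where the counting of pairs begins.
        unique-start : ∀ {jB m i} → jB + 0 ≡ full i → m ≡ full i →
          first (nextE ⟨ i , jB , 0 ⟩) ≡ first (kid false ⟨ i , 0 , m ⟩)
        unique-start {jB} {m} {i} v e = cong (λ k → first ⟨ suc i , 0 , suc (dbl k) ⟩) (trans (sym (+-identityʳ jB)) (trans v (sym e)))

        -- Heads are named by role here, not by tape. At the end of the chosen entry B is already
        -- where the next A must start, and A has reached the level on which the next B starts
        -- skipping; so the roles are exchanged.
        roleStep : ∀ {q cs c aA aB} → Chosen cs c → Inv q cs c aA aB → ∀ l o →
          (reads q ≡ just A → l ≡ letterAt x aA) → (reads q ≡ just B → l ≡ letterAt x aB) →
          (IsChoose q → W (length cs) o) →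
          Next q (nx q l o) cs c (advA (movesA (reads q)) aA) (advA (movesB (reads q)) aB)
        roleStep ch at-start l o rA rB w = next ch (inj₁ (refl , at-skip refl refl refl)) (inj₁ (refl , refl))
        roleStep ch (at-skip {cs} {c} {e} {⟨ i , jB , zero ⟩ at oB ∣ zero} el lv vB) l o rA rB w rewrite rB refl = done el lv vB
          where
          open Chosen ch
          done : e ≡ isZero (left c) → i ≡ level c → jB + 0 ≡ full i →
            Next (skipP (parity cs) e) (if e then chooseP (parity cs) else entryP (parity cs)) cs c
              (first (nextE c)) (first (nextE ⟨ i , jB , 0 ⟩))
          done refl refl vB = helper c refl
            where
            helper : ∀ c′ → c ≡ c′ →
              Next (skipP (parity cs) (isZero (left c))) (if isZero (left c′) then chooseP (parity cs) else entryP (parity cs)) cs c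
                (first (nextE c)) (first (nextE ⟨ level c , jB , 0 ⟩))
            helper ⟨ i , j , zero ⟩ refl = next ch (inj₁ (refl , subst (Inv _ cs c _)
              (sym (unique-start vB (trans (sym (+-identityʳ j)) valid))) (at-choose refl (valid-nextE c valid)))) (inj₁ (refl , refl))
            helper ⟨ i , j , suc r ⟩ refl = next ch (inj₁ (refl , subst (Inv _ cs c _)
              (sym (unique-start vB (trans (sym (+-suc j r)) valid))) (at-entry 0 (suc j) r refl (trans (sym (+-suc j r)) valid)))) (inj₁ (refl , refl))
        roleStep ch (at-skip {cs} {c} {e} {⟨ i , jB , suc r₀ ⟩ at oB ∣ zero} el lv vB) l o rA rB w rewrite rB refl =
          next ch (inj₁ (refl , at-skip el lv (trans (sym (+-suc jB r₀)) vB))) (inj₁ (refl , refl))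
        roleStep ch (at-skip {aB = eB at oB ∣ suc sB} el lv vB) l o rA rB w rewrite rB refl =
          next ch (inj₁ (refl , at-skip el lv vB)) (inj₁ (refl , refl))
        roleStep ch (at-entry n jA r₁ {o₁} {zero} en ej) l o rA rB w rewrite rA refl =
          next ch (inj₁ (refl , at-pair n jA r₁ true en ej refl)) (inj₁ (refl , refl))
        roleStep ch (at-entry n jA r₁ {o₁} {suc s} en ej) l o rA rB w rewrite rA refl =
          next ch (inj₁ (refl , at-entry n jA r₁ en ej)) (inj₁ (refl , refl))
        roleStep ch (at-pair n jA r₁ f {e} {o₁} {suc s} en ej er) l o rA rB w rewrite rB refl =
          next ch (inj₁ (refl , at-pair n jA r₁ f en ej er)) (inj₁ (refl , refl))
        roleStep ch (at-pair n jA r₁ true {e} {o₁} {zero} en ej er) l o rA rB w rewrite rB refl =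
          next ch (inj₁ (refl , at-pair n jA r₁ false en ej er)) (inj₁ (refl , refl))
        roleStep {cs = cs} {c = c} ch (at-pair n jA (suc r₂) false {e} {o₁} {zero} en ej refl) l o rA rB w rewrite rB refl =
          next ch (inj₁ (refl , subst (λ m → Inv (entryP (parity cs)) cs c (first (nextE ⟨ level c , jA , suc r₂ ⟩)) (first (kid false ⟨ level c , suc n , m ⟩))) (sym (+-suc (index c) r₂))
            (at-entry (suc n) (suc jA) r₂ (trans (sym (+-suc n (suc r₂))) en) (trans (sym (+-suc jA r₂)) ej)))) (inj₁ (refl , refl))
        roleStep {cs = cs} {c = c} ch (at-pair n jA zero false {e} {o₁} {zero} en ej refl) l o rA rB w rewrite rB refl =
          next ch (inj₁ (refl , subst₂ (λ r m → Inv (chooseP (parity cs)) cs c (first (nextE ⟨ level c , jA , 0 ⟩)) (first (kid false ⟨ level c , r , m ⟩)))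
            (trans (sym en) (+-comm n 1)) (sym (+-identityʳ (index c)))
            (at-choose refl (valid-nextE ⟨ level c , jA , 0 ⟩ ej)))) (inj₁ (refl , refl))
        roleStep ch (at-choose lv vA) l false rA rB w = next ch (inj₁ (refl , at-pick false lv vA (w tt))) (inj₁ (refl , refl))
        roleStep ch (at-choose lv vA) l true rA rB w = next ch (inj₁ (refl , at-right lv vA (w tt))) (inj₁ (refl , refl))
        roleStep ch (at-right {s = zero} lv vA wt) l o rA rB w rewrite rB refl =
          next ch (inj₁ (refl , at-pick true lv vA wt)) (inj₁ (refl , refl))
        roleStep ch (at-right {s = suc s} lv vA wt) l o rA rB w rewrite rB refl =
          next ch (inj₁ (refl , at-right lv vA wt)) (inj₁ (refl , refl))
        roleStep {cs = cs} {c = c} {aA = aA} ch (at-pick t lv vA wt) l o rA rB w rewrite rB refl =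
          helper (parity cs) refl
          where
          c′ = kid t (mirror c)
          cs′ = bitOf (parity cs) t ∷ cs
          ch′ : Chosen cs′ c′
          ch′ = chosen-kid t ch
          helper : ∀ par → parity cs ≡ par →
            Next (pickP (parity cs)) (if not par ∧ flag (proj₁ (control (letterAt x (first c′)))) then accP else restP par) cs c
              aA (nextA (first c′))
          helper true e = next ch′ (inj₁ (sym e , at-rest lv vA (cong not (sym e)) (s≤s z≤n))) (inj₂ (refl , (t , wt , refl) , notFlagged))
            where
            notFlagged : {A : Set} → Flagged cs′ ≡ true → A
            notFlagged f rewrite e = absurd f
          helper false e with flag (ctl (conf₁ c′)) in ef
          ... | false = next ch′ (inj₁ (sym e , at-rest lv vA (cong not (sym e)) (s≤s z≤n))) (inj₂ (refl , (t , wt , refl) , notFlagged))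
            where
            even : Sync true (runM cs′) c′
            even = subst (λ b → Sync b (runM cs′) c′) (cong not e) (Chosen.sync ch′)
            notFlagged : Flagged cs′ ≡ true → restP false ≡ accP
            notFlagged f rewrite cong not e = absurd (trans (trans (sym ef) (cong (flag ∘ ctl) (proj₁ even))) f)
          ... | true = next ch′ (inj₁ (sym e , at-acc lv vA (cong not e) (s≤s z≤n)
                (trans (cong (_∧ flag (ctl (runM cs′))) (cong not e)) (trans (cong (flag ∘ ctl) (sym (proj₁ even))) ef))))
                (inj₂ (refl , (t , wt , refl) , λ _ → refl))
            where
            even : Sync true (runM cs′) c′
            even = subst (λ b → Sync b (runM cs′) c′) (cong not e) (Chosen.sync ch′)
        roleStep {cs = cs} {c = c} {aA = aA} ch (at-rest {s = zero} {par = par} lv vA ep _) l o rA rB w rewrite rB refl =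
          next ch (inj₂ (refl , subst (λ b → Inv (skipP b (isZero (left c))) cs c (first (nextE c)) aA) (sym ep) (at-skip refl lv vA))) (inj₁ (refl , refl))
        roleStep ch (at-rest {s = suc s} lv vA ep pos) l o rA rB w rewrite rB refl =
          next ch (inj₁ (refl , at-rest lv vA ep pos)) (inj₁ (refl , refl))
        roleStep {cs = cs} {c = c} {aA = aA} ch (at-acc {s = zero} lv vA ep _ f) l o rA rB w rewrite rB refl =
          next ch (inj₂ (refl , subst (λ b → Inv (skipP b (isZero (left c))) cs c (first (nextE c)) aA) ep (at-skip refl lv vA))) (inj₁ (refl , refl))
        roleStep ch (at-acc {s = suc s} lv vA ep pos f) l o rA rB w rewrite rB refl =
          next ch (inj₁ (refl , at-rest lv vA (sym ep) pos)) (inj₁ (refl , refl))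

        -- This ties head positions to the number of choices: a head that is far along its tape
        -- means many choices, and many choices push both heads forward.
        levels : ∀ {q cs c aA aB} → Inv q cs c aA aB →
          (level c ≤ lev aA × lev aA ≤ suc (level c)) × (level c ≤ lev aB × lev aB ≤ suc (level c))
        levels at-start = (z≤n , z≤n) , (z≤n , z≤n)
        levels (at-skip {c = ⟨ i , j , zero ⟩} e lv v) = (n≤1+n _ , ≤-refl) , (≤-reflexive (sym lv) , m≤n⇒m≤1+n (≤-reflexive lv))
        levels (at-skip {c = ⟨ i , j , suc r ⟩} e lv v) = (≤-refl , n≤1+n _) , (≤-reflexive (sym lv) , m≤n⇒m≤1+n (≤-reflexive lv))
        levels (at-entry n jA r₁ e₁ e₂) = (≤-refl , n≤1+n _) , (n≤1+n _ , ≤-refl)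
        levels (at-pair n jA zero f e₁ e₂ e₃) = (n≤1+n _ , ≤-refl) , (n≤1+n _ , ≤-refl)
        levels (at-pair n jA (suc r₁) f e₁ e₂ e₃) = (≤-refl , n≤1+n _) , (n≤1+n _ , ≤-refl)
        levels (at-choose lv v) = (m<n⇒m≤n lv , ≤-reflexive lv) , (n≤1+n _ , ≤-refl)
          where m<n⇒m≤n : ∀ {m n} → n ≡ suc m → m ≤ n
                m<n⇒m≤n refl = n≤1+n _
        levels (at-right lv v w) = (≤-trans (n≤1+n _) (≤-reflexive (sym lv)) , ≤-reflexive lv) , (n≤1+n _ , ≤-refl)
        levels (at-pick t lv v w) = (≤-trans (n≤1+n _) (≤-reflexive (sym lv)) , ≤-reflexive lv) , (n≤1+n _ , ≤-refl)
        levels (at-rest lv v e p) = (≤-reflexive (sym lv) , m≤n⇒m≤1+n (≤-reflexive lv)) , (≤-refl , n≤1+n _)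
        levels (at-acc lv v e p f) = (≤-reflexive (sym lv) , m≤n⇒m≤1+n (≤-reflexive lv)) , (≤-refl , n≤1+n _)

    place : Bool → Address → Address → Address
    place true  aA aB = aA
    place false aA aB = aB

    place-not : ∀ par a b → place (not par) a b ≡ place par b a
    place-not true  a b = refl
    place-not false a b = refl

    place-move₁ : ∀ par h aA aB → advA (onTape₁ par h) (place par aA aB) ≡ place par (advA (onTape₁ true h) aA) (advA (onTape₂ true h) aB)
    place-move₁ true  nothing  aA aB = refl
    place-move₁ false nothing  aA aB = refl
    place-move₁ true  (just A) aA aB = refl
    place-move₁ true  (just B) aA aB = refl
    place-move₁ false (just A) aA aB = refl
    place-move₁ false (just B) aA aB = refl

    place-move₂ : ∀ par h aA aB → advA (onTape₂ par h) (place par aB aA) ≡ place par (advA (onTape₂ true h) aB) (advA (onTape₁ true h) aA)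
    place-move₂ true  nothing  aA aB = refl
    place-move₂ false nothing  aA aB = refl
    place-move₂ true  (just A) aA aB = refl
    place-move₂ true  (just B) aA aB = refl
    place-move₂ false (just A) aA aB = refl
    place-move₂ false (just B) aA aB = refl

    revs : (ℕ → Bool) → ℕ → List Bool
    revs β zero    = []
    revs β (suc t) = β t ∷ revs β t

    length-revs : ∀ β t → length (revs β t) ≡ t
    length-revs β zero    = refl
    length-revs β (suc t) = cong suc (length-revs β t)

    record RunState : Set where
      constructor runState
      field
        st      : PState
        at₁ at₂ : ℕ
        k       : ℕ

    -- The branch automaton on actual tapes: soundness and completeness.

    module Tapes {U V : Set} (note₁ : U → Letter) (note₂ : V → Letter) where

      look : ∀ par h → Opt (onTape₁ par h) U → Opt (onTape₂ par h) V → Letter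
      look par   nothing  _ _ = rootLetter
      look true  (just A) u _ = note₁ u
      look false (just A) _ v = note₂ v
      look true  (just B) _ v = note₂ v
      look false (just B) u _ = note₁ u

      path : Automaton U V
      path = record
        { State = PState
        ; finite = fin⊎ (finFin 2) (fin× finBool (fin⊎ finBool (fin⊎ (fin× finBool finBool) (finFin 5))))
        ; start = startP
        ; acc = λ { accP → true ; _ → false }
        ; move₁ = λ q → onTape₁ (parOf q) (reads q)
        ; move₂ = λ q → onTape₂ (parOf q) (reads q)
        ; δ = λ q u v o → nx q (look (parOf q) (reads q) u v) o }

      module _ (u : ℕ → U) (v : ℕ → V) (x : ℕ → X)
               (good₁ : ∀ p → note₁ (u p) ≡ letterAt x (addr p)) (good₂ : ∀ p → note₂ (v p) ≡ letterAt x (addr p)) where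
        open Automaton path using (move₁; move₂)
        open Runs path u v hiding (Accepted; Accepting)

        record Located (W : ℕ → Bool → Set) (q : PState) (p₁ p₂ : ℕ) (cs : List Bool) : Set where
          constructor located
          field
            {c}     : Entry
            {aA aB} : Address
            chosen  : Chosen x cs c
            inv     : Inv x W q cs c aA aB
            on₁     : addr p₁ ≡ place (parOf q) aA aB
            on₂     : addr p₂ ≡ place (parOf q) aB aA

        Grows : (W : ℕ → Bool → Set) → PState → PState → List Bool → List Bool → Set
        Grows W q q′ cs cs′ = (isPick q ≡ false × cs′ ≡ cs) ⊎
          (isPick q ≡ true × (∃ λ t → W (length cs) t × cs′ ≡ bitOf x (parity cs) t ∷ cs) × (Flagged x cs′ ≡ true → q′ ≡ accP))

        tapeStep : ∀ {W q p₁ p₂ cs} o → Located W q p₁ p₂ cs → (IsChoose q → W (length cs) o) →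
          ∃ λ cs′ → Located W (succ-state q p₁ p₂ o) (advance (move₁ q) p₁) (advance (move₂ q) p₂) cs′ ×
                    Grows W q (succ-state q p₁ p₂ o) cs cs′
        tapeStep {W} {q} {p₁} {p₂} {cs} o (located {c} {aA} {aB} ch i e₁ e₂) w =
          cs′ , relocate after , grow
          where
          h = reads q
          par = parOf q
          l = look par h (readAt (move₁ q) u p₁) (readAt (move₂ q) v p₂)
          seen : ∀ par h → addr p₁ ≡ place par aA aB → addr p₂ ≡ place par aB aA →
            let l = look par h (readAt (onTape₁ par h) u p₁) (readAt (onTape₂ par h) v p₂) in
            (h ≡ just A → l ≡ letterAt x aA) × (h ≡ just B → l ≡ letterAt x aB)
          seen par   nothing  e₁ e₂ = (λ ()) , (λ ())
          seen true  (just A) e₁ e₂ = (λ _ → trans (good₁ p₁) (cong (letterAt x) e₁)) , (λ ())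
          seen false (just A) e₁ e₂ = (λ _ → trans (good₂ p₂) (cong (letterAt x) e₂)) , (λ ())
          seen true  (just B) e₁ e₂ = (λ ()) , (λ _ → trans (good₂ p₂) (cong (letterAt x) e₂))
          seen false (just B) e₁ e₂ = (λ ()) , (λ _ → trans (good₁ p₁) (cong (letterAt x) e₁))
          open Next (roleStep x W ch i l o (proj₁ (seen par h e₁ e₂)) (proj₂ (seen par h e₁ e₂)) w)
          aA′ = advA (onTape₁ true h) aA
          aB′ = advA (onTape₂ true h) aB
          on₁′ : addr (advance (move₁ q) p₁) ≡ place par aA′ aB′
          on₁′ = trans (addr-advance (move₁ q) p₁) (trans (cong (advA (move₁ q)) e₁) (place-move₁ par h aA aB))
          on₂′ : addr (advance (move₂ q) p₂) ≡ place par aB′ aA′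
          on₂′ = trans (addr-advance (move₂ q) p₂) (trans (cong (advA (move₂ q)) e₂) (place-move₂ par h aA aB))
          relocate : After x W q (nx q l o) cs′ c′ aA′ aB′ →
            Located W (nx q l o) (advance (move₁ q) p₁) (advance (move₂ q) p₂) cs′
          relocate (inj₁ (ep , i′)) = located chosen i′
            (trans on₁′ (cong (λ b → place b aA′ aB′) (sym ep))) (trans on₂′ (cong (λ b → place b aB′ aA′) (sym ep)))
          relocate (inj₂ (ep , i′)) = located chosen i′
            (trans on₁′ (trans (sym (place-not par aB′ aA′)) (cong (λ b → place b aB′ aA′) (sym ep))))
            (trans on₂′ (trans (sym (place-not par aA′ aB′)) (cong (λ b → place b aA′ aB′) (sym ep))))

        private
          bounds : ∀ {W q p₁ p₂ cs} → Located W q p₁ p₂ cs →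
            (length cs ≤ lev (addr p₁) × lev (addr p₁) ≤ suc (length cs)) × (length cs ≤ lev (addr p₂) × lev (addr p₂) ≤ suc (length cs))
          bounds {W} {q} {p₁} {p₂} {cs} (located {c} {aA} {aB} ch i e₁ e₂) rewrite e₁ | e₂ | sym (Chosen.depth ch) = go (parOf q) (levels x W i)
            where
            go : ∀ par → (level c ≤ lev aA × lev aA ≤ suc (level c)) × (level c ≤ lev aB × lev aB ≤ suc (level c)) →
              (level c ≤ lev (place par aA aB) × lev (place par aA aB) ≤ suc (level c)) ×
              (level c ≤ lev (place par aB aA) × lev (place par aB aA) ≤ suc (level c))
            go true  (a , b) = a , b
            go false (a , b) = b , a

          deep : ∀ N {W q p₁ p₂ cs} → Located W q p₁ p₂ cs → proj₁ (lev-unbounded (suc N)) ≤ p₁ ⊎ proj₁ (lev-unbounded (suc N)) ≤ p₂ → N ≤ length cs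
          deep N loc (inj₁ le) = ≤-pred (≤-trans (≤-trans (≤-reflexive (sym (proj₂ (lev-unbounded (suc N))))) (lev-mono le)) (proj₂ (proj₁ (bounds loc))))
          deep N loc (inj₂ le) = ≤-pred (≤-trans (≤-trans (≤-reflexive (sym (proj₂ (lev-unbounded (suc N))))) (lev-mono le)) (proj₂ (proj₂ (bounds loc))))

          only-acc : ∀ q → Automaton.acc path q ≡ true → q ≡ accP
          only-acc accP _ = refl

        module _ (β : ℕ → Bool) where
          -- For fixed parity `bitOf` is an involution, so it also turns the desired bit of β into
          -- the child to be chosen.
          want : ℕ → Bool
          want k = bitOf x (parity (revs β k)) (β k)

        -- Here all choices are allowed. The lists of choices extend one another, and the unbounded
        -- progress of head 1 makes them arbitrarily long, so they converge to a branch β.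
        path-sound : Accepted path u v → ∃ λ β → ∀ N → ∃ λ t → N ≤ t × Flagged x (revs β t) ≡ true
        path-sound (o , a) = β , λ N → flagged N (recurs (proj₁ (level-reached N)))
          where
          open Runs.Accepting a
          W : ℕ → Bool → Set
          W _ _ = ⊤
          ghost : ∀ n → ∃ λ cs → Located W (stateAt o n) (pos₁ o n) (pos₂ o n) cs
          ghost zero    = [] , located (chosen-root x) at-start refl refl
          ghost (suc n) = let cs , loc , _ = tapeStep (o n) (proj₂ (ghost n)) (λ _ → tt) in cs , loc
          choices : ℕ → List Bool
          choices n = proj₁ (ghost n)

          get : List Bool → ℕ → Bool
          get []       i = false
          get (b ∷ bs) i with i ≟ length bs
          ... | yes _ = b
          ... | no  _ = get bs i

          get-cons : ∀ b bs i → i < length bs → get (b ∷ bs) i ≡ get bs i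
          get-cons b bs i lt with i ≟ length bs
          ... | yes e = ⊥-elim (<-irrefl e lt)
          ... | no _ = refl

          get-top : ∀ b bs → get (b ∷ bs) (length bs) ≡ b
          get-top b bs with length bs ≟ length bs
          ... | yes _ = refl
          ... | no ne = ⊥-elim (ne refl)

          Extends : List Bool → List Bool → Set
          Extends cs ds = length cs ≤ length ds × (∀ i → i < length cs → get ds i ≡ get cs i)

          extends-suc : ∀ n → Extends (choices n) (choices (suc n))
          extends-suc n = grown (choices n) (choices (suc n)) (proj₂ (proj₂ (tapeStep (o n) (proj₂ (ghost n)) (λ _ → tt))))
            where
            grown : ∀ {q q′} cs ds → Grows W q q′ cs ds → Extends cs ds
            grown cs _ (inj₁ (_ , refl)) = ≤-refl , λ _ _ → refl
            grown cs _ (inj₂ (_ , (t , _ , refl) , _)) = n≤1+n _ , get-cons _ cs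

          extends : ∀ {n m} → n ≤ m → Extends (choices n) (choices m)
          extends le = go (≤⇒≤′ le)
            where
            go : ∀ {n m} → n ≤′ m → Extends (choices n) (choices m)
            go ≤′-refl = ≤-refl , λ _ _ → refl
            go {m = suc m} (≤′-step le) = let l , g = go le ; l′ , g′ = extends-suc m in
              ≤-trans l l′ , λ i lt → trans (g′ i (≤-trans lt l)) (g i lt)

          level-reached : ∀ N → ∃ λ n → N ≤ length (choices n)
          level-reached N = let n , lt = unbounded₁ (proj₁ (lev-unbounded (suc N))) in
            n , deep N (proj₂ (ghost n)) (inj₁ (<⇒≤ lt))

          β : ℕ → Bool
          β i = get (choices (proj₁ (level-reached (suc i)))) i

          β-get : ∀ n i → i < length (choices n) → β i ≡ get (choices n) i
          β-get n i lt with ≤-total (proj₁ (level-reached (suc i))) n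
          ... | inj₁ le = sym (proj₂ (extends le) i (proj₂ (level-reached (suc i))))
          ... | inj₂ le = proj₂ (extends le) i lt

          revs-get : ∀ cs → (∀ i → i < length cs → β i ≡ get cs i) → revs β (length cs) ≡ cs
          revs-get [] e = refl
          revs-get (b ∷ bs) e = cong₂ _∷_ (trans (e (length bs) ≤-refl) (get-top b bs))
            (revs-get bs (λ i lt → trans (e i (m≤n⇒m≤1+n lt)) (get-cons b bs i lt)))

          at-accepting : ∀ {q p₁ p₂ cs} → Located W q p₁ p₂ cs → q ≡ accP → Flagged x cs ≡ true
          at-accepting (located ch (at-acc _ _ _ _ f) _ _) refl = f

          flagged : ∀ N → (∃ λ n → proj₁ (level-reached N) ≤ n × stateAt o n ≡ accState) → ∃ λ t → N ≤ t × Flagged x (revs β t) ≡ true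
          flagged N (n , le , e) = length (choices n) , ≤-trans (proj₂ (level-reached N)) (proj₁ (extends le)) ,
            trans (cong (Flagged x) (revs-get (choices n) (β-get n))) (at-accepting (proj₂ (ghost n)) (trans e (only-acc accState isAcc)))

        -- The oracle bit for time n depends on the number of choices made so far, hence on earlier
        -- oracle bits. To break the circle the run and the counter k are defined together as `S`,
        -- and `same` identifies the result with the run under the oracle o.
        path-complete : ∀ β → (∀ N → ∃ λ t → N ≤ t × Flagged x (revs β t) ≡ true) → Accepted path u v
        path-complete β inf = o , record
          { unbounded₁ = λ N → let n , le = reached (suc N) in n , ≤-trans le (≤-trans (subst (_≤ lev (addr (pos₁ o n))) (lenk n) (proj₁ (proj₁ (bounds (loc n))))) (lev≤ (pos₁ o n)))
          ; unbounded₂ = λ N → let n , le = reached (suc N) in n , ≤-trans le (≤-trans (subst (_≤ lev (addr (pos₂ o n))) (lenk n) (proj₁ (proj₂ (bounds (loc n))))) (lev≤ (pos₂ o n)))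
          ; accState = accP ; isAcc = refl
          ; recurs = again }
          where
          W : ℕ → Bool → Set
          W k t = t ≡ want β k

          open RunState
          advanceS : RunState → RunState
          advanceS (runState q p₁ p₂ k) = runState (succ-state q p₁ p₂ (want β k)) (advance (move₁ q) p₁) (advance (move₂ q) p₂)
            (if isPick q then suc k else k)
          S : ℕ → RunState
          S zero    = runState startP 0 0 0
          S (suc n) = advanceS (S n)
          o : ℕ → Bool
          o n = want β (k (S n))

          same : ∀ n → stateAt o n ≡ st (S n) × pos₁ o n ≡ at₁ (S n) × pos₂ o n ≡ at₂ (S n)
          same zero = refl , refl , refl
          same (suc n) = let e₀ , e₁ , e₂ = same n in
            step₃ e₀ e₁ e₂ , cong₂ (λ q p → advance (move₁ q) p) e₀ e₁ , cong₂ (λ q p → advance (move₂ q) p) e₀ e₂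
            where
            step₃ : stateAt o n ≡ st (S n) → pos₁ o n ≡ at₁ (S n) → pos₂ o n ≡ at₂ (S n) → stateAt o (suc n) ≡ st (S (suc n))
            step₃ e₀ e₁ e₂ rewrite e₀ | e₁ | e₂ = refl

          bitOf-bitOf : ∀ par b → bitOf x par (bitOf x par b) ≡ b
          bitOf-bitOf true  b = not-involutive b
          bitOf-bitOf false b = refl

          grows : ∀ q q′ k cs → Grows W q q′ (revs β k) cs → cs ≡ revs β (if isPick q then suc k else k)
          grows q q′ k cs (inj₁ (e , refl)) rewrite e = refl
          grows q q′ k cs (inj₂ (e , (t , refl , refl) , _)) rewrite e | length-revs β k =
            cong (_∷ revs β k) (bitOf-bitOf (parity (revs β k)) (β k))

          allowed : ∀ n → W (length (revs β (k (S n)))) (want β (k (S n)))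
          allowed n = cong (want β) (sym (length-revs β (k (S n))))

          locS : ∀ n → Located W (st (S n)) (at₁ (S n)) (at₂ (S n)) (revs β (k (S n)))
          locS zero    = located (chosen-root x) at-start refl refl
          locS (suc n) = let cs , l , g = tapeStep (want β (k (S n))) (locS n) (λ _ → allowed n) in
            subst (Located W (st (S (suc n))) (at₁ (S (suc n))) (at₂ (S (suc n)))) (grows (st (S n)) (st (S (suc n))) (k (S n)) cs g) l

          loc : ∀ n → Located W (stateAt o n) (pos₁ o n) (pos₂ o n) (revs β (k (S n)))
          loc n with stateAt o n | pos₁ o n | pos₂ o n | same n
          ... | _ | _ | _ | refl , refl , refl = locS n

          lenk : ∀ n → length (revs β (k (S n))) ≡ k (S n)
          lenk n = length-revs β (k (S n))

          entered : ∀ n → isPick (st (S n)) ≡ true → Flagged x (revs β (suc (k (S n)))) ≡ true → st (S (suc n)) ≡ accP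
          entered n pk f with tapeStep (want β (k (S n))) (locS n) (λ _ → allowed n)
          ... | cs , l , inj₁ (np , _) = absurd (trans (sym np) pk)
          ... | cs , l , g@(inj₂ (_ , _ , fl)) = fl (trans (cong (Flagged x) (trans (grows _ (st (S (suc n))) _ cs g) (cong (λ b → revs β (if b then suc (k (S n)) else k (S n))) pk))) f)

          total : ℕ → ℕ
          total n = pos₁ o n + pos₂ o n

          moves : ∀ par h p₁ p₂ → ¬ h ≡ nothing → suc (p₁ + p₂) ≤ advance (onTape₁ par h) p₁ + advance (onTape₂ par h) p₂
          moves par   nothing  p₁ p₂ ne = ⊥-elim (ne refl)
          moves true  (just A) p₁ p₂ _ = ≤-refl
          moves false (just A) p₁ p₂ _ = ≤-reflexive (sym (+-suc p₁ p₂))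
          moves true  (just B) p₁ p₂ _ = ≤-reflexive (sym (+-suc p₁ p₂))
          moves false (just B) p₁ p₂ _ = ≤-refl

          -- Only `chooseP` moves no head, and both of its successors move one.
          grows-total : ∀ n → ∃ λ m → suc (total n) ≤ total m
          grows-total n with reads (stateAt o n) in e
          ... | just h = suc n , moves (parOf (stateAt o n)) (reads (stateAt o n)) (pos₁ o n) (pos₂ o n) (λ z → case (trans (sym e) z))
            where case : ∀ {h : Head} → ¬ just h ≡ nothing
                  case ()
          ... | nothing = suc (suc n) , ≤-trans (s≤s (stay (stateAt o n) e)) (moves (parOf (stateAt o (suc n))) (reads (stateAt o (suc n))) (pos₁ o (suc n)) (pos₂ o (suc n)) (after-choose (stateAt o n) _ _ e))
            where
            after-choose : ∀ q l t → reads q ≡ nothing → ¬ reads (nx q l t) ≡ nothing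
            after-choose q l t e with reads-nothing q e
            after-choose q l true  e | par , refl = λ ()
            after-choose q l false e | par , refl = λ ()
            stay : ∀ q → reads q ≡ nothing → total n ≤ advance (move₁ q) (pos₁ o n) + advance (move₂ q) (pos₂ o n)
            stay q e with reads-nothing q e
            ... | par , refl = ≤-refl

          total-unbounded : ∀ N → ∃ λ n → N ≤ total n
          total-unbounded zero    = 0 , z≤n
          total-unbounded (suc N) = let n , le = total-unbounded N ; m , le′ = grows-total n in m , ≤-trans (s≤s le) le′

          one-of : ∀ P a b → P + P ≤ a + b → P ≤ a ⊎ P ≤ b
          one-of P a b le with ≤-total P a
          ... | inj₁ h = inj₁ h
          ... | inj₂ h with ≤-total P b
          ... | inj₁ h′ = inj₂ h′
          ... | inj₂ h′ = inj₁ (+-cancelʳ-≤ P P a (≤-trans le (+-monoʳ-≤ a h′)))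

          -- The heads together move without bound, so one of them gets beyond the beginning of
          -- level N + 1; by `levels` at least N choices have been made then.
          reached : ∀ N → ∃ λ n → N ≤ k (S n)
          reached N = let P = proj₁ (lev-unbounded (suc N)) ; n , le = total-unbounded (P + P) in
            n , subst (N ≤_) (lenk n) (deep N (loc n) (one-of P _ _ le))

          k≤ : ∀ n → k (S n) ≤ n
          k≤ zero = z≤n
          k≤ (suc n) with isPick (st (S n))
          ... | true  = s≤s (k≤ n)
          ... | false = m≤n⇒m≤1+n (k≤ n)

          -- The counter rises by one at a time, so it takes each positive value t, and does so at a
          -- pick.
          crossing : ∀ t n → 0 < t → t ≤ k (S n) → ∃ λ m → isPick (st (S m)) ≡ true × suc (k (S m)) ≡ t
          crossing t zero lt le = ⊥-elim (<⇒≱ lt le)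
          crossing t (suc n) lt le with ≤-total t (k (S n))
          ... | inj₁ le′ = crossing t n lt le′
          ... | inj₂ ge with isPick (st (S n)) in pk
          ...   | false = crossing t n lt le
          ...   | true with m≤n⇒m<n∨m≡n le
          ...     | inj₁ (s≤s lt′) = crossing t n lt lt′
          ...     | inj₂ e = n , pk , sym e

          again : ∀ N → ∃ λ n → N ≤ n × stateAt o n ≡ accP
          again N = let t , le , f = inf (suc N) ; n , le′ = reached t ; m , pk , e = crossing t n (≤-trans (s≤s z≤n) le) le′ in
            suc m , ≤-trans (<⇒≤ le) (≤-trans (≤-reflexive (sym e)) (s≤s (k≤ m))) ,
            trans (proj₁ (same (suc m))) (entered m pk (subst (λ t → Flagged x (revs β t) ≡ true) (sym e) f))

-- While programs on stacks and their execution by a local machine.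

module Machine where
  open FiniteTypes
  open Tree using (LocalMachine)
  open import Data.Nat using (_⊔_; _≟_)
  open import Data.Fin using (Fin; zero; suc; inject₁)
  open import Data.Maybe using (fromMaybe)
  open import Data.Vec using (Vec; []; _∷_)
  open import Data.List using (List; []; _∷_; head)

  data Op : Set where
    keep push pop clear lower : Op

  data Src : Set where
    reg     : ℕ → Src
    history : Src

  data Test : Set where
    nonempty positive always : Test

  data Cmd : Set where
    _≔_∙_ : ℕ → Op → Src → Cmd
    _⨾_   : Cmd → Cmd → Cmd
    while : Test → ℕ → Cmd → Cmd
    cond  : Test → ℕ → Cmd → Cmd → Cmd
    mark  : Cmd

  infix  4 _≔_∙_
  infixr 3 _⨾_

  -- Program points by recursion on syntax, which makes their finiteness and the embedding of
  -- subprograms immediate. `nothing` is the point where a test is made.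
  Pos : Cmd → Set
  Pos (_ ≔ _ ∙ _)    = ⊤
  Pos (a ⨾ b)        = Pos a ⊎ Pos b
  Pos (while _ _ a)  = Maybe (Pos a)
  Pos (cond _ _ a b) = Maybe (Pos a ⊎ Pos b)
  Pos mark           = ⊤

  finPos : ∀ p → Finite (Pos p)
  finPos (_ ≔ _ ∙ _)    = fin⊤
  finPos (a ⨾ b)        = fin⊎ (finPos a) (finPos b)
  finPos (while _ _ a)  = finMaybe (finPos a)
  finPos (cond _ _ a b) = finMaybe (fin⊎ (finPos a) (finPos b))
  finPos mark           = fin⊤

  entry : ∀ p → Pos p
  entry (_ ≔ _ ∙ _)    = tt
  entry (a ⨾ b)        = inj₁ (entry a)
  entry (while _ _ a)  = nothing
  entry (cond _ _ a b) = nothing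
  entry mark           = tt

  -- Registers hold stacks of items; a number is represented by the height of a stack.
  module Stacks (J : ℕ) where

    Item Sym : Set
    Item = Fin (suc J)
    Sym  = Maybe Item

    test : Test → Sym → Bool
    test nonempty (just _)       = true
    test positive (just (suc _)) = true
    test always   _              = true
    test _        _              = false

    -- The result `nothing` says that control leaves the command; the enclosing command decides
    -- where it goes.
    nextPos : ∀ p → Pos p → (ℕ → Sym) → Maybe (Pos p)
    nextPos (_ ≔ _ ∙ _) _ tops = nothing
    nextPos (a ⨾ b) (inj₁ x) tops = just (maybe′ inj₁ (inj₂ (entry b)) (nextPos a x tops))
    nextPos (a ⨾ b) (inj₂ y) tops = maybe′ (just ∘ inj₂) nothing (nextPos b y tops)
    nextPos (while t r a) nothing tops = if test t (tops r) then just (just (entry a)) else nothing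
    nextPos (while t r a) (just x) tops = just (nextPos a x tops)
    nextPos (cond t r a b) nothing tops = just (just (if test t (tops r) then inj₁ (entry a) else inj₂ (entry b)))
    nextPos (cond t r a b) (just (inj₁ x)) tops = maybe′ (just ∘ just ∘ inj₁) nothing (nextPos a x tops)
    nextPos (cond t r a b) (just (inj₂ y)) tops = maybe′ (just ∘ just ∘ inj₂) nothing (nextPos b y tops)
    nextPos mark _ tops = nothing

    Assignment : Set
    Assignment = ℕ × Op × Src

    instr : ∀ p → Pos p → Maybe Assignment
    instr (d ≔ op ∙ s) _ = just (d , op , s)
    instr (a ⨾ b) (inj₁ x) = instr a x
    instr (a ⨾ b) (inj₂ y) = instr b y
    instr (while _ _ a) nothing  = nothing
    instr (while _ _ a) (just x) = instr a x
    instr (cond _ _ a b) nothing = nothing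
    instr (cond _ _ a b) (just (inj₁ x)) = instr a x
    instr (cond _ _ a b) (just (inj₂ y)) = instr b y
    instr mark _ = nothing

    marked : ∀ p → Pos p → Bool
    marked (_ ≔ _ ∙ _) _ = false
    marked (a ⨾ b) (inj₁ x) = marked a x
    marked (a ⨾ b) (inj₂ y) = marked b y
    marked (while _ _ a) nothing  = false
    marked (while _ _ a) (just x) = marked a x
    marked (cond _ _ a b) nothing = false
    marked (cond _ _ a b) (just (inj₁ x)) = marked a x
    marked (cond _ _ a b) (just (inj₂ y)) = marked b y
    marked mark _ = true

    Store : Set
    Store = ℕ → List Item

    decrease : Item → Item
    decrease zero    = zero
    decrease (suc a) = inject₁ a

    apply : Op → List Item → List Item
    apply keep  l       = l
    apply push  l       = zero ∷ l
    apply pop   []      = []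
    apply pop   (_ ∷ l) = l
    apply clear l       = []
    apply lower []      = []
    apply lower (a ∷ l) = decrease a ∷ l

    _[_↦_] : Store → ℕ → List Item → Store
    (ρ [ d ↦ l ]) r with r ≟ d
    ... | yes _ = l
    ... | no _  = ρ r

    source : Src → Store → List Item → List Item
    source (reg s)  ρ h = ρ s
    source history  ρ h = h

    assign : Maybe Assignment → Store → List Item → Store
    assign nothing             ρ h = ρ
    assign (just (d , op , s)) ρ h = ρ [ d ↦ apply op (source s ρ h) ]

    tops : Store → ℕ → Sym
    tops ρ r = head (ρ r)

    -- There is no rule for `mark` or for copying `history`, so whatever is executed passes no mark
    -- and has an effect independent of time. These two commands are followed by hand in the search
    -- program.
    data Exec : Cmd → Store → Store → Set where
      e-assign : ∀ {d op s ρ} → Exec (d ≔ op ∙ reg s) ρ (ρ [ d ↦ apply op (ρ s) ])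
      e-seq    : ∀ {a b ρ ρ₁ ρ₂} → Exec a ρ ρ₁ → Exec b ρ₁ ρ₂ → Exec (a ⨾ b) ρ ρ₂
      e-done   : ∀ {t r a ρ} → test t (tops ρ r) ≡ false → Exec (while t r a) ρ ρ
      e-loop   : ∀ {t r a ρ ρ₁ ρ₂} → test t (tops ρ r) ≡ true → Exec a ρ ρ₁ → Exec (while t r a) ρ₁ ρ₂ →
                 Exec (while t r a) ρ ρ₂
      e-then   : ∀ {t r a b ρ ρ₁} → test t (tops ρ r) ≡ true → Exec a ρ ρ₁ → Exec (cond t r a b) ρ ρ₁
      e-else   : ∀ {t r a b ρ ρ₁} → test t (tops ρ r) ≡ false → Exec b ρ ρ₁ → Exec (cond t r a b) ρ ρ₁

    module Program (P : Cmd) where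

      goto : Pos P → (ℕ → Sym) → Pos P
      goto c ts = fromMaybe (entry P) (nextPos P c ts)

      -- A copy of the command p inside P, continuing at `exit`.
      record Part (p : Cmd) : Set where
        field
          at     : Pos p → Pos P
          exit   : Pos P
          goes   : ∀ x ts → goto (at x) ts ≡ maybe′ at exit (nextPos p x ts)
          does   : ∀ x → instr P (at x) ≡ instr p x
          marks  : ∀ x → marked P (at x) ≡ marked p x
      open Part public

      part-fst : ∀ {a b} → Part (a ⨾ b) → Part a
      part-fst {a} {b} e = record
        { at = at e ∘ inj₁ ; exit = at e (inj₂ (entry b))
        ; goes = λ x ts → trans (goes e (inj₁ x) ts) (lemma (nextPos a x ts))
        ; does = does e ∘ inj₁ ; marks = marks e ∘ inj₁ }
        where
        lemma : ∀ m → at e (maybe′ inj₁ (inj₂ (entry b)) m) ≡ maybe′ (at e ∘ inj₁) (at e (inj₂ (entry b))) m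
        lemma nothing  = refl
        lemma (just _) = refl

      part-snd : ∀ {a b} → Part (a ⨾ b) → Part b
      part-snd {a} {b} e = record
        { at = at e ∘ inj₂ ; exit = exit e
        ; goes = λ x ts → trans (goes e (inj₂ x) ts) (lemma (nextPos b x ts))
        ; does = does e ∘ inj₂ ; marks = marks e ∘ inj₂ }
        where
        lemma : ∀ m → maybe′ (at e) (exit e) (maybe′ (just ∘ inj₂) nothing m) ≡ maybe′ (at e ∘ inj₂) (exit e) m
        lemma nothing  = refl
        lemma (just _) = refl

      part-body : ∀ {t r a} → Part (while t r a) → Part a
      part-body {a = a} e = record
        { at = at e ∘ just ; exit = at e nothing
        ; goes = λ x ts → trans (goes e (just x) ts) (lemma (nextPos a x ts))
        ; does = does e ∘ just ; marks = marks e ∘ just }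
        where
        lemma : ∀ m → at e m ≡ maybe′ (at e ∘ just) (at e nothing) m
        lemma nothing  = refl
        lemma (just _) = refl

      part-then : ∀ {t r a b} → Part (cond t r a b) → Part a
      part-then {a = a} e = record
        { at = at e ∘ just ∘ inj₁ ; exit = exit e
        ; goes = λ x ts → trans (goes e (just (inj₁ x)) ts) (lemma (nextPos a x ts))
        ; does = does e ∘ just ∘ inj₁ ; marks = marks e ∘ just ∘ inj₁ }
        where
        lemma : ∀ m → maybe′ (at e) (exit e) (maybe′ (just ∘ just ∘ inj₁) nothing m) ≡ maybe′ (at e ∘ just ∘ inj₁) (exit e) m
        lemma nothing  = refl
        lemma (just _) = refl

      part-else : ∀ {t r a b} → Part (cond t r a b) → Part b
      part-else {b = b} e = record
        { at = at e ∘ just ∘ inj₂ ; exit = exit e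
        ; goes = λ x ts → trans (goes e (just (inj₂ x)) ts) (lemma (nextPos b x ts))
        ; does = does e ∘ just ∘ inj₂ ; marks = marks e ∘ just ∘ inj₂ }
        where
        lemma : ∀ m → maybe′ (at e) (exit e) (maybe′ (just ∘ just ∘ inj₂) nothing m) ≡ maybe′ (at e ∘ just ∘ inj₂) (exit e) m
        lemma nothing  = refl
        lemma (just _) = refl

      part-whole : Part P
      part-whole = record
        { at = λ x → x ; exit = entry P ; goes = λ x ts → lemma (nextPos P x ts) ; does = λ _ → refl ; marks = λ _ → refl }
        where
        lemma : ∀ m → fromMaybe (entry P) m ≡ maybe′ (λ x → x) (entry P) m
        lemma nothing  = refl
        lemma (just _) = refl

      module Run (y : ℕ → Item) where

        hist : ℕ → List Item
        hist zero    = []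
        hist (suc t) = y t ∷ hist t

        mutual
          posAt : ℕ → Pos P
          posAt zero    = entry P
          posAt (suc t) = goto (posAt t) (tops (storeAt t))

          storeAt : ℕ → Store
          storeAt zero    = λ _ → []
          storeAt (suc t) = assign (instr P (posAt t)) (storeAt t) (hist t)

        markedAt : ℕ → Bool
        markedAt t = marked P (posAt t)

        record At (t : ℕ) (c : Pos P) (ρ : Store) : Set where
          constructor at-state
          field
            here  : posAt t ≡ c
            store : storeAt t ≡ ρ

        Unmarked : ℕ → ℕ → Set
        Unmarked t t′ = ∀ u → t ≤ u → u < t′ → markedAt u ≡ false

        record Reach (t : ℕ) (c : Pos P) (ρ : Store) : Set where
          constructor reach
          field
            {end}    : ℕ
            later    : t < end
            arrives  : At end c ρ
            unmarked : Unmarked t end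

        unmarked-trans : ∀ {t t′ t″} → Unmarked t t′ → Unmarked t′ t″ → Unmarked t t″
        unmarked-trans {t′ = t′} m₁ m₂ u le lt with <-≤-connex u t′
        ... | inj₁ lt′ = m₁ u le lt′
        ... | inj₂ ge  = m₂ u ge lt

        then-reach : ∀ {t c ρ c′ ρ′} → Reach t c ρ → (∀ {t′} → t < t′ → At t′ c ρ → Reach t′ c′ ρ′) → Reach t c′ ρ′
        then-reach (reach lt a m) k with k lt a
        ... | reach lt′ a′ m′ = reach (≤-trans lt (<⇒≤ lt′)) a′ (unmarked-trans m m′)

        step-at : ∀ {t c ρ} → At t c ρ → At (suc t) (goto c (tops ρ)) (assign (instr P c) ρ (hist t))
        step-at {t} (at-state e₁ e₂) =
          at-state (cong₂ (λ c ρ → goto c (tops ρ)) e₁ e₂) (cong₂ (λ c ρ → assign (instr P c) ρ (hist t)) e₁ e₂)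

        part-step : ∀ {p t ρ} (e : Part p) x → At t (at e x) ρ →
          At (suc t) (maybe′ (at e) (exit e) (nextPos p x (tops ρ))) (assign (instr p x) ρ (hist t))
        part-step {t = t} {ρ} e x a with step-at a
        ... | at-state e₁ e₂ = at-state (trans e₁ (goes e x (tops ρ))) (trans e₂ (cong (λ i → assign i ρ (hist t)) (does e x)))

        branch : ∀ {p t ρ m} (e : Part p) x → At t (at e x) ρ → nextPos p x (tops ρ) ≡ m →
          At (suc t) (maybe′ (at e) (exit e) m) (assign (instr p x) ρ (hist t))
        branch e x a refl = part-step e x a

        single : ∀ {t p c ρ ρ′} (e : Part p) x → At t (at e x) ρ → marked p x ≡ false → At (suc t) c ρ′ → Reach t c ρ′
        single {t} {p} e x a m a′ = reach ≤-refl a′ unm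
          where
          unm : Unmarked t (suc t)
          unm u le (s≤s ge) rewrite ≤-antisym ge le =
            trans (cong (marked P) (At.here a)) (trans (marks e x) m)

        exec : ∀ {p ρ ρ′ t} (e : Part p) → Exec p ρ ρ′ → At t (at e (entry p)) ρ → Reach t (exit e) ρ′
        exec e e-assign a = single e tt a refl (part-step e tt a)
        exec e (e-seq x y) a = then-reach (exec (part-fst e) x a) (λ _ → exec (part-snd e) y)
        exec {while t r b} {ρ} e (e-done f) a = single e nothing a refl (branch e nothing a eq)
          where eq : nextPos (while t r b) nothing (tops ρ) ≡ nothing
                eq rewrite f = refl
        exec {while t r b} {ρ} e (e-loop f x y) a =
          then-reach (single e nothing a refl (branch e nothing a eq))
            (λ _ a₁ → then-reach (exec (part-body e) x a₁) (λ _ → exec e y))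
          where eq : nextPos (while t r b) nothing (tops ρ) ≡ just (just (entry b))
                eq rewrite f = refl
        exec {cond t r b c} {ρ} e (e-then f x) a =
          then-reach (single e nothing a refl (branch e nothing a eq))
            (λ _ → exec (part-then e) x)
          where eq : nextPos (cond t r b c) nothing (tops ρ) ≡ just (just (inj₁ (entry b)))
                eq rewrite f = refl
        exec {cond t r b c} {ρ} e (e-else f x) a =
          then-reach (single e nothing a refl (branch e nothing a eq))
            (λ _ → exec (part-else e) x)
          where eq : nextPos (cond t r b c) nothing (tops ρ) ≡ just (just (inj₂ (entry c)))
                eq rewrite f = refl

      -- Only registers that are tested or copied from count: these determine the control, so a cell
      -- has to store no others.
      maxReg : Cmd → ℕ
      maxReg (_ ≔ _ ∙ reg s)   = suc s
      maxReg (_ ≔ _ ∙ history) = 0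
      maxReg (a ⨾ b)           = maxReg a ⊔ maxReg b
      maxReg (while _ r a)     = suc r ⊔ maxReg a
      maxReg (cond _ r a b)    = suc r ⊔ (maxReg a ⊔ maxReg b)
      maxReg mark              = 0

      module _ (K : ℕ) (ts ts′ : ℕ → Sym) (agree : ∀ r → r < K → ts r ≡ ts′ r) where

        nextPos-cong : ∀ p x → maxReg p ≤ K → nextPos p x ts ≡ nextPos p x ts′
        nextPos-cong (_ ≔ _ ∙ _) x le = refl
        nextPos-cong (a ⨾ b) (inj₁ x) le = cong (λ m → just (maybe′ inj₁ (inj₂ (entry b)) m)) (nextPos-cong a x (m⊔n≤o⇒m≤o _ _ le))
        nextPos-cong (a ⨾ b) (inj₂ x) le = cong (maybe′ (just ∘ inj₂) nothing) (nextPos-cong b x (m⊔n≤o⇒n≤o (maxReg a) _ le))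
        nextPos-cong (while t r a) nothing le =
          cong (λ s → if test t s then just (just (entry a)) else nothing) (agree r (m⊔n≤o⇒m≤o (suc r) (maxReg a) le))
        nextPos-cong (while t r a) (just x) le = cong just (nextPos-cong a x (m⊔n≤o⇒n≤o (suc r) _ le))
        nextPos-cong (cond t r a b) nothing le =
          cong (λ s → just (just (if test t s then inj₁ (entry a) else inj₂ (entry b)))) (agree r (m⊔n≤o⇒m≤o (suc r) (maxReg a ⊔ maxReg b) le))
        nextPos-cong (cond t r a b) (just (inj₁ x)) le =
          cong (maybe′ (just ∘ just ∘ inj₁) nothing) (nextPos-cong a x (m⊔n≤o⇒m≤o (maxReg a) (maxReg b) (m⊔n≤o⇒n≤o (suc r) _ le)))
        nextPos-cong (cond t r a b) (just (inj₂ x)) le =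
          cong (maybe′ (just ∘ just ∘ inj₂) nothing) (nextPos-cong b x (m⊔n≤o⇒n≤o (maxReg a) (maxReg b) (m⊔n≤o⇒n≤o (suc r) _ le)))
        nextPos-cong mark x le = refl

      reads-below : ∀ K p x {d op s} → maxReg p ≤ K → instr p x ≡ just (d , op , reg s) → s < K
      reads-below K (_ ≔ _ ∙ reg s) x le refl = le
      reads-below K (a ⨾ b) (inj₁ x) le e = reads-below K a x (m⊔n≤o⇒m≤o (maxReg a) (maxReg b) le) e
      reads-below K (a ⨾ b) (inj₂ x) le e = reads-below K b x (m⊔n≤o⇒n≤o (maxReg a) (maxReg b) le) e
      reads-below K (while _ r a) (just x) le e = reads-below K a x (m⊔n≤o⇒n≤o (suc r) _ le) e
      reads-below K (cond _ r a b) (just (inj₁ x)) le e = reads-below K a x (m⊔n≤o⇒m≤o (maxReg a) (maxReg b) (m⊔n≤o⇒n≤o (suc r) _ le)) e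
      reads-below K (cond _ r a b) (just (inj₂ x)) le e = reads-below K b x (m⊔n≤o⇒n≤o (maxReg a) (maxReg b) (m⊔n≤o⇒n≤o (suc r) _ le)) e

      -- Configurations of the stack machine as rows of cells.

      K : ℕ
      K = maxReg P

      build : ∀ n → (ℕ → Sym) → Vec Sym n
      build zero    f = []
      build (suc n) f = f 0 ∷ build n (f ∘ suc)

      get : ∀ {n} → Vec Sym n → ℕ → Sym
      get []      _       = nothing
      get (a ∷ v) zero    = a
      get (a ∷ v) (suc i) = get v i

      get-build : ∀ n f i → i < n → get (build n f) i ≡ f i
      get-build (suc n) f zero    _        = refl
      get-build (suc n) f (suc i) (s≤s lt) = get-build n (f ∘ suc) i lt

      get-blank : ∀ n i → get (build n (λ _ → nothing)) i ≡ nothing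
      get-blank zero    i       = refl
      get-blank (suc n) zero    = refl
      get-blank (suc n) (suc i) = get-blank n i

      build-cong : ∀ n {f g} → (∀ i → f i ≡ g i) → build n f ≡ build n g
      build-cong zero    e = refl
      build-cong (suc n) e = cong₂ _∷_ (e 0) (build-cong n (e ∘ suc))

      -- Cells: track 0 holds the history, track r + 1 holds register r.
      track : Src → ℕ
      track (reg r) = suc r
      track history = 0

      opTop : Op → Sym → Sym → Sym
      opTop keep  c n = c
      opTop push  c n = just zero
      opTop pop   c n = n
      opTop clear c n = nothing
      opTop lower c n = maybe′ (just ∘ decrease) nothing c

      -- The top of a stack is at offset 0, so a push shifts items away from it and a pop towards
      -- it: the new item comes from the previous or the next cell.
      opRest : Op → Sym → Sym → Sym → Sym
      opRest keep  p c n = c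
      opRest push  p c n = p
      opRest pop   p c n = n
      opRest clear p c n = nothing
      opRest lower p c n = c

      topTrack : Maybe Assignment → (ℕ → Sym) → (ℕ → Sym) → ℕ → Sym
      topTrack nothing             c n r = c (suc r)
      topTrack (just (d , op , s)) c n r with r ≟ d
      ... | yes _ = opTop op (c (track s)) (n (track s))
      ... | no _  = c (suc r)

      restTrack : Maybe Assignment → (ℕ → Sym) → (ℕ → Sym) → (ℕ → Sym) → ℕ → Sym
      restTrack nothing             p c n r = c (suc r)
      restTrack (just (d , op , s)) p c n r with r ≟ d
      ... | yes _ = opRest op (p (track s)) (c (track s)) (n (track s))
      ... | no _  = c (suc r)

      CellP : Set
      CellP = Vec Sym (suc K)

      topCell : Item → Pos P → CellP → CellP → CellP
      topCell i k c n = just i ∷ build K (topTrack (instr P k) (get c) (get n))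

      restCell : Pos P → CellP → CellP → CellP → CellP
      restCell k p c n = get p 0 ∷ build K (restTrack (instr P k) (get p) (get c) (get n))

      blank : CellP
      blank = build (suc K) (λ _ → nothing)

      restCell-blank : ∀ k → restCell k blank blank blank ≡ blank
      restCell-blank k = cong (nothing ∷_) (build-cong K (go (instr P k)))
        where
        go : ∀ i r → restTrack i (get blank) (get blank) (get blank) r ≡ nothing
        go nothing r = get-blank (suc K) (suc r)
        go (just (d , op , s)) r with r ≟ d
        go (just (d , keep , s)) r | yes _ = get-blank (suc K) (track s)
        go (just (d , push , s)) r | yes _ = get-blank (suc K) (track s)
        go (just (d , pop , s)) r | yes _ = get-blank (suc K) (track s)
        go (just (d , clear , s)) r | yes _ = refl
        go (just (d , lower , s)) r | yes _ = get-blank (suc K) (track s)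
        go (just (d , op , s)) r | no _ = get-blank (suc K) (suc r)

      module _ {X : Set} (item : X → Bool → Item) where

        ConfP : Set
        ConfP = Pos P × (ℕ → CellP)

        gotoCell : Pos P → CellP → Pos P
        gotoCell k c = goto k (λ r → get c (suc r))

        stepP : Bool → X → ConfP → ConfP
        stepP b x (k , c) = gotoCell k (c 0) , c′
          where
          c′ : ℕ → CellP
          c′ zero    = topCell (item x b) k (c 0) (c 1)
          c′ (suc o) = restCell k (c o) (c (suc o)) (c (suc (suc o)))

        machine : LocalMachine X
        machine = record
          { Ctl = Pos P ; Cell = CellP ; Conf = ConfP
          ; finCtl = finPos P ; finCell = finVec (finMaybe (finFin (suc J))) (suc K)
          ; ∅ = blank
          ; init = entry P , λ _ → blank
          ; step = stepP
          ; ctl = proj₁ ; cell = proj₂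
          ; κ = gotoCell
          ; top = λ b x → topCell (item x b)
          ; rest = λ k _ → restCell k
          ; init-∅ = λ _ → refl
          ; ctl-step = λ _ _ _ → refl
          ; cell-top = λ _ _ _ → refl
          ; cell-rest = λ _ _ _ _ → refl
          ; rest-∅ = λ k _ → restCell-blank k
          }

        nth : List Item → ℕ → Sym
        nth []      _       = nothing
        nth (a ∷ l) zero    = just a
        nth (a ∷ l) (suc o) = nth l o

        nth-head : ∀ l → nth l 0 ≡ head l
        nth-head []      = refl
        nth-head (_ ∷ _) = refl

        nth-top : ∀ op l → nth (apply op l) 0 ≡ opTop op (nth l 0) (nth l 1)
        nth-top keep  l       = refl
        nth-top push  l       = refl
        nth-top pop   []      = refl
        nth-top pop   (_ ∷ l) = refl
        nth-top clear l       = refl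
        nth-top lower []      = refl
        nth-top lower (_ ∷ l) = refl

        nth-rest : ∀ op l o → nth (apply op l) (suc o) ≡ opRest op (nth l o) (nth l (suc o)) (nth l (suc (suc o)))
        nth-rest keep  l       o = refl
        nth-rest push  l       o = refl
        nth-rest pop   []      o = refl
        nth-rest pop   (_ ∷ l) o = refl
        nth-rest clear l       o = refl
        nth-rest lower []      o = refl
        nth-rest lower (_ ∷ l) o = refl

        record Represents (conf : ConfP) (k : Pos P) (ρ : Store) (h : List Item) : Set where
          field
            control : proj₁ conf ≡ k
            hist₀   : ∀ o → get (proj₂ conf o) 0 ≡ nth h o
            regs    : ∀ r o → r < K → get (proj₂ conf o) (suc r) ≡ nth (ρ r) o

        represents-init : Represents (entry P , λ _ → blank) (entry P) (λ _ → []) []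
        represents-init = record { control = refl ; hist₀ = λ _ → refl ; regs = λ r o lt → get-blank (suc K) (suc r) }

        represents-step : ∀ {conf k ρ h} b x → Represents conf k ρ h →
          Represents (stepP b x conf) (goto k (tops ρ)) (assign (instr P k) ρ h) (item x b ∷ h)
        represents-step {k , c} {.k} {ρ} {h} b x record { control = refl ; hist₀ = hist₀ ; regs = regs } = record
          { control = cong (fromMaybe (entry P)) (nextPos-cong K _ _ (λ r lt → trans (regs r 0 lt) (nth-head (ρ r))) P k ≤-refl)
          ; hist₀ = λ { zero → refl ; (suc o) → hist₀ o }
          ; regs = λ { r zero lt → trans (get-build K _ r lt) (new-top (instr P k) refl r lt)
                     ; r (suc o) lt → trans (get-build K _ r lt) (new-rest (instr P k) refl r o lt) } }
          where
          src≡ : ∀ {d op s} → instr P k ≡ just (d , op , s) → ∀ o → get (c o) (track s) ≡ nth (source s ρ h) o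
          src≡ {s = reg s}   e o = regs s o (reads-below K P k ≤-refl e)
          src≡ {s = history} e o = hist₀ o
          new-top : ∀ i → instr P k ≡ i → ∀ r → r < K → topTrack i (get (c 0)) (get (c 1)) r ≡ nth (assign i ρ h r) 0
          new-top nothing e r lt = regs r 0 lt
          new-top (just (d , op , s)) e r lt with r ≟ d
          ... | yes _ = trans (cong₂ (opTop op) (src≡ e 0) (src≡ e 1)) (sym (nth-top op (source s ρ h)))
          ... | no _  = regs r 0 lt
          new-rest : ∀ i → instr P k ≡ i → ∀ r o → r < K →
            restTrack i (get (c o)) (get (c (suc o))) (get (c (suc (suc o)))) r ≡ nth (assign i ρ h r) (suc o)
          new-rest nothing e r o lt = regs r (suc o) lt
          new-rest (just (d , op , s)) e r o lt with r ≟ d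
          ... | yes _ = trans (cong (λ a → opRest op a _ _) (src≡ e o)) (trans (cong₂ (opRest op _) (src≡ e (suc o)) (src≡ e (suc (suc o)))) (sym (nth-rest op (source s ρ h) o)))
          ... | no _  = regs r (suc o) lt

        control-run : ∀ (x : ℕ → X) (β : ℕ → Bool) (run : ℕ → ConfP) → run 0 ≡ (entry P , λ _ → blank) →
          (∀ t → run (suc t) ≡ stepP (β t) (x t) (run t)) → ∀ t → proj₁ (run t) ≡ Run.posAt (λ t → item (x t) (β t)) t
        control-run x β run e₀ eₛ t = Represents.control (go t)
          where
          open Run (λ t → item (x t) (β t))
          go : ∀ t → Represents (run t) (posAt t) (storeAt t) (hist t)
          go zero    = subst (λ c → Represents c _ _ _) (sym e₀) represents-init
          go (suc t) = subst (λ c → Represents c _ _ _) (sym (eₛ t)) (represents-step (β t) (x t) (go t))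

-- Primitive recursive functions as while programs.

module Compile where
  open Machine
  open import Data.Nat using (_≟_)
  open import Data.Fin using (zero; suc)
  open import Data.Vec using (Vec; []; _∷_; lookup) renaming (map to vmap)
  open import Data.Vec.Properties using (lookup-map)
  open import Data.Vec.Relation.Unary.All using (All; []; _∷_) renaming (map to mapAll)
  open import Data.List using (List; []; _∷_; length)

  range : ℕ → ∀ m → Vec ℕ m
  range o zero    = []
  range o (suc m) = o ∷ range (suc o) m

  mutual
    -- Registers from s on are scratch space.
    compile : ∀ {n} → PR n → Vec ℕ n → (out s : ℕ) → Cmd
    compile zer ins out s = out ≔ clear ∙ reg out
    compile succ (r ∷ []) out s = out ≔ push ∙ reg r
    compile (proj i) ins out s = out ≔ keep ∙ reg (lookup ins i)
    compile (comp {m} f gs) ins out s = compileVec gs ins s (m + s) ⨾ compile f (range s m) out (m + s)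
    compile (prec f g) (r ∷ ins) out s =
      -- Register s counts down, 1 + s holds the value reached, 2 + s the recursion index counting
      -- up, and 3 + s receives the new value; scratch space therefore begins at 4 + s.
      s ≔ keep ∙ reg r ⨾ 2 + s ≔ clear ∙ reg s ⨾ compile f ins (1 + s) (4 + s) ⨾
      while nonempty s (compileBody g ins s) ⨾ out ≔ keep ∙ reg (1 + s)

    compileBody : ∀ {n} → PR (suc (suc n)) → Vec ℕ n → ℕ → Cmd
    compileBody g ins s =
      compile g (1 + s ∷ 2 + s ∷ ins) (3 + s) (4 + s) ⨾
      1 + s ≔ keep ∙ reg (3 + s) ⨾ 2 + s ≔ push ∙ reg (2 + s) ⨾ s ≔ pop ∙ reg s

    compileVec : ∀ {m n} → Vec (PR n) m → Vec ℕ n → (o s : ℕ) → Cmd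
    -- There is no empty command; copying a register onto itself takes its place.
    compileVec []       ins o s = o ≔ keep ∙ reg o
    compileVec (g ∷ gs) ins o s = compile g ins o s ⨾ compileVec gs ins (suc o) s

  module Correctness (J : ℕ) where
    open Stacks J

    num : Store → ℕ → ℕ
    num ρ r = length (ρ r)

    updated : ∀ ρ d l → (ρ [ d ↦ l ]) d ≡ l
    updated ρ d l with d ≟ d
    ... | yes _ = refl
    ... | no ne = ⊥-elim (ne refl)

    unchanged : ∀ ρ d l {r} → ¬ r ≡ d → (ρ [ d ↦ l ]) r ≡ ρ r
    unchanged ρ d l {r} ne with r ≟ d
    ... | yes e = ⊥-elim (ne e)
    ... | no _  = refl

    Same : ℕ → Store → Store → Set
    Same s ρ ρ′ = ∀ r → r < s → ρ′ r ≡ ρ r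

    same-nums : ∀ {n s ρ ρ′} {ins : Vec ℕ n} → Same s ρ ρ′ → All (_< s) ins → vmap (num ρ′) ins ≡ vmap (num ρ) ins
    same-nums same []        = refl
    same-nums same (lt ∷ al) = cong₂ _∷_ (cong length (same _ lt)) (same-nums same al)

    range-below : ∀ o m s → m + o ≤ s → All (_< s) (range o m)
    range-below o zero    s le = []
    range-below o (suc m) s le =
      ≤-trans (s≤s (m≤n+m o m)) le ∷ range-below (suc o) m s (≤-trans (≤-reflexive (+-suc m o)) le)

    record Computes (p : Cmd) (ρ : Store) (out s v : ℕ) : Set where
      constructor computes
      field
        {end}  : Store
        runs   : Exec p ρ end
        result : num end out ≡ v
        frame  : ∀ r → r < s → ¬ r ≡ out → end r ≡ ρ r

    record ComputesVec {m} (p : Cmd) (ρ : Store) (o : ℕ) (vs : Vec ℕ m) : Set where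
      constructor computesVec
      field
        {end}   : Store
        runs    : Exec p ρ end
        results : vmap (num end) (range o m) ≡ vs
        frame   : Same o ρ end

    assigns : ∀ {ρ d op r s v} → length (apply op (ρ r)) ≡ v → Computes (d ≔ op ∙ reg r) ρ d s v
    assigns {ρ} {d} {op} {r} e =
      computes e-assign (trans (cong length (updated ρ d _)) e) (λ _ _ ne → unchanged ρ d _ ne)

    record Loop {n} (f : PR n) (g : PR (suc (suc n))) (ins : Vec ℕ n) (s : ℕ) (xs : Vec ℕ n) (k : ℕ) (ρ : Store) : Set where
      constructor loop
      field
        {end}  : Store
        runs   : Exec (while nonempty s (compileBody g ins s)) ρ end
        result : num end (1 + s) ≡ evalRec f g (k + num ρ (2 + s)) xs
        frame  : Same s ρ end

    mutual
      compile-correct : ∀ {n} (f : PR n) ins out s ρ → All (_< s) ins → out < s →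
        Computes (compile f ins out s) ρ out s (eval f (vmap (num ρ) ins))
      compile-correct zer ins out s ρ al lt = assigns refl
      compile-correct succ (r ∷ []) out s ρ al lt = assigns refl
      compile-correct (proj i) ins out s ρ al lt = assigns (sym (lookup-map i (num ρ) ins))
      compile-correct (comp {m} f gs) ins out s ρ al lt = computes (e-seq V.runs F.runs)
        (trans F.result (cong (eval f) V.results))
        (λ r lt′ ne → trans (F.frame r (m≤n⇒m≤o+n m lt′) ne) (V.frame r lt′))
        where
        module V = ComputesVec (compileVec-correct gs ins s (m + s) ρ al ≤-refl)
        module F = Computes (compile-correct f (range s m) out (m + s) V.end (range-below s m (m + s) ≤-refl) (m≤n⇒m≤o+n m lt))
      compile-correct (prec f g) (r ∷ ins) out s ρ (r< ∷ al) lt = computes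
        (e-seq e-assign (e-seq e-assign (e-seq F.runs (e-seq L.runs e-assign))))
        (trans (cong length (updated L.end out _)) (trans L.result
          (cong (λ k → evalRec f g k (vmap (num ρ) ins)) (trans (cong₂ _+_ counter index₀) (+-zero _)))))
        (λ r′ lt′ ne → trans (unchanged L.end out _ ne) (trans (L.frame r′ lt′) (start-frame r′ lt′)))
        where
        ρ₁ ρ₂ : Store
        ρ₁ = ρ [ s ↦ ρ r ]
        ρ₂ = ρ₁ [ 2 + s ↦ [] ]
        same₂ : Same s ρ ρ₂
        same₂ r′ lt′ = trans (unchanged ρ₁ (2 + s) [] (<⇒≢ (m≤n⇒m≤o+n 2 lt′))) (unchanged ρ s _ (<⇒≢ lt′))
        module F = Computes (compile-correct f ins (1 + s) (4 + s) ρ₂ (mapAll (m≤n⇒m≤o+n 4) al) (s≤s (s≤s (m≤n⇒m≤o+n 2 ≤-refl))))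
        start-frame : Same s ρ F.end
        start-frame r′ lt′ = trans (F.frame r′ (m≤n⇒m≤o+n 4 lt′) (<⇒≢ (m≤n⇒m≤o+n 1 lt′))) (same₂ r′ lt′)
        counter : num F.end s ≡ num ρ r
        counter = cong length (trans (F.frame s (m≤n⇒m≤o+n 3 ≤-refl) (<⇒≢ ≤-refl))
          (trans (unchanged ρ₁ (2 + s) [] (<⇒≢ (m≤n⇒m≤o+n 1 ≤-refl))) (updated ρ s _)))
        index₀ : num F.end (2 + s) ≡ 0
        index₀ = cong length (trans (F.frame (2 + s) (s≤s (s≤s (s≤s (n≤1+n s)))) (>⇒≢ ≤-refl)) (updated ρ₁ (2 + s) []))
        +-zero : ∀ k → k + 0 ≡ k
        +-zero zero    = refl
        +-zero (suc k) = cong suc (+-zero k)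
        module L = Loop (loop-correct f g ins s (vmap (num ρ) ins) al (num F.end s) F.end refl
          (trans F.result (trans (cong (eval f) (same-nums same₂ al)) (cong (λ k → evalRec f g k (vmap (num ρ) ins)) (sym index₀))))
          (same-nums start-frame al))

      compileVec-correct : ∀ {m n} (gs : Vec (PR n) m) ins o s ρ → All (_< o) ins → m + o ≤ s →
        ComputesVec (compileVec gs ins o s) ρ o (evalVec gs (vmap (num ρ) ins))
      compileVec-correct [] ins o s ρ al le = computesVec e-assign refl (λ r lt → unchanged ρ o _ (<⇒≢ lt))
      compileVec-correct {suc m} (g ∷ gs) ins o s ρ al le = computesVec (e-seq G.runs V.runs)
        (cong₂ _∷_ (trans (cong length (V.frame o ≤-refl)) G.result) (trans V.results (cong (evalVec gs) (same-nums same al))))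
        (λ r lt → trans (V.frame r (m≤n⇒m≤1+n lt)) (same r lt))
        where
        o<s : o < s
        o<s = ≤-trans (s≤s (m≤n+m o m)) le
        module G = Computes (compile-correct g ins o s ρ (mapAll (λ lt → ≤-trans lt (≤-trans (n≤1+n o) o<s)) al) o<s)
        same : Same o ρ G.end
        same r lt = G.frame r (≤-trans lt (≤-trans (n≤1+n o) o<s)) (<⇒≢ lt)
        module V = ComputesVec (compileVec-correct gs ins (suc o) s G.end (mapAll m≤n⇒m≤1+n al) (≤-trans (≤-reflexive (+-suc m o)) le))

      -- The accumulator is always the value of the recursion at the current index, and countdown
      -- plus index is constant.
      loop-correct : ∀ {n} (f : PR n) (g : PR (suc (suc n))) ins s xs → All (_< s) ins → ∀ k ρ → num ρ s ≡ k →
        num ρ (1 + s) ≡ evalRec f g (num ρ (2 + s)) xs → vmap (num ρ) ins ≡ xs → Loop f g ins s xs k ρ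
      loop-correct f g ins s xs al zero ρ ek ea ei = loop (e-done (empty (ρ s) ek)) ea (λ _ _ → refl)
        where
        empty : ∀ l → length l ≡ 0 → test nonempty (Data.List.head l) ≡ false
        empty [] _ = refl
      loop-correct f g ins s xs al (suc k) ρ ek ea ei = loop
        (e-loop (full (ρ s) ek) (e-seq G.runs (e-seq e-assign (e-seq e-assign e-assign))) R.runs)
        (trans R.result (cong (λ i → evalRec f g i xs) (trans (cong (k +_) index′) (+-suc k _))))
        (λ r lt → trans (R.frame r lt) (frame₄ r lt))
        where
        full : ∀ l → length l ≡ suc k → test nonempty (Data.List.head l) ≡ true
        full (_ ∷ _) _ = refl
        module G = Computes (compile-correct g (1 + s ∷ 2 + s ∷ ins) (3 + s) (4 + s) ρ
          (s≤s (s≤s (m≤n⇒m≤o+n 2 ≤-refl)) ∷ s≤s (s≤s (s≤s (n≤1+n s))) ∷ mapAll (m≤n⇒m≤o+n 4) al) ≤-refl)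
        ρ₂ ρ₃ ρ₄ : Store
        ρ₂ = G.end [ 1 + s ↦ G.end (3 + s) ]
        ρ₃ = ρ₂ [ 2 + s ↦ zero ∷ ρ₂ (2 + s) ]
        ρ₄ = ρ₃ [ s ↦ apply pop (ρ₃ s) ]
        s<1 : s < 1 + s
        s<1 = ≤-refl
        s<2 : s < 2 + s
        s<2 = n≤1+n (suc s)
        s<3 : s < 3 + s
        s<3 = m≤n⇒m≤o+n 2 ≤-refl
        2< : 2 + s < 4 + s
        2< = s≤s (s≤s (s≤s (n≤1+n s)))
        frame₄ : Same s ρ ρ₄
        frame₄ r lt = trans (unchanged ρ₃ s _ (<⇒≢ lt)) (trans (unchanged ρ₂ (2 + s) _ (<⇒≢ (m≤n⇒m≤o+n 2 lt)))
          (trans (unchanged G.end (1 + s) _ (<⇒≢ (m≤n⇒m≤o+n 1 lt))) (G.frame r (m≤n⇒m≤o+n 4 lt) (<⇒≢ (m≤n⇒m≤o+n 3 lt)))))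
        index′ : num ρ₄ (2 + s) ≡ suc (num ρ (2 + s))
        index′ = cong length (trans (unchanged ρ₃ s _ (>⇒≢ s<2)) (trans (updated ρ₂ (2 + s) _)
          (cong (zero ∷_) (trans (unchanged G.end (1 + s) _ (>⇒≢ ≤-refl)) (G.frame (2 + s) 2< (<⇒≢ ≤-refl))))))
        counter′ : num ρ₄ s ≡ k
        counter′ = trans (cong length (updated ρ₃ s _)) (popped (ρ₃ s) (trans (cong length
          (trans (unchanged ρ₂ (2 + s) _ (<⇒≢ s<2)) (trans (unchanged G.end (1 + s) _ (<⇒≢ s<1)) (G.frame s (m≤n⇒m≤o+n 3 ≤-refl) (<⇒≢ s<3))))) ek))
          where
          popped : ∀ l → length l ≡ suc k → length (apply pop l) ≡ k
          popped (_ ∷ l) refl = refl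
        acc′ : num ρ₄ (1 + s) ≡ evalRec f g (num ρ₄ (2 + s)) xs
        acc′ = trans (cong length (trans (unchanged ρ₃ s _ (>⇒≢ s<1)) (trans (unchanged ρ₂ (2 + s) _ (<⇒≢ ≤-refl)) (updated G.end (1 + s) _))))
          (trans G.result (trans (cong₂ (λ a xs → eval g (a ∷ num ρ (2 + s) ∷ xs)) ea ei) (cong (λ i → evalRec f g i xs) (sym index′))))
        module R = Loop (loop-correct f g ins s xs al k ρ₄ counter′ acc′ (trans (same-nums frame₄ al) ei))

-- A program that is marked infinitely often iff the Π⁰₂ condition holds.

module SearchProgram where
  open Machine
  open Compile
  open Games using (take-snoc)
  open import Data.List.Properties using (++-identityʳ; ++-assoc)
  open import Data.Nat using (_^_)
  open import Data.Fin using (zero; suc; toℕ; inject₁)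
  open import Data.Fin.Properties using (toℕ-inject₁)
  open import Data.Vec using ([]; _∷_)
  open import Data.Vec.Relation.Unary.All using ([]; _∷_)
  open import Data.List using (List; []; _∷_; length; head; _++_)

  doublePR : PR 1
  doublePR = prec zer (comp succ (comp succ (proj zero ∷ []) ∷ []))

  oddPR : PR 1
  oddPR = comp succ (doublePR ∷ [])

  eval-double : ∀ n → eval doublePR (n ∷ []) ≡ 2 * n
  eval-double zero    = refl
  eval-double (suc n) = trans (cong (2 +_) (eval-double n)) (sym (*-distribˡ-+ 2 1 n))

  module Rounds (markedAt : ℕ → Bool) (Zero : ℕ → ℕ → Set) (Searching : ℕ → ℕ → ℕ → Set) where

    Unmarked : ℕ → ℕ → Set
    Unmarked t t′ = ∀ u → t ≤ u → u < t′ → markedAt u ≡ false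

    -- After an unsuccessful round the prefix loses its last letter or, if empty, is replaced by all
    -- that has been read, which is at least t letters when the round began at time t.
    Refilled : ℕ → ℕ → ℕ → Set
    Refilled t m m′ = m ≡ suc m′ ⊎ (m ≡ 0 × t ≤ m′)

    data Outcome (t n m : ℕ) : Set where
      hit  : ∀ {t′ u m′} → Zero n m → t ≤ u → suc u < t′ → markedAt u ≡ true → markedAt (suc u) ≡ true →
             Searching t′ (suc n) m′ → Outcome t n m
      miss : ∀ {t′ m′} → ¬ Zero n m → t < t′ → Unmarked t t′ → Searching t′ n m′ → Refilled t m m′ → Outcome t n m

    module _ (searching₀ : Searching 0 0 0) (round : ∀ {t n m} → Searching t n m → Outcome t n m) where

      -- A miss passes no mark, so a later mark forces a hit for the current n, and then the search
      -- continues with n + 1.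
      marks⇒zeros : (∀ N → ∃ λ t → N ≤ t × markedAt t ≡ true) → ∀ n → ∃ λ m → Zero n m
      marks⇒zeros inf n = let _ , _ , s = reached n in proj₁ (next s)
        where
        next-hit : ∀ fuel {t n m u} → Searching t n m → t ≤ u → u ≤ fuel + t → markedAt u ≡ true →
          (∃ λ m → Zero n m) × ∃ λ t → ∃ λ m → Searching t (suc n) m
        next-hit fuel {t} {n} {m} {u} s le bound mk with round s
        ... | hit z _ _ _ _ s′ = (m , z) , _ , _ , s′
        ... | miss {t′} _ lt un s′ _ with <-≤-connex u t′
        ... | inj₁ u<t′ = ⊥-elim (true≢false (trans (sym mk) (un u le u<t′)))
          where true≢false : ¬ true ≡ false
                true≢false ()
        next-hit zero {t} s le bound mk | miss _ lt _ _ _ | inj₂ t′≤u = ⊥-elim (<⇒≱ lt (≤-trans t′≤u bound))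
        next-hit (suc fuel) s le bound mk | miss _ lt _ s′ _ | inj₂ t′≤u =
          next-hit fuel s′ t′≤u (≤-trans bound (≤-trans (≤-reflexive (sym (+-suc fuel _))) (+-monoʳ-≤ fuel lt))) mk
        next : ∀ {t n m} → Searching t n m → (∃ λ m → Zero n m) × ∃ λ t → ∃ λ m → Searching t (suc n) m
        next {t} s = let u , le , mk = inf t in next-hit u s le (m≤m+n u t) mk
        reached : ∀ n → ∃ λ t → ∃ λ m → Searching t n m
        reached zero    = _ , _ , searching₀
        reached (suc n) = let _ , _ , s = reached n in proj₂ (next s)

      -- Let m₀ be a length that works for the current n. Wait until time m₀, use up the prefix
      -- under examination, refill with at least m₀ letters and descend: there is a hit at length m₀
      -- at the latest.
      zeros⇒marks : (∀ n → ∃ λ m → Zero n m) → ∀ N → ∃ λ t → N ≤ t × markedAt t ≡ true × markedAt (suc t) ≡ true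
      zeros⇒marks zeros N = let t , n , m , le , s = late N ; u , le′ , mk = find (zeros n) s in u , ≤-trans le le′ , mk
        where
        late : ∀ N → ∃ λ t → ∃ λ n → ∃ λ m → N ≤ t × Searching t n m
        late zero    = _ , _ , _ , z≤n , searching₀
        late (suc N) with late N
        ... | t , n , m , le , s with round s
        ... | hit _ le′ lt _ _ s′ = _ , _ , _ , ≤-trans (s≤s (≤-trans le le′)) (<⇒≤ lt) , s′
        ... | miss _ lt _ s′ _ = _ , _ , _ , ≤-trans (s≤s le) lt , s′
        Found : ℕ → Set
        Found t = ∃ λ u → t ≤ u × markedAt u ≡ true × markedAt (suc u) ≡ true
        earlier : ∀ {t t′} → t < t′ → Found t′ → Found t
        earlier lt (u , le , mk) = u , ≤-trans (<⇒≤ lt) le , mk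
        find : ∀ {t n m} → (∃ λ m → Zero n m) → Searching t n m → Found t
        find {t} {n} (m₀ , z₀) s = wait m₀ s (m≤m+n m₀ t)
          where
          descend : ∀ m {t} → Searching t n m → m₀ ≤ m → Found t
          descend m s le with round s
          ... | hit _ le′ _ mk mk′ _ = _ , le′ , mk , mk′
          descend m s le | miss ¬z lt un s′ r with m≤n⇒m<n∨m≡n le
          ... | inj₂ refl = ⊥-elim (¬z z₀)
          descend (suc m) s le | miss ¬z lt un s′ (inj₁ refl) | inj₁ (s≤s le′) = earlier lt (descend m s′ le′)
          drain : ∀ m {t} → Searching t n m → m₀ ≤ t → Found t
          drain m s le with round s
          ... | hit _ le′ _ mk mk′ _ = _ , le′ , mk , mk′
          drain (suc m) s le | miss ¬z lt un s′ (inj₁ refl) = earlier lt (drain m s′ (≤-trans le (<⇒≤ lt)))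
          drain zero s le | miss ¬z lt un s′ (inj₂ (_ , le′)) = earlier lt (descend _ s′ (≤-trans le le′))
          wait : ∀ fuel {t m} → Searching t n m → m₀ ≤ fuel + t → Found t
          wait zero s le = drain _ s le
          wait (suc fuel) s le with round s
          ... | hit _ le′ _ mk mk′ _ = _ , le′ , mk , mk′
          ... | miss ¬z lt un s′ _ =
            earlier lt (wait fuel s′ (≤-trans le (≤-trans (≤-reflexive (sym (+-suc fuel _))) (+-monoʳ-≤ fuel lt))))

  module Search (J : ℕ) (f : PR 2) where
    open Stacks J
    open Correctness J

    -- For n = 0, 1, ... searches a prefix of the input on which f n vanishes. Each success is marked
    -- twice in succession, because marks are only inspected at even times. Registers: 0 = n, 1 = stack
    -- of the prefix under examination, 2 = copy of it being consumed, 3 = its code, 4 = auxiliary,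
    -- 5 = value of f.
    startLetter scaleLetter scan evaluate react refill body search : Cmd
    startLetter = compile oddPR (3 ∷ []) 4 6 ⨾ 3 ≔ keep ∙ reg 4
    scaleLetter = while positive 2 (compile doublePR (3 ∷ []) 4 6 ⨾ 3 ≔ keep ∙ reg 4 ⨾ 2 ≔ lower ∙ reg 2)
    scan = while nonempty 2 (startLetter ⨾ scaleLetter ⨾ 2 ≔ pop ∙ reg 2)
    evaluate = 2 ≔ keep ∙ reg 1 ⨾ 3 ≔ clear ∙ reg 3 ⨾ scan ⨾ compile f (0 ∷ 3 ∷ []) 5 6
    react = cond nonempty 5 (5 ≔ keep ∙ reg 5) (mark ⨾ mark ⨾ 0 ≔ push ∙ reg 0)
    refill = cond nonempty 1 (1 ≔ pop ∙ reg 1) (1 ≔ keep ∙ history)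
    body = evaluate ⨾ react ⨾ refill
    search = while always 0 body

    -- A history has its last letter on top, and the code of a word is built from its last letter
    -- outwards, so popping and accumulating computes `codeList` of the prefix.
    codeFrom : ℕ → List Item → ℕ
    codeFrom c []      = c
    codeFrom c (a ∷ l) = codeFrom (2 ^ toℕ a * suc (2 * c)) l

    record Rewrites (p : Cmd) (ρ : Store) (stack : List Item → Set) (c : ℕ) : Set where
      constructor rewrites
      field
        {end} : Store
        runs  : Exec p ρ end
        keeps : Same 2 ρ end
        stk   : stack (end 2)
        code  : num end 3 ≡ c

    private
      low : ∀ {r} → r < 2 → ∀ k → ¬ r ≡ 2 + k
      low (s≤s z≤n) k ()
      low (s≤s (s≤s z≤n)) k ()
      low′ : ∀ {r} → r < 2 → r < 6
      low′ lt = ≤-trans lt (s≤s (s≤s z≤n))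

    rewrite-code : ∀ (g : PR 1) ρ → Rewrites (compile g (3 ∷ []) 4 6 ⨾ 3 ≔ keep ∙ reg 4) ρ (_≡ ρ 2) (eval g (num ρ 3 ∷ []))
    rewrite-code g ρ = rewrites (e-seq G.runs e-assign)
      (λ r lt → trans (unchanged G.end 3 _ (low lt 1)) (G.frame r (low′ lt) (low lt 2)))
      (G.frame 2 (s≤s (s≤s (s≤s z≤n))) (λ ()))
      G.result
      where module G = Computes (compile-correct g (3 ∷ []) 4 6 ρ (s≤s (s≤s (s≤s (s≤s z≤n))) ∷ []) (s≤s (s≤s (s≤s (s≤s (s≤s z≤n))))))

    Below : List Item → List Item → Set
    Below l s = ∃ λ a → s ≡ a ∷ l

    scaleLetter-correct : ∀ k ρ a l → toℕ a ≡ k → ρ 2 ≡ a ∷ l → Rewrites scaleLetter ρ (Below l) (2 ^ k * num ρ 3)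
    scaleLetter-correct zero ρ zero l ek es = rewrites (e-done (cong (test positive ∘ head) es)) (λ _ _ → refl) (zero , es) (sym (+-identityʳ _))
    scaleLetter-correct (suc k) ρ (suc a) l ek es = rewrites
      (e-loop (cong (test positive ∘ head) es) (reassoc D.runs) I.runs)
      (λ r lt → trans (I.keeps r lt) (trans (unchanged D.end 2 _ (low lt 0)) (D.keeps r lt)))
      I.stk
      (trans I.code (trans (cong (λ c → 2 ^ k * c) (trans D.code (eval-double (num ρ 3))))
        (trans (sym (*-assoc (2 ^ k) 2 _)) (cong (_* num ρ 3) (*-comm (2 ^ k) 2)))))
      where
      module D = Rewrites (rewrite-code doublePR ρ)
      reassoc : ∀ {a b c ρ ρ₁} → Exec (a ⨾ b) ρ ρ₁ → Exec (a ⨾ b ⨾ (2 ≔ c ∙ reg 2)) ρ (ρ₁ [ 2 ↦ apply c (ρ₁ 2) ])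
      reassoc (e-seq x y) = e-seq x (e-seq y e-assign)
      module I = Rewrites (scaleLetter-correct k (D.end [ 2 ↦ apply lower (D.end 2) ]) (inject₁ a) l (trans (toℕ-inject₁ a) (suc-injective ek))
        (cong (apply lower) (trans D.stk es)))

    scan-correct : ∀ l ρ → ρ 2 ≡ l → Rewrites scan ρ (λ _ → ℕ) (codeFrom (num ρ 3) l)
    scan-correct [] ρ es = rewrites (e-done (cong (test nonempty ∘ head) es)) (λ _ _ → refl) 0 refl
    scan-correct (a ∷ l) ρ es = rewrites
      (e-loop (cong (test nonempty ∘ head) es) (e-seq A.runs (e-seq B.runs e-assign)) I.runs)
      (λ r lt → trans (I.keeps r lt) (trans (unchanged B.end 2 _ (low lt 0)) (trans (B.keeps r lt) (A.keeps r lt))))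
      0
      (trans I.code (cong (λ c → codeFrom c l) (trans B.code
        (cong (2 ^ toℕ a *_) (trans A.code (cong (1 +_) (eval-double (num ρ 3))))))))
      where
      module A = Rewrites (rewrite-code oddPR ρ)
      module B = Rewrites (scaleLetter-correct (toℕ a) A.end a l refl (trans A.stk es))
      module I = Rewrites (scan-correct l (B.end [ 2 ↦ apply pop (B.end 2) ]) (cong (apply pop) (proj₂ B.stk)))

    record Evaluated (ρ : Store) : Set where
      constructor evaluated
      field
        {end} : Store
        runs  : Exec evaluate ρ end
        keeps : Same 2 ρ end
        value : num end 5 ≡ eval f (num ρ 0 ∷ codeFrom 0 (ρ 1) ∷ [])

    evaluate-correct : ∀ ρ → Evaluated ρ
    evaluate-correct ρ = evaluated (e-seq e-assign (e-seq e-assign (e-seq S.runs F.runs)))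
      (λ r lt → trans (F.frame r (low′ lt) (low lt 3)) (trans (S.keeps r lt) (start r lt)))
      (trans F.result (cong₂ (λ n c → eval f (n ∷ c ∷ []))
        (cong length (trans (S.keeps 0 (s≤s z≤n)) (start 0 (s≤s z≤n))))
        S.code))
      where
      ρ₁ ρ₂ : Store
      ρ₁ = ρ [ 2 ↦ ρ 1 ]
      ρ₂ = ρ₁ [ 3 ↦ [] ]
      start : Same 2 ρ ρ₂
      start r lt = trans (unchanged ρ₁ 3 [] (low lt 1)) (unchanged ρ 2 _ (low lt 0))
      module S = Rewrites (scan-correct (ρ 1) ρ₂ refl)
      module F = Computes (compile-correct f (0 ∷ 3 ∷ []) 5 6 S.end (s≤s z≤n ∷ s≤s (s≤s (s≤s (s≤s z≤n))) ∷ []) ≤-refl)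

    module _ (y : ℕ → Item) where
      open Program search
      open Run y

      prefixCode : ℕ → ℕ
      prefixCode m = codeList (mapL toℕ (take m y))

      mapL-++ : ∀ {A B : Set} (g : A → B) xs ys → mapL g (xs ++ ys) ≡ mapL g xs ++ mapL g ys
      mapL-++ g []       ys = refl
      mapL-++ g (x ∷ xs) ys = cong (g x ∷_) (mapL-++ g xs ys)

      codeFrom-hist : ∀ m → codeFrom 0 (hist m) ≡ prefixCode m
      codeFrom-hist m = trans (go m []) (cong codeList (++-identityʳ (mapL toℕ (take m y))))
        where
        go : ∀ m w → codeFrom (codeList w) (hist m) ≡ codeList (mapL toℕ (take m y) ++ w)
        go zero    w = refl
        go (suc m) w = trans (go m (toℕ (y m) ∷ w)) (cong codeList (sym (trans (cong (λ l → mapL toℕ l ++ w) (take-snoc m y))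
          (trans (cong (_++ w) (mapL-++ toℕ (take m y) (y m ∷ []))) (++-assoc (mapL toℕ (take m y)) _ w)))))

      Zero : ℕ → ℕ → Set
      Zero n m = eval f (n ∷ prefixCode m ∷ []) ≡ 0

      record Searching (t n m : ℕ) : Set where
        constructor searching
        field
          {ρ}     : Store
          at-head : At t nothing ρ
          counter : num ρ 0 ≡ n
          prefix  : ρ 1 ≡ hist m

      open Rounds markedAt Zero Searching hiding (Unmarked; marks⇒zeros; zeros⇒marks)

      private
        partBody : Part body
        partBody = part-body part-whole
        partReact : Part react
        partReact = part-fst (part-snd partBody)
        partRefill : Part refill
        partRefill = part-snd (part-snd partBody)

        record Restart (t₀ t n m : ℕ) : Set where
          constructor restart
          field
            {t′ m′}  : ℕ
            later    : t < t′
            unmarked : Unmarked t t′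
            searches : Searching t′ n m′
            refilled : Refilled t₀ m m′

        refill-correct : ∀ {t₀ t ρ n} m → t₀ ≤ t → At t (at partRefill (entry refill)) ρ → num ρ 0 ≡ n → ρ 1 ≡ hist m → Restart t₀ t n m
        refill-correct {ρ = ρ} (suc m) le a en em with exec partRefill (e-then (cong (test nonempty ∘ head) em) e-assign) a
        ... | reach lt a′ un = restart lt un (searching a′ en (cong (apply pop) em)) (inj₁ refl)
        refill-correct {t₀} {t} {ρ} zero le a en em = restart (≤-trans lt₁ (<⇒≤ (Reach.later s₂))) (unmarked-trans un₁ (Reach.unmarked s₂))
          (searching (Reach.arrives s₂) en refl) (inj₂ (refl , ≤-trans le (n≤1+n t)))
          where
          eq : nextPos refill nothing (tops ρ) ≡ just (just (inj₂ tt))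
          eq rewrite em = refl
          s₁ : Reach t (at partRefill (just (inj₂ tt))) ρ
          s₁ = single partRefill nothing a refl (branch partRefill nothing a eq)
          lt₁ = Reach.later s₁
          un₁ = Reach.unmarked s₁
          -- The test took one step, so the history copied is that of time suc t.
          s₂ : Reach (suc t) nothing (ρ [ 1 ↦ hist (suc t) ])
          s₂ = single (part-else partRefill) tt (Reach.arrives s₁) refl (part-step (part-else partRefill) tt (Reach.arrives s₁))

      round : ∀ {t n m} → Searching t n m → Outcome t n m
      round {t} {n} {m} (searching {ρ} a en em) = continue (exec (part-fst partBody) E.runs a₁)
        where
        a₁ : At (suc t) (at partBody (entry body)) ρ
        a₁ = branch part-whole nothing a refl
        start : Reach t (at partBody (entry body)) ρ
        start = single part-whole nothing a refl a₁
        module E = Evaluated (evaluate-correct ρ)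
        value : num E.end 5 ≡ eval f (n ∷ prefixCode m ∷ [])
        value = trans E.value (cong₂ (λ n c → eval f (n ∷ c ∷ [])) en (trans (cong (codeFrom 0) em) (codeFrom-hist m)))
        n′ : num E.end 0 ≡ n
        n′ = trans (cong length (E.keeps 0 (s≤s z≤n))) en
        m′ : E.end 1 ≡ hist m
        m′ = trans (E.keeps 1 (s≤s (s≤s z≤n))) em
        continue : Reach (suc t) (at partReact (entry react)) E.end → Outcome t n m
        continue (reach {t₂} lt₂ a₂ un₂) = decide (E.end 5) refl
          where
          t≤t₂ : t ≤ t₂
          t≤t₂ = ≤-trans (n≤1+n t) (<⇒≤ lt₂)
          decide : ∀ l → E.end 5 ≡ l → Outcome t n m
          decide (b ∷ l) e5 with exec partReact (e-then (cong (test nonempty ∘ head) e5) e-assign) a₂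
          ... | reach {t₃} lt₃ a₃ un₃ with refill-correct {t₀ = t} m (≤-trans t≤t₂ (<⇒≤ lt₃)) a₃
                  n′ m′
          ... | restart lt₄ un₄ s r = miss (λ z → nonzero (trans (sym (cong length e5)) (trans value z)))
                  (≤-trans (s≤s t≤t₂) (≤-trans lt₃ (<⇒≤ lt₄)))
                  (unmarked-trans (Reach.unmarked start) (unmarked-trans un₂ (unmarked-trans un₃ un₄))) s r
            where
            nonzero : ∀ {k} → ¬ suc k ≡ 0
            nonzero ()
          decide [] e5 = finish (refill-correct {t₀ = t} m (≤-trans t≤t₂ (≤-trans (n≤1+n _) (≤-trans (n≤1+n _) (≤-trans (n≤1+n _) (n≤1+n _))))) a₆
              (cong (1 +_) n′) m′)
            where
            eq : nextPos react nothing (tops E.end) ≡ just (just (inj₂ (inj₁ tt)))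
            eq rewrite e5 = refl
            partHit = part-else partReact
            -- Marked steps are outside `Exec` and are followed singly; the marks fall on the times
            -- t₂ + 1 and t₂ + 2.
            a₃ : At (suc t₂) (at partHit (inj₁ tt)) E.end
            a₃ = branch partReact nothing a₂ eq
            a₄ : At (suc (suc t₂)) (at partHit (inj₂ (inj₁ tt))) E.end
            a₄ = part-step partHit (inj₁ tt) a₃
            a₅ : At (suc (suc (suc t₂))) (at partHit (inj₂ (inj₂ tt))) E.end
            a₅ = part-step partHit (inj₂ (inj₁ tt)) a₄
            a₆ : At (suc (suc (suc (suc t₂)))) (at partRefill (entry refill)) (E.end [ 0 ↦ zero ∷ E.end 0 ])
            a₆ = part-step partHit (inj₂ (inj₂ tt)) a₅
            finish : Restart t (suc (suc (suc (suc t₂)))) (suc n) m → Outcome t n m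
            finish (restart lt _ s _) = hit (trans (sym value) (cong length e5)) (≤-trans t≤t₂ (n≤1+n t₂)) (≤-trans (n≤1+n _) (<⇒≤ lt))
              (trans (cong (marked search) (At.here a₃)) (marks partHit (inj₁ tt))) (trans (cong (marked search) (At.here a₄)) (marks partHit (inj₂ (inj₁ tt)))) s

      searching₀ : Searching 0 0 0
      searching₀ = searching (at-state refl refl) refl refl

      marks⇒zeros : (∀ N → ∃ λ t → N ≤ t × markedAt t ≡ true) → ∀ n → ∃ λ m → Zero n m
      marks⇒zeros = Rounds.marks⇒zeros markedAt Zero Searching searching₀ round

      zeros⇒marks : (∀ n → ∃ λ m → Zero n m) → ∀ N → ∃ λ t → N ≤ t × markedAt t ≡ true × markedAt (suc t) ≡ true
      zeros⇒marks = Rounds.zeros⇒marks markedAt Zero Searching searching₀ round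

-- The annotated game is equivalent to the original one.

module GameTransfer where
  open FiniteTypes
  open Automata
  open Games using (module Annotated)
  open Tree
  open ErrorDetection
  open PathAutomaton
  open import Data.Nat.Induction using (<-rec)
  open import Data.Fin using (Fin; suc)

  module AnnotatedGame (k : ℕ) (M : LocalMachine (Fin k)) (flag : LocalMachine.Ctl M → Bool)
    (fin₂ : Finite (Letters.Letter (finFin k) (double M))) (fin₁ : Finite (Fin k × Letters.Letter (finFin k) (double M))) where

    finX : Finite (Fin k)
    finX = finFin k

    open Letters finX (double M)
    open Errors finX (double M) using (rootLetter; _≟ˡ_; module Machines)
    open Path finX M flag

    -- Tape 1 alone carries the letters of the original game; each tape carries a copy of the
    -- annotation.
    Sym₁ Sym₂ : Set
    Sym₁ = Fin (size fin₁)
    Sym₂ = Fin (size fin₂)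

    noteOf₁ : Sym₁ × Sym₁ → Letter
    noteOf₁ (_ , b) = proj₂ (dec fin₁ b)

    noteOf₂ : Sym₂ × Sym₂ → Letter
    noteOf₂ (_ , b) = dec fin₂ b

    inputsOf : Sym₁ × Sym₁ → Fin k × Fin k
    inputsOf (a , b) = proj₁ (dec fin₁ a) , proj₁ (dec fin₁ b)

    open Machines {Sym₁ × Sym₁} {Sym₂ × Sym₂} noteOf₁ noteOf₂ inputsOf using (errors; Good; errors-sound; errors-complete)
    open Tapes {Sym₁ × Sym₁} {Sym₂ × Sym₂} noteOf₁ noteOf₂ using (path; path-sound; path-complete)

    components : Bool → Automaton (Sym₁ × Sym₁) (Sym₂ × Sym₂)
    components false = errors
    components true  = path

    automaton : TwoTapeBüchi Sym₁ Sym₂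
    automaton = TwoTape.recognizer (union components)

    R : (ℕ → Sym₁ × Sym₂) → Set
    R z = Accepts automaton (proj₁ ∘ z) (proj₂ ∘ z)

    letterOf : Sym₁ × Sym₂ → Fin k
    letterOf z = proj₁ (dec fin₁ (proj₁ z))

    noteOf : Sym₁ × Sym₂ → Letter × Letter
    noteOf z = proj₂ (dec fin₁ (proj₁ z)) , dec fin₂ (proj₂ z)

    mkSym : Fin k → Letter × Letter → Sym₁ × Sym₂
    mkSym x (l , l′) = enc fin₁ (x , l) , enc fin₂ l′

    annotation : (ℕ → Fin k) → ℕ → Letter × Letter
    annotation x j = letterAt x (addr j) , letterAt x (addr j)

    annotation-causal : ∀ x x′ j → (∀ i → i < suc j + suc j → x i ≡ x′ i) → annotation x j ≡ annotation x′ j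
    annotation-causal x x′ j e = cong (λ l → l , l) (letterAt-causal x x′ (addr j)
      (λ i lt → e i (≤-trans lt (≤-trans (lev≤ j) (m≤n⇒m≤1+n (m≤m+n j (suc j)))))))

    open Annotated letterOf noteOf mkSym
      (λ x n → cong proj₁ (dec-enc fin₁ (x , proj₁ n)))
      (λ x n → cong₂ _,_ (cong proj₂ (dec-enc fin₁ (x , proj₁ n))) (dec-enc fin₂ (proj₂ n)))
      (rootLetter , rootLetter) annotation annotation-causal

    module _ (L : (ℕ → Fin k) → Set) (L-ext : ∀ {x x′} → (∀ i → x i ≡ x′ i) → L x → L x′)
       (flags⇒L : ∀ x β → (∀ N → ∃ λ t → N ≤ t × Flagged x (revs β t) ≡ true) → L x)
       (L⇒flags : ∀ x → L x → ∃ λ β → ∀ N → ∃ λ t → N ≤ t × Flagged x (revs β t) ≡ true) where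

      module _ (z : ℕ → Sym₁ × Sym₂) where
        private
          x : ℕ → Fin k
          x = letterOf ∘ z
          u : ℕ → Sym₁ × Sym₁
          u = rounds (proj₁ ∘ z)
          v : ℕ → Sym₂ × Sym₂
          v = rounds (proj₂ ∘ z)

        game-sound : Correct z → R z → L (letterOf ∘ z)
        game-sound correct r = cases (union-sound components u v (TwoTape.recognizer-sound (union components) (proj₁ ∘ z) (proj₂ ∘ z) r))
          where
          good : ∀ p → Good u v x (λ _ → refl) p
          good p = cong proj₁ (correct p) , cong proj₂ (correct p)
          cases : (∃ λ c → Accepted (components c) u v) → L x
          cases (false , a) = ⊥-elim (errors-sound u v x (λ _ → refl) good a)
          cases (true  , a) = let β , inf = path-sound u v x (proj₁ ∘ good) (proj₂ ∘ good) a in flags⇒L x β inf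

        -- If the automaton rejects, no position is a first error, so by induction the annotation is
        -- correct everywhere; a witness β for L would then make `path` accept.
        game-complete : ¬ R z → ¬ L (letterOf ∘ z)
        game-complete ¬r l = ¬r (accepted true (let β , inf = L⇒flags x l in path-complete u v x (proj₁ ∘ good) (proj₂ ∘ good) β inf))
          where
          accepted : ∀ c → Accepted (components c) u v → R z
          accepted c a = TwoTape.recognizer-complete (union components) (proj₁ ∘ z) (proj₂ ∘ z) (union-complete components u v c a)
          decide : ∀ p → Dec (Good u v x (λ _ → refl) p)
          decide p with noteOf₁ (u p) ≟ˡ letterAt x (addr p) | noteOf₂ (v p) ≟ˡ letterAt x (addr p)
          ... | yes e₁ | yes e₂ = yes (e₁ , e₂)
          ... | no ne  | _      = no (ne ∘ proj₁)
          ... | yes _  | no ne  = no (ne ∘ proj₂)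
          good : ∀ p → Good u v x (λ _ → refl) p
          good = <-rec _ λ p below → stable p (λ q lt → below lt)
            where
            stable : ∀ p → (∀ q → q < p → Good u v x (λ _ → refl) q) → Good u v x (λ _ → refl) p
            stable p below with decide p
            ... | yes g = g
            ... | no ¬g = ⊥-elim (¬r (accepted false (errors-complete u v x (λ _ → refl) p below ¬g)))

      transfer : Determined R → Determined L
      transfer = determined R L L-ext game-sound game-complete

-- From determinacy of rational relations to determinacy of Σ¹₁ sets.

module Reduction where
  open FiniteTypes
  open Tree
  open PathAutomaton
  open Machine
  open SearchProgram
  open GameTransfer
  open import Data.Fin using (Fin; zero; suc; toℕ; inject₁; combine)
  open import Data.Fin.Properties using (toℕ-inject₁; toℕ-combine)
  open import Data.Vec using ([]; _∷_)
  open import Data.List using ([]; _∷_)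

  mapL-take : ∀ {A B : Set} {C : Set} (g : A → C) (h : B → C) (u : ℕ → A) (v : ℕ → B) →
    (∀ i → g (u i) ≡ h (v i)) → ∀ m → mapL g (take m u) ≡ mapL h (take m v)
  mapL-take g h u v e zero    = refl
  mapL-take g h u v e (suc m) = cong₂ _∷_ (e 0) (mapL-take g h (u ∘ suc) (v ∘ suc) (e ∘ suc) m)

  module Σ¹₁Game (k : ℕ) (f : PR 2) (L : (ℕ → Fin k) → Set)
    (L-def : ∀ x → L x ⇔ (∃ λ (b : ℕ → Fin 2) → ∀ n → ∃ λ m →
      eval f (n ∷ codeList (mapL pairCode (take m (λ i → x i , b i))) ∷ []) ≡ 0))
    (search : Cmd)
    (marks⇒zeros : ∀ y → (∀ N → ∃ λ t → N ≤ t × Stacks.Program.Run.markedAt (k * 2) search y t ≡ true) →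
      ∀ n → ∃ λ m → eval f (n ∷ codeList (mapL toℕ (take m y)) ∷ []) ≡ 0)
    (zeros⇒marks : ∀ y → (∀ n → ∃ λ m → eval f (n ∷ codeList (mapL toℕ (take m y)) ∷ []) ≡ 0) →
      ∀ N → ∃ λ t → N ≤ t × Stacks.Program.Run.markedAt (k * 2) search y t ≡ true ×
                             Stacks.Program.Run.markedAt (k * 2) search y (suc t) ≡ true) where

    bit : Bool → Fin 2
    bit false = zero
    bit true  = suc zero

    isOne : Fin 2 → Bool
    isOne zero    = false
    isOne (suc _) = true

    bit-isOne : ∀ b → bit (isOne b) ≡ b
    bit-isOne zero       = refl
    bit-isOne (suc zero) = refl

    -- Numbered so that its value is the `pairCode` used in the definition of Π⁰₂. The spare element
    -- of the codomain keeps `Item` inhabited even for k = 0.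
    item : Fin k → Bool → Fin (suc (k * 2))
    item x b = inject₁ (combine x (bit b))

    toℕ-item : ∀ x b → toℕ (item x b) ≡ pairCode (x , bit b)
    toℕ-item x b = trans (toℕ-inject₁ _) (toℕ-combine x (bit b))

    open Stacks (k * 2) using (marked; module Program)

    M : LocalMachine (Fin k)
    M = Program.machine search item

    open Path (finFin k) M (marked search) using (runM; revs; length-revs; Flagged)

    module _ (x : ℕ → Fin k) (β : ℕ → Bool) where

      input-items : ℕ → Fin (suc (k * 2))
      input-items t = item (x t) (β t)

      open Program.Run search input-items using (markedAt)

      control-at : ∀ t → marked search (LocalMachine.ctl M (runM x (revs β t))) ≡ markedAt t
      control-at t = cong (marked search) (Program.control-run search item x β (λ t → runM x (revs β t)) refl
        (λ t → cong (λ i → LocalMachine.step M (β t) (x i) (runM x (revs β t))) (length-revs β t)) t)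

      codes : ∀ (b : ℕ → Fin 2) → (∀ t → bit (β t) ≡ b t) → ∀ m →
        codeList (mapL toℕ (take m input-items)) ≡ codeList (mapL pairCode (take m (λ i → x i , b i)))
      codes b e m = cong codeList (mapL-take toℕ pairCode input-items (λ i → x i , b i)
        (λ i → trans (toℕ-item (x i) (β i)) (cong (λ c → pairCode (x i , c)) (e i))) m)

      flags⇒L : (∀ N → ∃ λ t → N ≤ t × Flagged x (revs β t) ≡ true) → L x
      flags⇒L inf = Equivalence.from (L-def x) (bit ∘ β , λ n → let m , z = marks⇒zeros input-items marks n in
          m , trans (cong (λ c → eval f (n ∷ c ∷ [])) (sym (codes (bit ∘ β) (λ _ → refl) m))) z)
        where
        snd : ∀ {a b} → a ∧ b ≡ true → b ≡ true
        snd {true} e = e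
        marks : ∀ N → ∃ λ t → N ≤ t × markedAt t ≡ true
        marks N = let t , le , f = inf N in t , le , trans (sym (control-at t)) (snd {parity (revs β t)} f)

    L⇒flags : ∀ x → L x → ∃ λ β → ∀ N → ∃ λ t → N ≤ t × Flagged x (revs β t) ≡ true
    L⇒flags x l = β , flags
      where
      b = proj₁ (Equivalence.to (L-def x) l)
      zeros = proj₂ (Equivalence.to (L-def x) l)
      β : ℕ → Bool
      β = isOne ∘ b
      open Program.Run search (input-items x β) using (markedAt)
      ∧-true : ∀ {a b} → a ≡ true → b ≡ true → a ∧ b ≡ true
      ∧-true refl refl = refl
      flags : ∀ N → ∃ λ t → N ≤ t × Flagged x (revs β t) ≡ true
      flags N with zeros⇒marks (input-items x β) (λ n → let m , z = zeros n in
                   m , trans (cong (λ c → eval f (n ∷ c ∷ [])) (codes x β b (λ t → bit-isOne (b t)) m)) z) N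
      -- Of two consecutive times one is even, and `Flagged` counts even times only; hence the
      -- double mark.
      ... | t , le , m₁ , m₂ with parity (revs β t) in e
      ...   | true  = t , le , ∧-true e (trans (control-at x β t) m₁)
      ...   | false = suc t , m≤n⇒m≤1+n le , ∧-true (cong not e) (trans (control-at x β (suc t)) m₂)

    L-ext : ∀ {x x′} → (∀ i → x i ≡ x′ i) → L x → L x′
    L-ext {x} {x′} e l = let b , zeros = Equivalence.to (L-def x) l in
      Equivalence.from (L-def x′) (b , λ n → let m , z = zeros n in m ,
        trans (cong (λ w → eval f (n ∷ codeList w ∷ []))
          (mapL-take pairCode pairCode (λ i → x′ i , b i) (λ i → x i , b i) (λ i → cong (λ a → pairCode (a , b i)) (sym (e i))) m)) z)

    open AnnotatedGame k M (marked search) (Letters.finLetter (finFin k) (double M))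
      (fin× (finFin k) (Letters.finLetter (finFin k) (double M))) using (transfer; automaton)

    determinedΣ¹₁ : DetRATω → Determined L
    determinedΣ¹₁ det = transfer L L-ext flags⇒L L⇒flags (det _ _ automaton)

  RAT⇒Σ¹₁ : DetRATω → DetΣ¹₁
  RAT⇒Σ¹₁ det k L (P , (f , P-def) , L-def) = Σ¹₁Game.determinedΣ¹₁ k f L
    (λ x → mk⇔
      (λ l → let b , p = Equivalence.to (L-def x) l in b , Equivalence.to (P-def _) p)
      (λ (b , z) → Equivalence.from (L-def x) (b , Equivalence.from (P-def _) z)))
    (Search.search (k * 2) f) (Search.marks⇒zeros (k * 2) f) (Search.zeros⇒marks (k * 2) f) det

-- A toolkit of primitive recursive functions and the decoding of words.

module Recursive where
  open import Data.Nat using (pred; _^_; _∸_)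
  open import Data.Fin using (Fin; zero; suc)
  open import Data.Vec using (Vec; []; _∷_; lookup; head; tail)
  open import Data.List using ([]; _∷_)

  record IsPR {n} (F : Vec ℕ n → ℕ) : Set where
    constructor isPR
    field
      code    : PR n
      correct : ∀ xs → eval code xs ≡ F xs
  open IsPR public

  var : ∀ {n} (i : Fin n) → IsPR (λ xs → lookup xs i)
  var i = isPR (proj i) (λ _ → refl)

  call₁ : ∀ {n F A} → IsPR {1} F → IsPR {n} A → IsPR (λ xs → F (A xs ∷ []))
  call₁ {F = F} f a = isPR (comp (code f) (code a ∷ [])) (λ xs → trans (correct f _) (cong (λ x → F (x ∷ [])) (correct a xs)))

  call₂ : ∀ {n F A B} → IsPR {2} F → IsPR {n} A → IsPR {n} B → IsPR (λ xs → F (A xs ∷ B xs ∷ []))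
  call₂ {F = F} f a b = isPR (comp (code f) (code a ∷ code b ∷ []))
    (λ xs → trans (correct f _) (cong₂ (λ x y → F (x ∷ y ∷ [])) (correct a xs) (correct b xs)))

  call₃ : ∀ {n F A B C} → IsPR {3} F → IsPR {n} A → IsPR {n} B → IsPR {n} C → IsPR (λ xs → F (A xs ∷ B xs ∷ C xs ∷ []))
  call₃ {F = F} f a b c = isPR (comp (code f) (code a ∷ code b ∷ code c ∷ []))
    (λ xs → trans (correct f _) (trans (cong (λ x → F (x ∷ _)) (correct a xs))
      (cong₂ (λ y z → F (_ ∷ y ∷ z ∷ [])) (correct b xs) (correct c xs))))

  sucP : ∀ {n F} → IsPR {n} F → IsPR (λ xs → suc (F xs))
  sucP f = isPR (comp succ (code f ∷ [])) (λ xs → cong suc (correct f xs))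

  const : ∀ {n} k → IsPR {n} (λ _ → k)
  const zero    = isPR zer (λ _ → refl)
  const (suc k) = sucP (const k)

  recursion : ∀ {n} → (Vec ℕ n → ℕ) → (Vec ℕ (suc (suc n)) → ℕ) → ℕ → Vec ℕ n → ℕ
  recursion B S zero    xs = B xs
  recursion B S (suc y) xs = S (recursion B S y xs ∷ y ∷ xs)

  recP : ∀ {n B S} → IsPR {n} B → IsPR {suc (suc n)} S → IsPR (λ xs → recursion B S (head xs) (tail xs))
  recP {B = B} {S} b s = isPR (prec (code b) (code s)) (λ { (y ∷ xs) → go y xs })
    where
    go : ∀ y xs → evalRec (code b) (code s) y xs ≡ recursion B S y xs
    go zero    xs = correct b xs
    go (suc y) xs = trans (correct s _) (cong (λ r → S (r ∷ y ∷ xs)) (go y xs))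

  extensional : ∀ {n F G} → IsPR {n} F → (∀ xs → F xs ≡ G xs) → IsPR G
  extensional f e = isPR (code f) (λ xs → trans (correct f xs) (e xs))

  plus₂ : IsPR {2} (λ xs → lookup xs zero + lookup xs (suc zero))
  plus₂ = extensional (recP (var zero) (sucP (var zero))) (λ { (y ∷ x ∷ []) → go y x })
    where
    go : ∀ y x → recursion (λ xs → lookup xs zero) (λ xs → suc (lookup xs zero)) y (x ∷ []) ≡ y + x
    go zero    x = refl
    go (suc y) x = cong suc (go y x)

  infixl 6 _⊕_ _⊖_
  infixl 7 _⊗_

  _⊕_ : ∀ {n F G} → IsPR {n} F → IsPR {n} G → IsPR (λ xs → F xs + G xs)
  f ⊕ g = call₂ plus₂ f g

  times₂ : IsPR {2} (λ xs → lookup xs zero * lookup xs (suc zero))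
  times₂ = extensional (recP (const 0) (var (suc (suc zero)) ⊕ var zero)) (λ { (y ∷ x ∷ []) → go y x })
    where
    go : ∀ y x → recursion (λ xs → 0) (λ xs → lookup xs (suc (suc zero)) + lookup xs zero) y (x ∷ []) ≡ y * x
    go zero    x = refl
    go (suc y) x = cong (x +_) (go y x)

  _⊗_ : ∀ {n F G} → IsPR {n} F → IsPR {n} G → IsPR (λ xs → F xs * G xs)
  f ⊗ g = call₂ times₂ f g

  predP : IsPR {1} (λ xs → pred (lookup xs zero))
  predP = extensional (recP (const 0) (var (suc zero))) (λ { (zero ∷ []) → refl ; (suc y ∷ []) → refl })

  monus₂ : IsPR {2} (λ xs → lookup xs (suc zero) ∸ lookup xs zero)
  monus₂ = extensional (recP (var zero) (call₁ predP (var zero))) (λ { (y ∷ x ∷ []) → go y x })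
    where
    go : ∀ y x → recursion (λ xs → lookup xs zero) (λ xs → pred (lookup xs zero)) y (x ∷ []) ≡ x ∸ y
    go zero    x = refl
    go (suc y) x = trans (cong pred (go y x)) (pred[m∸n]≡m∸[1+n] x y)

  _⊖_ : ∀ {n F G} → IsPR {n} F → IsPR {n} G → IsPR (λ xs → F xs ∸ G xs)
  f ⊖ g = call₂ monus₂ g f

  sum : ℕ → (ℕ → ℕ) → ℕ
  sum zero    F = 0
  sum (suc n) F = F n + sum n F

  prod : ℕ → (ℕ → ℕ) → ℕ
  prod zero    F = 1
  prod (suc n) F = F n * prod n F

  vars : ∀ {n} m → (Fin m → PR n) → Vec (PR n) m
  vars zero    g = []
  vars (suc m) g = g zero ∷ vars m (g ∘ suc)

  vars-correct : ∀ {n} m (g : Fin m → PR n) {xs} (ys : Vec ℕ m) → (∀ i → eval (g i) xs ≡ lookup ys i) → evalVec (vars m g) xs ≡ ys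
  vars-correct zero    g []       e = refl
  vars-correct (suc m) g (y ∷ ys) e = cong₂ _∷_ (e zero) (vars-correct m (g ∘ suc) ys (e ∘ suc))

  bind : ∀ {n F A} → IsPR {suc n} F → IsPR {n} A → IsPR (λ xs → F (A xs ∷ xs))
  bind {n} {F} {A} f a = isPR (comp (code f) (code a ∷ vars n proj))
    (λ xs → trans (correct f _) (cong₂ (λ x ys → F (x ∷ ys)) (correct a xs) (vars-correct n proj xs (λ _ → refl))))

  -- In the recursion for a bounded sum or product the value so far comes before the index; this
  -- drops it.
  under : ∀ {n F} → IsPR {suc n} F → IsPR {suc (suc n)} (λ xs → F (lookup xs (suc zero) ∷ tail (tail xs)))
  under {n} {F} f = isPR (comp (code f) (proj (suc zero) ∷ vars n (λ i → proj (suc (suc i)))))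
    (λ { (a ∷ b ∷ xs) → trans (correct f _) (cong (λ ys → F (b ∷ ys)) (vars-correct n _ xs (λ _ → refl))) })

  sumP : ∀ {n F B} → IsPR {suc n} F → IsPR {n} B → IsPR (λ xs → sum (B xs) (λ i → F (i ∷ xs)))
  sumP {n} {F} f b = bind summing b
    where
    go : ∀ y xs → recursion (λ xs → 0) (λ xs → F (lookup xs (suc zero) ∷ tail (tail xs)) + lookup xs zero) y xs ≡ sum y (λ i → F (i ∷ xs))
    go zero    xs = refl
    go (suc y) xs = cong (F (y ∷ xs) +_) (go y xs)
    summing : IsPR {suc n} (λ xs → sum (head xs) (λ i → F (i ∷ tail xs)))
    summing = extensional (recP (const 0) (under f ⊕ var zero)) (λ { (y ∷ xs) → go y xs })

  prodP : ∀ {n F B} → IsPR {suc n} F → IsPR {n} B → IsPR (λ xs → prod (B xs) (λ i → F (i ∷ xs)))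
  prodP {n} {F} f b = bind multiplying b
    where
    go : ∀ y xs → recursion (λ xs → 1) (λ xs → F (lookup xs (suc zero) ∷ tail (tail xs)) * lookup xs zero) y xs ≡ prod y (λ i → F (i ∷ xs))
    go zero    xs = refl
    go (suc y) xs = cong (F (y ∷ xs) *_) (go y xs)
    multiplying : IsPR {suc n} (λ xs → prod (head xs) (λ i → F (i ∷ tail xs)))
    multiplying = extensional (recP (const 1) (under f ⊗ var zero)) (λ { (y ∷ xs) → go y xs })

  -- Vanishes exactly for equal arguments. Tests return 0 for success, so sums act as conjunctions
  -- and products as disjunctions.
  dist : ℕ → ℕ → ℕ
  dist a b = (a ∸ b) + (b ∸ a)

  distP : ∀ {n F G} → IsPR {n} F → IsPR {n} G → IsPR (λ xs → dist (F xs) (G xs))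
  distP f g = (f ⊖ g) ⊕ (g ⊖ f)

  dist-self : ∀ a → dist a a ≡ 0
  dist-self a rewrite n∸n≡0 a = refl

  dist-zero : ∀ a b → dist a b ≡ 0 → a ≡ b
  dist-zero a b e = ≤-antisym (m∸n≡0⇒m≤n (m+n≡0⇒m≡0 (a ∸ b) e)) (m∸n≡0⇒m≤n (m+n≡0⇒n≡0 (a ∸ b) e))

  ifZero : ℕ → ℕ → ℕ → ℕ
  ifZero zero    a b = a
  ifZero (suc _) a b = b

  ifZeroP : ∀ {n F G H} → IsPR {n} F → IsPR {n} G → IsPR {n} H → IsPR (λ xs → ifZero (F xs) (G xs) (H xs))
  ifZeroP f g h = call₃ choose f g h
    where
    choose : IsPR {3} (λ xs → ifZero (lookup xs zero) (lookup xs (suc zero)) (lookup xs (suc (suc zero))))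
    choose = extensional (recP (var zero) (var (suc (suc (suc zero)))))
      (λ { (zero ∷ a ∷ b ∷ []) → refl ; (suc y ∷ a ∷ b ∷ []) → refl })

  equal : ℕ → ℕ → ℕ
  equal a b = ifZero (dist a b) 1 0

  equal-self : ∀ a → equal a a ≡ 1
  equal-self a rewrite dist-self a = refl

  equal-distinct : ∀ a b → ¬ a ≡ b → equal a b ≡ 0
  equal-distinct a b ne with dist a b in e
  ... | zero  = ⊥-elim (ne (dist-zero a b e))
  ... | suc _ = refl

  powP : IsPR {1} (λ xs → 2 ^ lookup xs zero)
  powP = extensional (recP (const 1) (const 2 ⊗ var zero)) (λ { (y ∷ []) → go y })
    where
    go : ∀ y → recursion (λ xs → 1) (λ xs → 2 * lookup xs zero) y [] ≡ 2 ^ y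
    go zero    = refl
    go (suc y) = cong (2 *_) (go y)

  sum-zero : ∀ n F → (∀ i → i < n → F i ≡ 0) → sum n F ≡ 0
  sum-zero zero    F e = refl
  sum-zero (suc n) F e rewrite e n ≤-refl = sum-zero n F (λ i lt → e i (m≤n⇒m≤1+n lt))

  sum-single : ∀ n F a → a < n → (∀ i → ¬ i ≡ a → F i ≡ 0) → sum n F ≡ F a
  sum-single (suc n) F a lt e with m≤n⇒m<n∨m≡n lt
  ... | inj₁ (s≤s lt′) rewrite e n (>⇒≢ lt′) = sum-single n F a lt′ e
  ... | inj₂ refl = trans (cong (F n +_) (sum-zero n F (λ i i<n → e i (<⇒≢ i<n)))) (+-identityʳ (F n))

  cons : ℕ → ℕ → ℕ
  cons a w = 2 ^ a * suc (2 * w)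

  parity-clash : ∀ v w → ¬ suc (2 * v) ≡ 2 * w
  parity-clash v (suc w) e rewrite *-comm 2 v = go v w (trans (suc-injective e) (trans (+-suc w (w + 0)) (cong suc (*-comm 2 w))))
    where
    go : ∀ v w → ¬ v * 2 ≡ suc (w * 2)
    go (suc v) (suc w) e = go v w (suc-injective (suc-injective e))

  -- Powers of two are cancelled in parallel; if one exponent is exhausted first, an odd number
  -- would be even.
  cons-injective : ∀ a v b w → cons a v ≡ cons b w → a ≡ b × v ≡ w
  cons-injective zero v zero w e =
    refl , *-cancelˡ-≡ v w 2 (suc-injective (trans (sym (*-identityˡ (suc (2 * v)))) (trans e (*-identityˡ (suc (2 * w))))))
  cons-injective zero v (suc b) w e =
    ⊥-elim (parity-clash v (cons b w) (trans (sym (*-identityˡ (suc (2 * v)))) (trans e (*-assoc 2 (2 ^ b) _))))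
  cons-injective (suc a) v zero w e =
    ⊥-elim (parity-clash w (cons a v) (trans (sym (*-identityˡ (suc (2 * w)))) (trans (sym e) (*-assoc 2 (2 ^ a) _))))
  cons-injective (suc a) v (suc b) w e =
    let p , q = cons-injective a v b w (*-cancelˡ-≡ (cons a v) (cons b w) 2 (trans (sym (*-assoc 2 (2 ^ a) _)) (trans e (*-assoc 2 (2 ^ b) _)))) in
    cong suc p , q

  n<2^n : ∀ n → n < 2 ^ n
  n<2^n zero    = s≤s z≤n
  n<2^n (suc n) = ≤-trans (s≤s (n<2^n n)) (≤-trans (+-monoˡ-≤ (2 ^ n) (≤-trans (s≤s z≤n) (n<2^n n))) (≤-reflexive (cong (2 ^ n +_) (sym (+-identityʳ _)))))

  head<cons : ∀ a w → a < cons a w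
  head<cons a w = ≤-trans (n<2^n a) (m≤m*n (2 ^ a) (suc (2 * w)))

  tail<cons : ∀ a w → w < cons a w
  tail<cons a w = ≤-trans (s≤s (m≤m+n w _)) (m≤n*m (suc (2 * w)) (2 ^ a) {{m^n≢0 2 a}})

  -- The value of g at the decomposition of c as 2^i (2w + 1), and 0 if c = 0.
  decompose : (ℕ → ℕ → ℕ) → ℕ → ℕ
  decompose g c = sum c (λ i → sum c (λ w → g i w * equal (cons i w) c))

  -- Exponent and tail are both smaller than the code, so the bounded sums reach them, and by
  -- uniqueness of the decomposition just one summand survives.
  decompose-cons : ∀ g a v → decompose g (cons a v) ≡ g a v
  decompose-cons g a v = begin
    decompose g c ≡⟨ sum-single c _ a (head<cons a v) (λ i ne → sum-zero c _ (λ w _ → off i w (ne ∘ proj₁))) ⟩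
    sum c (λ w → g a w * equal (cons a w) c) ≡⟨ sum-single c _ v (tail<cons a v) (λ w ne → off a w (ne ∘ proj₂)) ⟩
    g a v * equal c c ≡⟨ cong (g a v *_) (equal-self c) ⟩
    g a v * 1 ≡⟨ *-identityʳ (g a v) ⟩
    g a v ∎
    where
    open ≡-Reasoning
    c = cons a v
    off : ∀ i w → ¬ (i ≡ a × w ≡ v) → g i w * equal (cons i w) c ≡ 0
    off i w ne = trans (cong (g i w *_) (equal-distinct (cons i w) c (ne ∘ cons-injective i w a v))) (*-zeroʳ (g i w))

  decomposeP : ∀ {g : ℕ → ℕ → ℕ} → IsPR {3} (λ xs → g (lookup xs (suc zero)) (lookup xs zero)) → IsPR {1} (λ xs → decompose g (lookup xs zero))
  decomposeP {g} p = extensional (sumP (sumP (p ⊗ eqP) (var (suc zero))) (var zero)) (λ { (c ∷ []) → refl })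
    where
    eqP : IsPR {3} (λ xs → equal (cons (lookup xs (suc zero)) (lookup xs zero)) (lookup xs (suc (suc zero))))
    eqP = ifZeroP (distP (call₁ powP (var (suc zero)) ⊗ sucP (const 2 ⊗ var zero)) (var (suc (suc zero)))) (const 1) (const 0)

  -- One plus the first letter, and the code of the remaining word.
  headOf tailOf : ℕ → ℕ
  headOf = decompose (λ i _ → suc i)
  tailOf = decompose (λ _ w → w)

  headP : IsPR {1} (λ xs → headOf (lookup xs zero))
  headP = decomposeP {g = λ i _ → suc i} (sucP (var (suc zero)))

  tailP : IsPR {1} (λ xs → tailOf (lookup xs zero))
  tailP = decomposeP {g = λ _ w → w} (var zero)

  tail-cons : ∀ a w → tailOf (cons a w) ≡ w
  tail-cons = decompose-cons (λ _ w → w)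

  dropCode : ℕ → ℕ → ℕ
  dropCode zero    c = c
  dropCode (suc j) c = tailOf (dropCode j c)

  -- The j-th letter plus one of a coded word, and 0 beyond its end.
  nthCode : ℕ → ℕ → ℕ
  nthCode c j = headOf (dropCode j c)

  nthCodeP : ∀ {n C J} → IsPR {n} C → IsPR {n} J → IsPR (λ xs → nthCode (C xs) (J xs))
  nthCodeP c j = call₂ (call₁ headP dropP) j c
    where
    dropP : IsPR {2} (λ xs → dropCode (lookup xs zero) (lookup xs (suc zero)))
    dropP = extensional (recP (var zero) (call₁ tailP (var zero))) (λ { (j ∷ c ∷ []) → go j c })
      where
      go : ∀ j c → recursion (λ xs → lookup xs zero) (λ xs → tailOf (lookup xs zero)) j (c ∷ []) ≡ dropCode j c
      go zero    c = refl
      go (suc j) c = cong tailOf (go j c)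

  dropCode-suc : ∀ j c → dropCode (suc j) c ≡ dropCode j (tailOf c)
  dropCode-suc zero    c = refl
  dropCode-suc (suc j) c = cong tailOf (dropCode-suc j c)

  module _ {A : Set} (h : A → ℕ) where

    prefixCode : (ℕ → A) → ℕ → ℕ
    prefixCode y m = codeList (mapL h (take m y))

    nthCode-below : ∀ m y j → j < m → nthCode (prefixCode y m) j ≡ suc (h (y j))
    nthCode-below (suc m) y zero lt = decompose-cons (λ i _ → suc i) (h (y 0)) (prefixCode (y ∘ suc) m)
    nthCode-below (suc m) y (suc j) (s≤s lt) = trans (cong headOf
      (trans (dropCode-suc j (prefixCode y (suc m))) (cong (dropCode j) (tail-cons (h (y 0)) (prefixCode (y ∘ suc) m)))))
      (nthCode-below m (y ∘ suc) j lt)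

    nthCode-beyond : ∀ m y j → m ≤ j → nthCode (prefixCode y m) j ≡ 0
    nthCode-beyond zero y j le = cong headOf (drop-empty j)
      where
      drop-empty : ∀ j → dropCode j 0 ≡ 0
      drop-empty zero    = refl
      drop-empty (suc j) = cong tailOf (drop-empty j)
    nthCode-beyond (suc m) y (suc j) (s≤s le) = trans (cong headOf
      (trans (dropCode-suc j (prefixCode y (suc m))) (cong (dropCode j) (tail-cons (h (y 0)) (prefixCode (y ∘ suc) m)))))
      (nthCode-beyond m (y ∘ suc) j le)

    length≤prefixCode : ∀ m y → m ≤ prefixCode y m
    length≤prefixCode zero    y = z≤n
    length≤prefixCode (suc m) y = ≤-trans (s≤s (length≤prefixCode m (y ∘ suc))) (tail<cons (h (y 0)) (prefixCode (y ∘ suc) m))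

-- Acceptance by a two-tape automaton is Σ¹₁, and the remaining implication.

module Encode where
  open Recursive
  open Games using (module Annotated)
  open Automata using (concat⇒slices; slices⇒concat; take-cong)
  open import Data.Nat using (_∸_; _⊔_; _/_; _%_; NonZero)
  open import Data.Fin using (Fin; zero; suc; toℕ; combine; remQuot)
  open import Data.Fin.Properties using (toℕ-injective; toℕ-combine; combine-injective; remQuot-combine; combine-remQuot; toℕ<n)
  open import Data.Vec using (Vec; []; _∷_; lookup)
  open import Data.List using (List; []; _∷_; length; map; allFin; cartesianProduct)
  open import Data.List.Properties using (length-++)
  open import Data.List.Membership.Propositional using (_∈_)
  open import Data.List.Membership.Propositional.Properties using (∈-map⁺; ∈-map⁻; ∈-allFin; ∈-cartesianProduct⁺)
  open import Data.List.Relation.Unary.Any using (here; there; index)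
  open import Data.List.Relation.Unary.Any.Properties using (lookup-index)
  open import Data.Nat.DivMod using ([m+kn]%n≡m%n; m<n⇒m%n≡m; m<n⇒m/n≡0; +-distrib-/-∣ʳ; m*n/n≡m)
  open import Data.Nat.Divisibility using (n∣m*n)
  open import Data.Vec.Properties using ([]=⇒lookup; lookup⇒[]=)

  -- Zero iff v is the successor of a member of the list.
  mem : List ℕ → ℕ → ℕ
  mem []       v = 1
  mem (c ∷ cs) v = dist v (suc c) * mem cs v

  mem-complete : ∀ {cs c} → c ∈ cs → mem cs (suc c) ≡ 0
  mem-complete {c = c} (here refl) rewrite dist-self (suc c) = refl
  mem-complete {c′ ∷ cs} {c} (there i) = trans (cong (dist (suc c) (suc c′) *_) (mem-complete i)) (*-zeroʳ (dist (suc c) (suc c′)))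

  mem-sound : ∀ cs {v} → mem cs v ≡ 0 → ∃ λ c → c ∈ cs × v ≡ suc c
  mem-sound (c ∷ cs) {v} e with m*n≡0⇒m≡0∨n≡0 (dist v (suc c)) e
  ... | inj₁ d = c , here refl , dist-zero v (suc c) d
  ... | inj₂ r = let c′ , i , e′ = mem-sound cs r in c′ , there i , e′

  memP : ∀ {n V} cs → IsPR {n} V → IsPR (λ xs → mem cs (V xs))
  memP []       v = const 1
  memP (c ∷ cs) v = distP v (const (suc c)) ⊗ memP cs v

  select : {A : Set} → ℕ → A → A → A
  select zero    a b = a
  select (suc _) a b = b

  sum-zero⁻ : ∀ n F → sum n F ≡ 0 → ∀ i → i < n → F i ≡ 0
  sum-zero⁻ (suc n) F e i lt with m≤n⇒m<n∨m≡n lt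
  ... | inj₁ (s≤s lt′) = sum-zero⁻ n F (m+n≡0⇒n≡0 (F n) e) i lt′
  ... | inj₂ refl = m+n≡0⇒m≡0 (F n) e

  sum-cong : ∀ n {F G} → (∀ i → i < n → F i ≡ G i) → sum n F ≡ sum n G
  sum-cong zero    e = refl
  sum-cong (suc n) e = cong₂ _+_ (e n ≤-refl) (sum-cong n (λ i lt → e i (m≤n⇒m≤1+n lt)))

  sum-mono : ∀ {m n} F → m ≤ n → sum m F ≤ sum n F
  sum-mono {n = n} F le with m≤n⇒m<n∨m≡n le
  ... | inj₂ refl = ≤-refl
  sum-mono {n = suc n} F le | inj₁ (s≤s lt) = ≤-trans (sum-mono F lt) (m≤n+m _ (F n))

  prod-zero : ∀ n F i → i < n → F i ≡ 0 → prod n F ≡ 0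
  prod-zero (suc n) F i lt e with m≤n⇒m<n∨m≡n lt
  ... | inj₁ (s≤s lt′) = trans (cong (F n *_) (prod-zero n F i lt′ e)) (*-zeroʳ (F n))
  ... | inj₂ refl = cong (_* prod n F) e

  prod-zero⁻ : ∀ n F → prod n F ≡ 0 → ∃ λ i → i < n × F i ≡ 0
  prod-zero⁻ (suc n) F e with m*n≡0⇒m≡0∨n≡0 (F n) e
  ... | inj₁ z = n , ≤-refl , z
  ... | inj₂ z = let i , lt , z′ = prod-zero⁻ n F z in i , m≤n⇒m≤1+n lt , z′

  module Encoding {s g : ℕ} (𝒜 : TwoTapeBüchi (Fin s) (Fin g)) where
    open TwoTapeBüchi 𝒜

    Tr : Set
    Tr = Transition 𝒜

    D : ℕ
    D = length Δ

    -- The witness bits come in blocks of D bits, the e-th bit of a block selecting the e-th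
    -- transition. Block t + 1 selects the t-th transition of the run and block 0 a transition
    -- ending in the accepting state to be visited infinitely often.
    letterCode : Fin (s * g) → Fin 2 → ℕ
    letterCode z b = pairCode (z , b)

    oneCodes : List ℕ
    oneCodes = map (λ z → letterCode z (suc zero)) (allFin (s * g))

    codes₁ : Fin s → List ℕ
    codes₁ σ = map (λ (γ , b) → letterCode (combine σ γ) b) (cartesianProduct (allFin g) (allFin 2))

    codes₂ : Fin g → List ℕ
    codes₂ γ = map (λ (σ , b) → letterCode (combine σ γ) b) (cartesianProduct (allFin s) (allFin 2))

    -- q gives one plus the letter code at a position and 0 where a prefix has ended, so unknown
    -- bits count as unset. The first set bit of the block decides.
    find : (ℕ → ℕ) → List Tr → ℕ → Maybe Tr
    find q []       p = nothing
    find q (e ∷ es) p = select (mem oneCodes (q p)) (just e) (find q es (suc p))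

    trAt : (ℕ → ℕ) → ℕ → Maybe Tr
    trAt q t = find q Δ (t * D)

    findP : ∀ {n C P d} {F : Tr → Vec ℕ n → ℕ} es → IsPR {n} C → (∀ e → IsPR (F e)) → IsPR d → IsPR P →
      IsPR (λ xs → maybe′ (λ e → F e xs) (d xs) (find (nthCode (C xs)) es (P xs)))
    findP [] c f d p = d
    findP {C = C} {P} {d₀} {F} (e ∷ es) c f d p =
      extensional (ifZeroP (memP oneCodes (nthCodeP c p)) (f e) (findP es c f d (sucP p)))
        (λ xs → lemma xs (mem oneCodes (nthCode (C xs) (P xs))))
      where
      lemma : ∀ xs k → ifZero k (F e xs) (maybe′ (λ e → F e xs) (d₀ xs) (find (nthCode (C xs)) es (suc (P xs)))) ≡
        maybe′ (λ e → F e xs) (d₀ xs) (select k (just e) (find (nthCode (C xs)) es (suc (P xs))))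
      lemma xs zero    = refl
      lemma xs (suc k) = refl

    trAtP : ∀ {n C T d} {F : Tr → Vec ℕ n → ℕ} → IsPR {n} C → (∀ e → IsPR (F e)) → IsPR d → IsPR T →
      IsPR (λ xs → maybe′ (λ e → F e xs) (d xs) (trAt (nthCode (C xs)) (T xs)))
    trAtP c f d t = findP Δ c f d (t ⊗ const D)

    module Tape {A : Set} (codes : A → List ℕ) (word : Tr → List A) where

      len : (ℕ → ℕ) → ℕ → ℕ
      len q t = maybe′ (length ∘ word) 0 (trAt q (suc t))

      pos : (ℕ → ℕ) → ℕ → ℕ
      pos q T = sum T (len q)

      wordErr : (ℕ → ℕ) → ℕ → List A → ℕ
      wordErr q p []      = 0
      wordErr q p (a ∷ w) = mem (codes a) (q p) + wordErr q (suc p) w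

      posP : IsPR {2} (λ xs → pos (nthCode (lookup xs (suc zero))) (lookup xs zero))
      posP = extensional (sumP {F = λ xs → len (nthCode (lookup xs (suc (suc zero)))) (lookup xs zero)}
        (trAtP (var (suc (suc zero))) (λ e → const (length (word e))) (const 0) (sucP (var zero))) (var zero))
        (λ { (T ∷ c ∷ []) → refl })

      wordErrP : ∀ {n C P} → IsPR {n} C → IsPR P → ∀ w → IsPR (λ xs → wordErr (nthCode (C xs)) (P xs) w)
      wordErrP c p []      = const 0
      wordErrP c p (a ∷ w) = memP (codes a) (nthCodeP c p) ⊕ wordErrP c (sucP p) w

    module T₁ = Tape codes₁ (inU 𝒜)
    module T₂ = Tape codes₂ (inV 𝒜)

    stateBefore : (ℕ → ℕ) → ℕ → ℕ
    stateBefore q zero    = toℕ q₀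
    stateBefore q (suc t) = maybe′ (toℕ ∘ tgt 𝒜) 0 (trAt q (suc t))

    stepErr : (ℕ → ℕ) → ℕ → Tr → ℕ
    stepErr q t e = dist (toℕ (src 𝒜 e)) (stateBefore q t) +
      (T₁.wordErr q (T₁.pos q t) (inU 𝒜 e) + T₂.wordErr q (T₂.pos q t) (inV 𝒜 e))

    err : (ℕ → ℕ) → ℕ → ℕ
    err q t = maybe′ (stepErr q t) 1 (trAt q (suc t))

    rejecting : Fin nStates → ℕ
    rejecting p = if lookup F p then 0 else 1

    visitErr : (ℕ → ℕ) → ℕ → ℕ
    visitErr q T = maybe′ (λ e → maybe′ (λ e₀ → dist (toℕ (tgt 𝒜 e)) (toℕ (tgt 𝒜 e₀)) + rejecting (tgt 𝒜 e₀)) 1 (trAt q 0)) 1 (trAt q (suc T))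

    -- Vanishes iff the steps 0 to T are legal, transition T ends in the accepting state announced
    -- by block 0, T is at least n and both tapes have been used beyond n. Having such a T for every
    -- n means having a successful run on both whole tapes.
    defect : (ℕ → ℕ) → ℕ → ℕ → ℕ
    defect q n T = (sum (suc T) (err q) + visitErr q T) + ((n ∸ T) + ((suc n ∸ T₁.pos q T) + (suc n ∸ T₂.pos q T)))

    -- The existential quantifier over T is bounded by the code of the prefix, which is at least its
    -- length and thus grows without bound.
    testPR : IsPR {2} (λ xs → prod (lookup xs (suc zero)) (defect (nthCode (lookup xs (suc zero))) (lookup xs zero)))
    testPR = extensional (prodP defectP (var (suc zero))) (λ { (n ∷ c ∷ []) → refl })
      where
      stateP : IsPR {2} (λ xs → stateBefore (nthCode (lookup xs (suc zero))) (lookup xs zero))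
      stateP = extensional (recP (const (toℕ q₀)) (trAtP (var (suc (suc zero))) (λ e → const (toℕ (tgt 𝒜 e))) (const 0) (sucP (var (suc zero)))))
        (λ { (zero ∷ c ∷ []) → refl ; (suc t ∷ c ∷ []) → refl })
      errP : IsPR {2} (λ xs → err (nthCode (lookup xs (suc zero))) (lookup xs zero))
      errP = trAtP (var (suc zero))
        (λ e → distP (const (toℕ (src 𝒜 e))) (call₂ stateP (var zero) (var (suc zero))) ⊕
          (T₁.wordErrP (var (suc zero)) (call₂ T₁.posP (var zero) (var (suc zero))) (inU 𝒜 e) ⊕
           T₂.wordErrP (var (suc zero)) (call₂ T₂.posP (var zero) (var (suc zero))) (inV 𝒜 e)))
        (const 1) (sucP (var zero))
      visitP : IsPR {2} (λ xs → visitErr (nthCode (lookup xs (suc zero))) (lookup xs zero))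
      visitP = trAtP (var (suc zero)) (λ e → trAtP (var (suc zero)) (λ e₀ → const (dist (toℕ (tgt 𝒜 e)) (toℕ (tgt 𝒜 e₀)) + rejecting (tgt 𝒜 e₀))) (const 1) (const 0))
        (const 1) (sucP (var zero))
      defectP : IsPR {3} (λ xs → defect (nthCode (lookup xs (suc (suc zero)))) (lookup xs (suc zero)) (lookup xs zero))
      defectP = (sumP {F = λ xs → err (nthCode (lookup xs (suc (suc (suc zero))))) (lookup xs zero)}
                   (call₂ errP (var zero) (var (suc (suc (suc zero))))) (sucP (var zero)) ⊕ call₂ visitP (var zero) (var (suc (suc zero)))) ⊕
        ((var (suc zero) ⊖ var zero) ⊕ ((sucP (var (suc zero)) ⊖ call₂ T₁.posP (var zero) (var (suc (suc zero)))) ⊕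
          (sucP (var (suc zero)) ⊖ call₂ T₂.posP (var zero) (var (suc (suc zero))))))

    record Step (q : ℕ → ℕ) (t : ℕ) : Set where
      constructor stepping
      field
        {tr}   : Tr
        found  : trAt q (suc t) ≡ just tr
        source : toℕ (src 𝒜 tr) ≡ stateBefore q t
        word₁  : T₁.wordErr q (T₁.pos q t) (inU 𝒜 tr) ≡ 0
        word₂  : T₂.wordErr q (T₂.pos q t) (inV 𝒜 tr) ≡ 0
    open Step

    err⇒step : ∀ q t → err q t ≡ 0 → Step q t
    err⇒step q t e with trAt q (suc t) in f
    ... | just tr = stepping f (dist-zero _ _ (m+n≡0⇒m≡0 (dist (toℕ (src 𝒜 tr)) (stateBefore q t)) e))
            (m+n≡0⇒m≡0 (T₁.wordErr q (T₁.pos q t) (inU 𝒜 tr)) words) (m+n≡0⇒n≡0 (T₁.wordErr q (T₁.pos q t) (inU 𝒜 tr)) words)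
      where words = m+n≡0⇒n≡0 (dist (toℕ (src 𝒜 tr)) (stateBefore q t)) e

    step⇒err : ∀ q t → Step q t → err q t ≡ 0
    step⇒err q t (stepping {tr} f s w₁ w₂) = trans (cong (maybe′ (stepErr q t) 1) f)
      (cong₂ _+_ (trans (cong (λ a → dist a (stateBefore q t)) s) (dist-self (stateBefore q t))) (cong₂ _+_ w₁ w₂))

    record Visit (q : ℕ → ℕ) (T : ℕ) : Set where
      constructor visiting
      field
        {tr tr₀} : Tr
        found    : trAt q (suc T) ≡ just tr
        found₀   : trAt q 0 ≡ just tr₀
        same     : tgt 𝒜 tr ≡ tgt 𝒜 tr₀
        final    : lookup F (tgt 𝒜 tr₀) ≡ true

    err⇒visit : ∀ q T → visitErr q T ≡ 0 → Visit q T
    err⇒visit q T e with trAt q (suc T) in f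
    ... | just tr with trAt q 0 in f₀
    ...   | just tr₀ with lookup F (tgt 𝒜 tr₀) in l
    ...     | true  = visiting f f₀ (toℕ-injective (dist-zero _ _ (m+n≡0⇒m≡0 (dist (toℕ (tgt 𝒜 tr)) (toℕ (tgt 𝒜 tr₀))) e))) l
    ...     | false = ⊥-elim (impossible (m+n≡0⇒n≡0 (dist (toℕ (tgt 𝒜 tr)) (toℕ (tgt 𝒜 tr₀))) e))
      where impossible : ¬ 1 ≡ 0
            impossible ()

    visit⇒err : ∀ q T → Visit q T → visitErr q T ≡ 0
    visit⇒err q T (visiting {tr} {tr₀} f f₀ s l) rewrite f | f₀ | s | dist-self (toℕ (tgt 𝒜 tr₀)) | l = refl

    record Good (q : ℕ → ℕ) (n T : ℕ) : Set where
      field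
        steps : ∀ t → t ≤ T → Step q t
        visit : Visit q T
        late  : n ≤ T
        far₁  : n < T₁.pos q T
        far₂  : n < T₂.pos q T

    defect⇒good : ∀ q n T → defect q n T ≡ 0 → Good q n T
    defect⇒good q n T e = record
      { steps = λ t le → err⇒step q t (sum-zero⁻ (suc T) (err q) (m+n≡0⇒m≡0 _ l) t (s≤s le))
      ; visit = err⇒visit q T (m+n≡0⇒n≡0 (sum (suc T) (err q)) l)
      ; late = m∸n≡0⇒m≤n (m+n≡0⇒m≡0 (n ∸ T) r)
      ; far₁ = m∸n≡0⇒m≤n (m+n≡0⇒m≡0 (suc n ∸ T₁.pos q T) r′)
      ; far₂ = m∸n≡0⇒m≤n (m+n≡0⇒n≡0 (suc n ∸ T₁.pos q T) r′) }
      where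
      l = m+n≡0⇒m≡0 (sum (suc T) (err q) + visitErr q T) e
      r = m+n≡0⇒n≡0 (sum (suc T) (err q) + visitErr q T) e
      r′ = m+n≡0⇒n≡0 (n ∸ T) r

    good⇒defect : ∀ q n T → Good q n T → defect q n T ≡ 0
    good⇒defect q n T gd = cong₂ _+_
      (cong₂ _+_ (sum-zero (suc T) (err q) (λ t lt → step⇒err q t (steps t (≤-pred lt)))) (visit⇒err q T visit))
      (cong₂ _+_ (m≤n⇒m∸n≡0 late) (cong₂ _+_ (m≤n⇒m∸n≡0 far₁) (m≤n⇒m∸n≡0 far₂)))
      where open Good gd

    -- A finite approximation q of Q: what is found in q is found in Q ...
    module Approximation (m : ℕ) (q Q : ℕ → ℕ) (agree : ∀ j → j < m → q j ≡ Q j) (beyond : ∀ j → m ≤ j → q j ≡ 0) where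

      mem-mono : ∀ cs j → mem cs (q j) ≡ 0 → mem cs (Q j) ≡ 0
      mem-mono cs j e with <-≤-connex j m
      ... | inj₁ lt = trans (cong (mem cs) (sym (agree j lt))) e
      ... | inj₂ ge with mem-sound cs e
      ... | c , _ , e′ = ⊥-elim (impossible (trans (sym (beyond j ge)) e′))
        where impossible : ¬ 0 ≡ suc c
              impossible ()

      find-beyond : ∀ es p → m ≤ p → find q es p ≡ nothing
      find-beyond [] p ge = refl
      find-beyond (e ∷ es) p ge with mem oneCodes (q p) in eq
      ... | suc _ = find-beyond es (suc p) (m≤n⇒m≤1+n ge)
      ... | zero with mem-sound oneCodes eq
      ... | c , _ , e′ = ⊥-elim (impossible (trans (sym (beyond p ge)) e′))
        where impossible : ¬ 0 ≡ suc c
              impossible ()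

      find-mono : ∀ es p {e} → find q es p ≡ just e → find Q es p ≡ just e
      find-mono (x ∷ es) p f with <-≤-connex p m
      ... | inj₂ ge = ⊥-elim (nothing≢just (trans (sym (find-beyond (x ∷ es) p ge)) f))
        where nothing≢just : ∀ {e : Tr} → ¬ nothing ≡ just e
              nothing≢just ()
      ... | inj₁ lt rewrite agree p lt with mem oneCodes (Q p)
      ... | zero  = f
      ... | suc _ = find-mono es (suc p) f

      module _ {A : Set} (codes : A → List ℕ) (word : Tr → List A) where
        open Tape codes word

        wordErr-mono : ∀ p w → wordErr q p w ≡ 0 → wordErr Q p w ≡ 0
        wordErr-mono p []      e = refl
        wordErr-mono p (a ∷ w) e = cong₂ _+_ (mem-mono (codes a) p (m+n≡0⇒m≡0 _ e)) (wordErr-mono (suc p) w (m+n≡0⇒n≡0 (mem (codes a) (q p)) e))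

        pos-mono : ∀ T → (∀ t → t < T → Step q t) → pos q T ≡ pos Q T
        pos-mono T st = sum-cong T (λ t lt → cong (maybe′ (length ∘ word) 0) (trans (found (st t lt)) (sym (find-mono Δ _ (found (st t lt))))))

      good-mono : ∀ n T → Good q n T → Good Q n T
      good-mono n T gd = record
        { steps = λ t le → stepping (find-mono Δ _ (found (steps t le)))
            (trans (source (steps t le)) (state-mono t le))
            (subst (λ p → T₁.wordErr Q p (inU 𝒜 (tr (steps t le))) ≡ 0) (pos₁ t le)
              (wordErr-mono codes₁ (inU 𝒜) (T₁.pos q t) (inU 𝒜 (tr (steps t le))) (word₁ (steps t le))))
            (subst (λ p → T₂.wordErr Q p (inV 𝒜 (tr (steps t le))) ≡ 0) (pos₂ t le)
              (wordErr-mono codes₂ (inV 𝒜) (T₂.pos q t) (inV 𝒜 (tr (steps t le))) (word₂ (steps t le))))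
        ; visit = visiting (find-mono Δ _ V.found) (find-mono Δ _ V.found₀) V.same V.final
        ; late = late
        ; far₁ = subst (n <_) (pos₁ T ≤-refl) far₁
        ; far₂ = subst (n <_) (pos₂ T ≤-refl) far₂ }
        where
        open Good gd
        module V = Visit visit
        pos₁ : ∀ t → t ≤ T → T₁.pos q t ≡ T₁.pos Q t
        pos₁ t le = pos-mono codes₁ (inU 𝒜) t (λ t′ lt → steps t′ (≤-trans (<⇒≤ lt) le))
        pos₂ : ∀ t → t ≤ T → T₂.pos q t ≡ T₂.pos Q t
        pos₂ t le = pos-mono codes₂ (inV 𝒜) t (λ t′ lt → steps t′ (≤-trans (<⇒≤ lt) le))
        state-mono : ∀ t → t ≤ T → stateBefore q t ≡ stateBefore Q t
        state-mono zero    le = refl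
        state-mono (suc t) le = cong (maybe′ (toℕ ∘ tgt 𝒜) 0)
          (trans (found (steps t (<⇒≤ le))) (sym (find-mono Δ _ (found (steps t (<⇒≤ le))))))

      -- ... and conversely if q is long enough.
      find-agree : ∀ es p → p + length es ≤ m → find q es p ≡ find Q es p
      find-agree [] p le = refl
      find-agree (e ∷ es) p le = cong₂ (λ k r → select k (just e) r)
        (cong (mem oneCodes) (agree p (≤-trans (m<m+n p (s≤s z≤n)) le)))
        (find-agree es (suc p) (≤-trans (≤-reflexive (sym (+-suc p (length es)))) le))

      -- Transition T is in block T + 1, so T + 2 blocks of D bits must be known.
      module _ (T : ℕ) (long : suc (suc T) * D ≤ m) where

        trAt-agree : ∀ t → t ≤ suc T → trAt q t ≡ trAt Q t
        trAt-agree t le = find-agree Δ (t * D) (≤-trans (≤-reflexive (+-comm (t * D) D)) (≤-trans (*-monoˡ-≤ D (s≤s le)) long))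

        module _ {A : Set} (codes : A → List ℕ) (word : Tr → List A) where
          open Tape codes word

          wordErr-agree : ∀ p w → p + length w ≤ m → wordErr q p w ≡ wordErr Q p w
          wordErr-agree p []      le = refl
          wordErr-agree p (a ∷ w) le = cong₂ _+_
            (cong (mem (codes a)) (agree p (≤-trans (m<m+n p (s≤s z≤n)) le)))
            (wordErr-agree (suc p) w (≤-trans (≤-reflexive (sym (+-suc p (length w)))) le))

          pos-agree : ∀ t → t ≤ suc T → pos q t ≡ pos Q t
          pos-agree t le = sum-cong t (λ i lt → cong (maybe′ (length ∘ word) 0) (trAt-agree (suc i) (≤-trans lt le)))

          word-agree : pos Q (suc T) ≤ m → ∀ t → t ≤ T → (st : Step Q t) →
            wordErr Q (pos Q t) (word (tr st)) ≡ 0 → wordErr q (pos q t) (word (tr st)) ≡ 0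
          word-agree far t le st w = trans (cong (λ p → wordErr q p (word (tr st))) (pos-agree t (m≤n⇒m≤1+n le)))
            (trans (wordErr-agree (pos Q t) (word (tr st)) (≤-trans (≤-reflexive (trans (+-comm (pos Q t) _)
                (cong (λ x → maybe′ (length ∘ word) 0 x + pos Q t) (sym (found st))))) (≤-trans (sum-mono (len Q) (s≤s le)) far))) w)

        good-agree : T₁.pos Q (suc T) ≤ m → T₂.pos Q (suc T) ≤ m → ∀ n → Good Q n T → Good q n T
        good-agree far₁′ far₂′ n gd = record
          { steps = λ t le → stepping (trans (trAt-agree (suc t) (s≤s le)) (found (steps t le)))
              (trans (source (steps t le)) (sym (state-agree t le)))
              (word-agree codes₁ (inU 𝒜) far₁′ t le (steps t le) (word₁ (steps t le)))
              (word-agree codes₂ (inV 𝒜) far₂′ t le (steps t le) (word₂ (steps t le)))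
          ; visit = visiting (trans (trAt-agree (suc T) ≤-refl) V.found) (trans (trAt-agree 0 z≤n) V.found₀) V.same V.final
          ; late = late
          ; far₁ = subst (n <_) (sym (pos-agree codes₁ (inU 𝒜) T (n≤1+n T))) far₁
          ; far₂ = subst (n <_) (sym (pos-agree codes₂ (inV 𝒜) T (n≤1+n T))) far₂ }
          where
          open Good gd
          module V = Visit visit
          state-agree : ∀ t → t ≤ T → stateBefore q t ≡ stateBefore Q t
          state-agree zero    le = refl
          state-agree (suc t) le = cong (maybe′ (toℕ ∘ tgt 𝒜) 0) (trAt-agree (suc t) (m≤n⇒m≤1+n le))

    module Words {A : Set} (codes : A → List ℕ) (word : Tr → List A) (Q : ℕ → ℕ) (x : ℕ → A)
      (mem⇒ : ∀ j a → mem (codes a) (Q j) ≡ 0 → x j ≡ a) (mem⇐ : ∀ j → mem (codes (x j)) (Q j) ≡ 0) where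
      open Tape codes word

      wordErr⇒take : ∀ p w → wordErr Q p w ≡ 0 → w ≡ take (length w) (λ i → x (p + i))
      wordErr⇒take p []      e = refl
      wordErr⇒take p (a ∷ w) e = cong₂ _∷_ (sym (trans (cong x (+-identityʳ p)) (mem⇒ p a (m+n≡0⇒m≡0 _ e))))
        (trans (wordErr⇒take (suc p) w (m+n≡0⇒n≡0 (mem (codes a) (Q p)) e)) (take-cong (length w) (λ i → cong x (sym (+-suc p i)))))

      take⇒wordErr : ∀ p m → wordErr Q p (take m (λ i → x (p + i))) ≡ 0
      take⇒wordErr p zero    = refl
      take⇒wordErr p (suc m) = cong₂ _+_ (trans (cong (λ j → mem (codes (x j)) (Q p)) (+-identityʳ p)) (mem⇐ p))
        (trans (cong (wordErr Q (suc p)) (take-cong m (λ i → cong x (+-suc p i)))) (take⇒wordErr (suc p) m))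

      module _ (run : ℕ → Tr) (found : ∀ t → trAt Q (suc t) ≡ just (run t)) where

        length-concat : ∀ n → length (concatUpTo (word ∘ run) n) ≡ pos Q n
        length-concat zero    = refl
        length-concat (suc n) = trans (length-++ (concatUpTo (word ∘ run) n)) (trans (+-comm _ (length (word (run n))))
          (cong₂ _+_ (cong (maybe′ (length ∘ word) 0) (sym (found n))) (length-concat n)))

        concatIs : (∀ t → wordErr Q (pos Q t) (word (run t)) ≡ 0) → (∀ n → ∃ λ T → n < pos Q T) → ConcatIs (word ∘ run) x
        concatIs err far = slices⇒concat (word ∘ run) x
            (λ n → subst (λ p → word (run n) ≡ take (length (word (run n))) (λ i → x (p + i))) (sym (length-concat n))
                     (wordErr⇒take (pos Q n) (word (run n)) (err n))) ,
          λ n → let T , lt = far n in T , subst (n <_) (sym (length-concat T)) lt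

        concatIs⇒err : ConcatIs (word ∘ run) x → ∀ t → wordErr Q (pos Q t) (word (run t)) ≡ 0
        concatIs⇒err c t = subst (λ w → wordErr Q (pos Q t) w ≡ 0)
          (sym (trans (concat⇒slices (word ∘ run) x c t) (cong (λ p → take (length (word (run t))) (λ i → x (p + i))) (length-concat t))))
          (take⇒wordErr (pos Q t) (length (word (run t))))

    pairCode-injective : ∀ {z z′ : Fin (s * g)} {b b′} → pairCode (z , b) ≡ pairCode (z′ , b′) → z ≡ z′ × b ≡ b′
    pairCode-injective {z} {z′} {b} {b′} e = combine-injective z b z′ b′
      (toℕ-injective (trans (toℕ-combine z b) (trans e (sym (toℕ-combine z′ b′)))))

    module _ (z : ℕ → Fin (s * g)) (b : ℕ → Fin 2) where

      total : ℕ → ℕ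
      total j = suc (pairCode (z j , b j))

      tape₁ : ℕ → Fin s
      tape₁ j = proj₁ (remQuot g (z j))

      tape₂ : ℕ → Fin g
      tape₂ j = proj₂ (remQuot {s} g (z j))

      mem₁⇒ : ∀ j σ → mem (codes₁ σ) (total j) ≡ 0 → tape₁ j ≡ σ
      mem₁⇒ j σ e with mem-sound (codes₁ σ) e
      ... | c , i , e′ with ∈-map⁻ (λ (γ , b) → letterCode (combine σ γ) b) i
      ... | (γ , b′) , _ , refl = trans (cong (proj₁ ∘ remQuot g) (proj₁ (pairCode-injective (suc-injective e′)))) (cong proj₁ (remQuot-combine σ γ))

      mem₂⇒ : ∀ j γ → mem (codes₂ γ) (total j) ≡ 0 → tape₂ j ≡ γ
      mem₂⇒ j γ e with mem-sound (codes₂ γ) e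
      ... | c , i , e′ with ∈-map⁻ (λ (σ , b) → letterCode (combine σ γ) b) i
      ... | (σ , b′) , _ , refl = trans (cong (proj₂ ∘ remQuot {s} g) (proj₁ (pairCode-injective (suc-injective e′)))) (cong proj₂ (remQuot-combine σ γ))

      mem₁⇐ : ∀ j → mem (codes₁ (tape₁ j)) (total j) ≡ 0
      mem₁⇐ j = mem-complete {codes₁ (tape₁ j)} (subst (λ z → letterCode z (b j) ∈ codes₁ (tape₁ j)) (combine-remQuot {s} g (z j))
        (∈-map⁺ (λ (γ , b) → letterCode (combine (tape₁ j) γ) b) (∈-cartesianProduct⁺ (∈-allFin (tape₂ j)) (∈-allFin (b j)))))

      mem₂⇐ : ∀ j → mem (codes₂ (tape₂ j)) (total j) ≡ 0
      mem₂⇐ j = mem-complete {codes₂ (tape₂ j)} (subst (λ z → letterCode z (b j) ∈ codes₂ (tape₂ j)) (combine-remQuot {s} g (z j))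
        (∈-map⁺ (λ (σ , b) → letterCode (combine σ (tape₂ j)) b) (∈-cartesianProduct⁺ (∈-allFin (tape₁ j)) (∈-allFin (b j)))))

      module W₁ = Words codes₁ (inU 𝒜) total tape₁ mem₁⇒ mem₁⇐
      module W₂ = Words codes₂ (inV 𝒜) total tape₂ mem₂⇒ mem₂⇐

      find-∈ : ∀ es p {e} → find total es p ≡ just e → e ∈ es
      find-∈ (x ∷ es) p f with mem oneCodes (total p)
      find-∈ (x ∷ es) p refl | zero = here refl
      find-∈ (x ∷ es) p f | suc _ = there (find-∈ es (suc p) f)

      -- Step i comes from the instance n = i, which reaches that far. Block 0 is common to all
      -- instances, so the visits are all to one state.
      decode : (∀ n → ∃ λ T → Good total n T) → Accepts 𝒜 tape₁ tape₂
      decode inf = run , ((λ i → find-∈ Δ _ (found (st i))) , initial , chain) ,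
        (tgt 𝒜 V₀.tr₀ , lookup⇒[]= (tgt 𝒜 V₀.tr₀) F V₀.final , recurring) ,
        W₁.concatIs run (λ i → found (st i)) (λ i → word₁ (st i)) (λ n → proj₁ (inf n) , Good.far₁ (proj₂ (inf n))) ,
        W₂.concatIs run (λ i → found (st i)) (λ i → word₂ (st i)) (λ n → proj₁ (inf n) , Good.far₂ (proj₂ (inf n)))
        where
        st : ∀ i → Step total i
        st i = Good.steps (proj₂ (inf i)) i (Good.late (proj₂ (inf i)))
        run : ℕ → Tr
        run i = tr (st i)
        module V₀ = Visit (Good.visit (proj₂ (inf 0)))
        initial : src 𝒜 (run 0) ≡ q₀
        initial = toℕ-injective (source (st 0))
        chain : ∀ i → tgt 𝒜 (run i) ≡ src 𝒜 (run (suc i))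
        chain i = toℕ-injective (sym (trans (source (st (suc i))) (cong (maybe′ (toℕ ∘ tgt 𝒜) 0) (found (st i)))))
        just-injective : ∀ {a b : Tr} → just a ≡ just b → a ≡ b
        just-injective refl = refl
        recurring : ∀ n → ∃ λ m → n ≤ m × tgt 𝒜 (run m) ≡ tgt 𝒜 V₀.tr₀
        recurring n = proj₁ (inf n) , Good.late (proj₂ (inf n)) ,
          trans (cong (tgt 𝒜) (just-injective (trans (sym (found (st (proj₁ (inf n))))) V.found)))
            (trans V.same (cong (tgt 𝒜) (just-injective (trans (sym V.found₀) V₀.found₀))))
          where module V = Visit (Good.visit (proj₂ (inf n)))

      one⇒ : ∀ j → mem oneCodes (total j) ≡ 0 → b j ≡ suc zero
      one⇒ j e with mem-sound oneCodes e
      ... | c , i , e′ with ∈-map⁻ (λ z → letterCode z (suc zero)) i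
      ... | z′ , _ , refl = proj₂ (pairCode-injective {z j} {z′} (suc-injective e′))

      one⇐ : ∀ j → b j ≡ suc zero → mem oneCodes (total j) ≡ 0
      one⇐ j e = trans (cong (λ b → mem oneCodes (suc (pairCode (z j , b)))) e) (mem-complete {oneCodes} (∈-map⁺ (λ z → letterCode z (suc zero)) (∈-allFin (z j))))

      find-index : ∀ es p (i : Fin (length es)) → (∀ k → k < toℕ i → b (p + k) ≡ zero) → b (p + toℕ i) ≡ suc zero →
        find total es p ≡ just (Data.List.lookup es i)
      find-index (x ∷ es) p zero zeros one rewrite one⇐ p (trans (cong b (sym (+-identityʳ p))) one) = refl
      find-index (x ∷ es) p (suc i) zeros one with mem oneCodes (total p) in e
      ... | zero  = ⊥-elim (zero≢one (trans (sym (zeros 0 (s≤s z≤n))) (trans (cong b (+-identityʳ p)) (one⇒ p e))))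
        where zero≢one : ¬ _≡_ {A = Fin 2} zero (suc zero)
              zero≢one ()
      ... | suc _ = find-index es (suc p) i (λ k lt → trans (cong b (sym (+-suc p k))) (zeros (suc k) (s≤s lt))) (trans (cong b (sym (+-suc p (toℕ i)))) one)

    encode : ∀ z → Accepts 𝒜 (λ j → proj₁ (remQuot g (z j))) (λ j → proj₂ (remQuot {s} g (z j))) →
      ∃ λ b → ∀ n → ∃ λ T → Good (total z b) n T
    encode z (t , (t∈ , t₀ , chain) , (qF , qF∈ , inf) , c₁ , c₂) = b , good
      where
      blocks : ℕ → Tr
      -- Any transition of the run that ends in qF can announce this state.
      blocks zero    = t (proj₁ (inf 0))
      blocks (suc i) = t i
      blocks∈ : ∀ i → blocks i ∈ Δ
      blocks∈ zero    = t∈ (proj₁ (inf 0))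
      blocks∈ (suc i) = t∈ i
      instance
        D≢0 : NonZero D
        D≢0 with Δ | t∈ 0
        ... | _ ∷ _ | _ = _
      select-bit : ℕ → ℕ → Fin 2
      select-bit i r with i ≟ r
      ... | yes _ = suc zero
      ... | no _  = zero
      slot : ℕ → Fin D
      slot i = index (blocks∈ i)
      b : ℕ → Fin 2
      b j = select-bit (toℕ (slot (j / D))) (j % D)
      b-at : ∀ i k → k < D → b (i * D + k) ≡ select-bit (toℕ (slot i)) k
      b-at i k lt = cong₂ (λ i r → select-bit (toℕ (slot i)) r)
        (trans (cong (_/ D) (+-comm (i * D) k)) (trans (+-distrib-/-∣ʳ k (n∣m*n i)) (cong₂ _+_ (m<n⇒m/n≡0 lt) (m*n/n≡m i D))))
        (trans (cong (_% D) (+-comm (i * D) k)) (trans ([m+kn]%n≡m%n k i D) (m<n⇒m%n≡m lt)))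
      Q = total z b
      found-at : ∀ i → trAt Q i ≡ just (blocks i)
      found-at i = trans (find-index z b Δ (i * D) (slot i)
          (λ k lt → trans (b-at i k (<-trans lt (toℕ<n (slot i)))) (off k lt))
          (trans (b-at i (toℕ (slot i)) (toℕ<n (slot i))) on))
        (cong just (sym (lookup-index (blocks∈ i))))
        where
        off : ∀ k → k < toℕ (slot i) → select-bit (toℕ (slot i)) k ≡ zero
        off k lt with toℕ (slot i) ≟ k
        ... | yes e = ⊥-elim (<-irrefl (sym e) lt)
        ... | no _  = refl
        on : select-bit (toℕ (slot i)) (toℕ (slot i)) ≡ suc zero
        on with toℕ (slot i) ≟ toℕ (slot i)
        ... | yes _ = refl
        ... | no ne = ⊥-elim (ne refl)
      found-run : ∀ i → trAt Q (suc i) ≡ just (t i)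
      found-run i = found-at (suc i)
      steps : ∀ i → Step Q i
      steps i = stepping (found-run i) (states i)
        (W₁.concatIs⇒err z b t found-run c₁ i) (W₂.concatIs⇒err z b t found-run c₂ i)
        where
        states : ∀ i → toℕ (src 𝒜 (t i)) ≡ stateBefore Q i
        states zero    = cong toℕ t₀
        states (suc i) = trans (cong toℕ (sym (chain i))) (cong (maybe′ (toℕ ∘ tgt 𝒜) 0) (sym (found-run i)))
      good : ∀ n → ∃ λ T → Good Q n T
      good n = T , record
        { steps = λ i _ → steps i
        ; visit = visiting (found-run T) (found-at 0) (trans eT (sym (proj₂ (proj₂ (inf 0)))))
                    (trans (cong (lookup F) (proj₂ (proj₂ (inf 0)))) ([]=⇒lookup qF∈))
        ; late = ≤-trans (m≤m⊔n n (n₁ ⊔ n₂)) le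
        ; far₁ = ≤-trans (subst (n <_) (W₁.length-concat z b t found-run n₁) (proj₂ (proj₂ c₁ n)))
                   (sum-mono (T₁.len Q) (≤-trans (m≤m⊔n n₁ n₂) (≤-trans (m≤n⊔m n (n₁ ⊔ n₂)) le)))
        ; far₂ = ≤-trans (subst (n <_) (W₂.length-concat z b t found-run n₂) (proj₂ (proj₂ c₂ n)))
                   (sum-mono (T₂.len Q) (≤-trans (m≤n⊔m n₁ n₂) (≤-trans (m≤n⊔m n (n₁ ⊔ n₂)) le))) }
        where
        n₁ = proj₁ (proj₂ c₁ n)
        n₂ = proj₁ (proj₂ c₂ n)
        -- A visit to qF that is late enough for n and for both tapes to have passed position n.
        T = proj₁ (inf (n ⊔ (n₁ ⊔ n₂)))
        le = proj₁ (proj₂ (inf (n ⊔ (n₁ ⊔ n₂))))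
        eT = proj₂ (proj₂ (inf (n ⊔ (n₁ ⊔ n₂))))

    accepted-Σ¹₁ : IsΣ¹₁ (λ (z : ℕ → Fin (s * g)) → Accepts 𝒜 (λ j → proj₁ (remQuot g (z j))) (λ j → proj₂ (remQuot {s} g (z j))))
    accepted-Σ¹₁ = P , (code testPR , λ y → mk⇔ (λ p → p) (λ p → p)) , λ z → mk⇔ (to z) (from z)
      where
      P : (ℕ → Fin (s * g) × Fin 2) → Set
      P y = ∀ n → ∃ λ m → eval (code testPR) (n ∷ codeList (mapL pairCode (take m y)) ∷ []) ≡ 0
      module A z b m = Approximation m (nthCode (prefixCode pairCode (λ i → z i , b i) m)) (total z b)
        (λ j lt → nthCode-below pairCode m (λ i → z i , b i) j lt) (λ j le → nthCode-beyond pairCode m (λ i → z i , b i) j le)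
      to : ∀ z → Accepts 𝒜 (λ j → proj₁ (remQuot g (z j))) (λ j → proj₂ (remQuot {s} g (z j))) → ∃ λ b → P (λ i → z i , b i)
      to z a = let b , good = encode z a in b , λ n →
        let T , gd = good n
            Q = total z b
            -- Long enough for the blocks up to T + 1, for the letters that the steps up to T
            -- consume on either tape, and for T to lie below the bound of the product.
            m = suc (suc T) * D ⊔ (T₁.pos Q (suc T) ⊔ (T₂.pos Q (suc T) ⊔ suc T))
            c = prefixCode pairCode (λ i → z i , b i) m
            m₁ = m≤m⊔n (suc (suc T) * D) (T₁.pos Q (suc T) ⊔ (T₂.pos Q (suc T) ⊔ suc T))
            m₂ = m≤n⊔m (suc (suc T) * D) (T₁.pos Q (suc T) ⊔ (T₂.pos Q (suc T) ⊔ suc T))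
            m₃ = ≤-trans (m≤n⊔m (T₁.pos Q (suc T)) (T₂.pos Q (suc T) ⊔ suc T)) m₂
            gd′ = A.good-agree z b m T m₁ (≤-trans (m≤m⊔n _ _) m₂) (≤-trans (m≤m⊔n _ _) m₃) n gd
        in m , trans (correct testPR (n ∷ c ∷ [])) (prod-zero c (defect (nthCode c) n) T
             (≤-trans (≤-trans (m≤n⊔m (T₂.pos Q (suc T)) (suc T)) m₃) (length≤prefixCode pairCode m (λ i → z i , b i)))
             (good⇒defect (nthCode c) n T gd′))
      from : ∀ z → (∃ λ b → P (λ i → z i , b i)) → Accepts 𝒜 (λ j → proj₁ (remQuot g (z j))) (λ j → proj₂ (remQuot {s} g (z j)))
      from z (b , p) = decode z b (λ n →
        let m , e = p n
            c = prefixCode pairCode (λ i → z i , b i) m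
            T , _ , d = prod-zero⁻ c (defect (nthCode c) n) (trans (sym (correct testPR (n ∷ c ∷ []))) e)
        in T , A.good-mono z b m n T (defect⇒good (nthCode c) n T d))

  accepts-ext : ∀ {s g} (𝒜 : TwoTapeBüchi (Fin s) (Fin g)) {u u′ v v′} → (∀ i → u i ≡ u′ i) → (∀ i → v i ≡ v′ i) →
    Accepts 𝒜 u v → Accepts 𝒜 u′ v′
  accepts-ext 𝒜 eu ev (t , computation , recurring , c₁ , c₂) = t , computation , recurring , concat-ext eu c₁ , concat-ext ev c₂
    where
    concat-ext : ∀ {A : Set} {ws : ℕ → List A} {x y : ℕ → A} → (∀ i → x i ≡ y i) → ConcatIs ws x → ConcatIs ws y
    concat-ext e (c , far) = (λ n → trans (c n) (take-cong _ e)) , far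

  -- `DetΣ¹₁` speaks of alphabets `Fin k`, so pairs of letters are numbered; renaming the letters of
  -- a game is `Annotated` with a trivial annotation.
  Σ¹₁⇒RAT : DetΣ¹₁ → DetRATω
  Σ¹₁⇒RAT det s g 𝒜 = determined accepted (λ x → Accepts 𝒜 (proj₁ ∘ x) (proj₂ ∘ x))
    (λ e → accepts-ext 𝒜 (cong proj₁ ∘ e) (cong proj₂ ∘ e)) (λ _ _ r → r) (λ _ ¬r → ¬r)
    (det (s * g) accepted (Encoding.accepted-Σ¹₁ 𝒜))
    where
    accepted : (ℕ → Fin (s * g)) → Set
    accepted z = Accepts 𝒜 (λ j → proj₁ (remQuot g (z j))) (λ j → proj₂ (remQuot {s} g (z j)))
    open Annotated {N = ⊤} (remQuot g) (λ _ → tt) (λ (a , b) _ → combine a b) (λ (a , b) _ → remQuot-combine a b) (λ _ _ → refl) tt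
      (λ _ _ → tt) (λ _ _ _ _ → refl)

theorem3p5 : DetΣ¹₁ ⇔ DetRATω
theorem3p5 = mk⇔ Encode.Σ¹₁⇒RAT Reduction.RAT⇒Σ¹₁
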